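{- Let $a_n$ be the number of permutations of $[n]$ that strongly avoid the pattern $132$. The growth rate of $a_n$ is $2$, i.e. $\lim_{n\to\infty}a_n^{1/n}=2$; furthermore, $a_n<2^n$ for all sufficiently large $n$.
   Context: A permutation $\pi=\pi_1\pi_2\cdots\pi_n$ of $[n]=\{1,\dots,n\}$ (one-line notation, $\pi_i=\pi(i)$) avoids $132$ if there are no indices $i<j<k$ with $\pi_i<\pi_k<\pi_j$. The permutation $\pi$ strongly avoids $132$ if both $\pi$ and $\pi^2=\pi\circ\pi$ avoid $132$. The growth rate of a sequence $(a_n)$ is $\lim_{n\to\infty}a_n^{1/n}$. -}

module Defs where

import Algebra.Definitions.RawSemiring
open import Data.Fin.Base using (Fin; finToFun)
import Data.Fin.Base as Fin
import Data.Fin.Properties as Fin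
open import Data.Integer.Base using (+_)
open import Data.Nat.Base using (ℕ; zero; suc; NonZero)
import Data.Nat.Base as ℕ
open import Data.Product.Base using (∃; ∃-syntax; _×_; _,_; proj₁; proj₂)
open import Data.Rational.Base
  using (ℚ; 0ℚ; 1ℚ; -_; _+_; _-_; _*_; 1/_; _/_; _≤_; _<_;
         positive; nonNegative; >-nonZero; +-*-rawSemiring)
open import Data.Rational.Properties
open import Data.Sum.Base using (_⊎_; inj₁; inj₂)
open import Data.Vec.Base using (allFin; count)
open import Function.Base using (_∘_)
open import Function.Bundles using (_⇔_; mk⇔)
open import Function.Definitions using (Injective; Surjective; Bijective)
open import Relation.Binary.PropositionalEquality.Core
  using (_≡_; refl; sym; trans; cong; subst)
open import Relation.Nullary using (¬_; Dec; yes; no; contradiction)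
open import Relation.Nullary.Decidable
  using (map′; ¬?; _×-dec_; _→-dec_; from-yes)

------------------------------------------------------------------------
-- Permutations strongly avoiding 132

Avoids132 : ∀ {n} → (Fin n → Fin n) → Set
Avoids132 π = ¬ (∃[ i ] ∃[ j ] ∃[ k ]
  (i Fin.< j × j Fin.< k × π i Fin.< π k × π k Fin.< π j))

StronglyAvoids132 : ∀ {n} → (Fin n → Fin n) → Set
StronglyAvoids132 π = Avoids132 π × Avoids132 (π ∘ π)

IsPermutation : ∀ {n} → (Fin n → Fin n) → Set
IsPermutation = Bijective _≡_ _≡_

avoids132? : ∀ {n} (π : Fin n → Fin n) → Dec (Avoids132 π)
avoids132? π = ¬? (Fin.any? λ i → Fin.any? λ j → Fin.any? λ k →
  i Fin.<? j ×-dec j Fin.<? k ×-dec π i Fin.<? π k ×-dec π k Fin.<? π j)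

stronglyAvoids132? : ∀ {n} (π : Fin n → Fin n) → Dec (StronglyAvoids132 π)
stronglyAvoids132? π = avoids132? π ×-dec avoids132? (π ∘ π)

injective? : ∀ {n} (f : Fin n → Fin n) → Dec (Injective _≡_ _≡_ f)
injective? f = map′ (λ h {x} {y} → h x y) (λ h x y → h {x} {y})
  (Fin.all? λ x → Fin.all? λ y → (f x Fin.≟ f y) →-dec (x Fin.≟ y))

surjective? : ∀ {n} (f : Fin n → Fin n) → Dec (Surjective _≡_ _≡_ f)
surjective? f = map′
  (λ h y → proj₁ (h y) , λ { refl → proj₂ (h y) })
  (λ h y → proj₁ (h y) , proj₂ (h y) refl)
  (Fin.all? λ y → Fin.any? λ x → f x Fin.≟ y)

isPermutation? : ∀ {n} (f : Fin n → Fin n) → Dec (IsPermutation f)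
isPermutation? f = injective? f ×-dec surjective? f

-- As k runs over Fin (n ^ n), finToFun k runs over all maps
-- Fin n → Fin n, meeting each exactly once up to pointwise equality
-- (Fin.funToFin-finToFin, Fin.finToFun-funToFin).

numStronglyAvoiding132 : ℕ → ℕ
numStronglyAvoiding132 n =
  count (λ k → isPermutation? (f k) ×-dec stronglyAvoids132? (f k))
        (allFin (n ℕ.^ n))
  where
  f : Fin (n ℕ.^ n) → Fin n → Fin n
  f = finToFun

------------------------------------------------------------------------
-- Dedekind reals

-- Lower q means q < x, and Upper q means x < q.

record ℝ : Set₁ where
  field
    Lower Upper     : ℚ → Set
    lower-inhabited : ∃ Lower
    upper-inhabited : ∃ Upper
    lower-rounded   : ∀ p → Lower p ⇔ (∃[ q ] (p < q × Lower q))
    upper-rounded   : ∀ q → Upper q ⇔ (∃[ p ] (p < q × Upper p))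
    disjoint        : ∀ p → ¬ (Lower p × Upper p)
    located         : ∀ {p q} → p < q → Lower p ⊎ Upper q

-- Sequences are indexed by n ≥ 1.  For rational l and ε, the inequality
-- |x n − l| < ε reads l − ε < x n < l + ε.

_⟶_ : ((n : ℕ) → .{{NonZero n}} → ℝ) → ℚ → Set
x ⟶ l = ∀ ε → 0ℚ < ε → ∃[ N ] (∀ n → .{{_ : NonZero n}} → N ℕ.≤ n →
  ℝ.Lower (x n) (l - ε) × ℝ.Upper (x n) (l + ε))

------------------------------------------------------------------------
-- Powers of rationals

open Algebra.Definitions.RawSemiring +-*-rawSemiring public using (_^_)

private

  1>0 : 0ℚ < 1ℚ
  1>0 = from-yes (0ℚ <? 1ℚ)

  p<p+1 : ∀ p → p < p + 1ℚ
  p<p+1 p = subst (_< p + 1ℚ) (+-identityʳ p) (+-monoʳ-< p 1>0)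

  *-mono-≤ : ∀ {p q r s} → 0ℚ ≤ r → 0ℚ ≤ q → p ≤ q → r ≤ s → p * r ≤ q * s
  *-mono-≤ {p} {q} {r} {s} 0≤r 0≤q p≤q r≤s = ≤-trans
    (*-monoʳ-≤-nonNeg r {{nonNegative 0≤r}} p≤q)
    (*-monoˡ-≤-nonNeg q {{nonNegative 0≤q}} r≤s)

  *-pos : ∀ {p q} → 0ℚ < p → 0ℚ < q → 0ℚ < p * q
  *-pos {p} {q} 0<p 0<q = subst (_< p * q) (*-zeroˡ q)
    (*-monoˡ-<-pos q {{positive 0<q}} 0<p)

  ^-nonNeg : ∀ {p} n → 0ℚ ≤ p → 0ℚ ≤ p ^ n
  ^-nonNeg     zero    0≤p = <⇒≤ 1>0
  ^-nonNeg {p} (suc n) 0≤p = subst (_≤ p * p ^ n) (*-zeroˡ 0ℚ)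
    (*-mono-≤ ≤-refl 0≤p 0≤p (^-nonNeg n 0≤p))

  ^-pos : ∀ {p} n → 0ℚ < p → 0ℚ < p ^ n
  ^-pos zero    0<p = 1>0
  ^-pos (suc n) 0<p = *-pos 0<p (^-pos n 0<p)

  ^-mono-≤ : ∀ {p q} n → 0ℚ ≤ p → p ≤ q → p ^ n ≤ q ^ n
  ^-mono-≤ zero    0≤p p≤q = ≤-refl
  ^-mono-≤ (suc n) 0≤p p≤q =
    *-mono-≤ (^-nonNeg n 0≤p) (≤-trans 0≤p p≤q) p≤q (^-mono-≤ n 0≤p p≤q)

  ^-mono-< : ∀ {p q} n .{{_ : NonZero n}} → 0ℚ ≤ p → p < q → p ^ n < q ^ n
  ^-mono-< {p} {q} (suc n) 0≤p p<q = ≤-<-trans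
    (*-monoˡ-≤-nonNeg p {{nonNegative 0≤p}} (^-mono-≤ n 0≤p (<⇒≤ p<q)))
    (*-monoˡ-<-pos (q ^ n) {{positive (^-pos n (≤-<-trans 0≤p p<q))}} p<q)

  1≤^ : ∀ {p} n → 1ℚ ≤ p → 1ℚ ≤ p ^ n
  1≤^     zero    1≤p = ≤-refl
  1≤^ {p} (suc n) 1≤p = subst (_≤ p * p ^ n) (*-identityˡ 1ℚ)
    (*-mono-≤ (<⇒≤ 1>0) (≤-trans (<⇒≤ 1>0) 1≤p) 1≤p (1≤^ n 1≤p))

  p≤p^n : ∀ {p} n .{{_ : NonZero n}} → 1ℚ ≤ p → p ≤ p ^ n
  p≤p^n {p} (suc n) 1≤p = subst (_≤ p * p ^ n) (*-identityʳ p)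
    (*-monoˡ-≤-nonNeg p {{nonNegative (≤-trans (<⇒≤ 1>0) 1≤p)}} (1≤^ n 1≤p))

  divide : ∀ c {y} → 0ℚ < y → ∃[ w ] w * y ≡ c
  divide c {y} 0<y = c * 1/ y , trans (*-assoc c (1/ y) y)
    (trans (cong (c *_) (*-inverseˡ y)) (*-identityʳ c))
    where instance _ = >-nonZero 0<y

  *-raiseˡ : ∀ {x y c} → 0ℚ ≤ y → x * y < c → ∃[ z ] (x < z × z * y < c)
  *-raiseˡ {x} {y} {c} 0≤y xy<c with 0ℚ <? y
  ... | no 0≮y = x + 1ℚ , p<p+1 x , subst (_< c) eq xy<c
    where
    eq : x * y ≡ (x + 1ℚ) * y
    eq with refl ← ≤-antisym 0≤y (≮⇒≥ 0≮y) =
      trans (*-zeroʳ x) (sym (*-zeroʳ (x + 1ℚ)))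
  ... | yes 0<y
    with w , refl ← divide c 0<y
    with z , x<z , z<w ← <-dense
           (*-cancelʳ-<-nonNeg y {{nonNegative 0≤y}} {x} {w} xy<c)
    = z , x<z , *-monoˡ-<-pos y {{positive 0<y}} z<w

  *-lowerˡ : ∀ {x y c} → 0ℚ < y → c < x * y → ∃[ z ] (z < x × c < z * y)
  *-lowerˡ {x} {y} {c} 0<y c<xy
    with w , refl ← divide c 0<y
    with z , w<z , z<x ← <-dense
           (*-cancelʳ-<-nonNeg y {{nonNegative (<⇒≤ 0<y)}} {w} {x} c<xy)
    = z , z<x , *-monoˡ-<-pos y {{positive 0<y}} w<z

  posˡ : ∀ {x y c} → 0ℚ ≤ c → 0ℚ < y → c < x * y → 0ℚ < x
  posˡ {x} {y} 0≤c 0<y c<xy = *-cancelʳ-<-nonNeg y {{nonNegative (<⇒≤ 0<y)}}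
    (subst (_< x * y) (sym (*-zeroˡ y)) (≤-<-trans 0≤c c<xy))

  ^-raise : ∀ {x c} n → 0ℚ ≤ x → x ^ n < c → ∃[ r ] (x < r × r ^ n < c)
  ^-raise {x} zero 0≤x 1<c = x + 1ℚ , p<p+1 x , 1<c
  ^-raise {x} {c} (suc n) 0≤x lt
    with z , x<z , zy<c ← *-raiseˡ (^-nonNeg n 0≤x) lt
    with 0≤z ← ≤-trans 0≤x (<⇒≤ x<z)
    with w , y<w , wz<c ← *-raiseˡ 0≤z (subst (_< c) (*-comm z (x ^ n)) zy<c)
    with r , x<r , r^n<w ← ^-raise n 0≤x y<w
    with 0≤r ← ≤-trans 0≤x (<⇒≤ x<r)
    with ≤-total z r
  ... | inj₁ z≤r = z , x<z , ≤-<-trans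
          (*-mono-≤ (^-nonNeg n 0≤z) 0≤z ≤-refl
            (≤-trans (^-mono-≤ n 0≤z z≤r) (<⇒≤ r^n<w)))
          (subst (_< c) (*-comm w z) wz<c)
  ... | inj₂ r≤z = r , x<r , ≤-<-trans
          (*-mono-≤ (^-nonNeg n 0≤r) 0≤z r≤z (<⇒≤ r^n<w))
          (subst (_< c) (*-comm w z) wz<c)

  ^-lower : ∀ {x c} n → 0ℚ < x → 0ℚ ≤ c → c < x ^ n →
            ∃[ r ] (0ℚ < r × r < x × c < r ^ n)
  ^-lower zero 0<x 0≤c c<1
    with r , 0<r , r<x ← <-dense 0<x = r , 0<r , r<x , c<1
  ^-lower {x} {c} (suc n) 0<x 0≤c lt
    with z , z<x , c<zy ← *-lowerˡ (^-pos n 0<x) lt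
    with 0<z ← posˡ 0≤c (^-pos n 0<x) c<zy
    with w , w<y , c<wz ← *-lowerˡ 0<z (subst (c <_) (*-comm z (x ^ n)) c<zy)
    with 0<w ← posˡ 0≤c 0<z c<wz
    with r , 0<r , r<x , w<r^n ← ^-lower n 0<x (<⇒≤ 0<w) w<y
    with ≤-total z r
  ... | inj₁ z≤r = r , 0<r , r<x , <-≤-trans
          (subst (c <_) (*-comm w z) c<wz)
          (*-mono-≤ (<⇒≤ 0<w) (<⇒≤ 0<r) z≤r (<⇒≤ w<r^n))
  ... | inj₂ r≤z = z , 0<z , z<x , <-≤-trans
          (subst (c <_) (*-comm w z) c<wz)
          (*-mono-≤ (<⇒≤ 0<w) (<⇒≤ 0<z) ≤-refl
            (≤-trans (<⇒≤ w<r^n) (^-mono-≤ n (<⇒≤ 0<r) r≤z)))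

------------------------------------------------------------------------
-- Roots and growth rates

-- The nonnegative n-th root of c.  Lower needs the case q < 0 separately,
-- since q ^ n may be large for even n.

root : (n : ℕ) → .{{NonZero n}} → (c : ℚ) → 0ℚ ≤ c → ℝ
root n c 0≤c = record
  { Lower           = Lower
  ; Upper           = Upper
  ; lower-inhabited = - 1ℚ , inj₁ (from-yes (- 1ℚ <? 0ℚ))
  ; upper-inhabited = c + 1ℚ , ≤-<-trans 0≤c (p<p+1 c) ,
      <-≤-trans (p<p+1 c) (p≤p^n n
        (subst (_≤ c + 1ℚ) (+-identityˡ 1ℚ) (+-monoˡ-≤ 1ℚ 0≤c)))
  ; lower-rounded   = λ p → mk⇔ (lower-open p) (lower-closed p)
  ; upper-rounded   = λ q → mk⇔ (upper-open q) (upper-closed q)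
  ; disjoint        = λ where
      p (inj₁ p<0   , 0<p , _    ) → <-asym p<0 0<p
      p (inj₂ p^n<c , _   , c<p^n) → <-asym p^n<c c<p^n
  ; located         = located
  }
  where
  Lower Upper : ℚ → Set
  Lower q = q < 0ℚ ⊎ q ^ n < c
  Upper q = 0ℚ < q × c < q ^ n

  lower-open : ∀ p → Lower p → ∃[ q ] (p < q × Lower q)
  lower-open p low with p <? 0ℚ
  ... | yes p<0 with q , p<q , q<0 ← <-dense p<0 = q , p<q , inj₁ q<0
  lower-open p (inj₁ p<0) | no p≮0 = contradiction p<0 p≮0
  lower-open p (inj₂ p^n<c) | no p≮0
    with q , p<q , q^n<c ← ^-raise n (≮⇒≥ p≮0) p^n<c = q , p<q , inj₂ q^n<c

  lower-closed : ∀ p → ∃[ q ] (p < q × Lower q) → Lower p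
  lower-closed p (q , p<q , inj₁ q<0) = inj₁ (<-trans p<q q<0)
  lower-closed p (q , p<q , inj₂ q^n<c) with p <? 0ℚ
  ... | yes p<0 = inj₁ p<0
  ... | no  p≮0 = inj₂ (<-trans (^-mono-< n (≮⇒≥ p≮0) p<q) q^n<c)

  upper-open : ∀ q → Upper q → ∃[ p ] (p < q × Upper p)
  upper-open q (0<q , c<q^n)
    with p , 0<p , p<q , c<p^n ← ^-lower n 0<q 0≤c c<q^n
    = p , p<q , 0<p , c<p^n

  upper-closed : ∀ q → ∃[ p ] (p < q × Upper p) → Upper q
  upper-closed q (p , p<q , 0<p , c<p^n) =
    <-trans 0<p p<q , <-trans c<p^n (^-mono-< n (<⇒≤ 0<p) p<q)

  located : ∀ {p q} → p < q → Lower p ⊎ Upper q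
  located {p} {q} p<q with p <? 0ℚ | p ^ n <? c
  ... | yes p<0 | _         = inj₁ (inj₁ p<0)
  ... | no  _   | yes p^n<c = inj₁ (inj₂ p^n<c)
  ... | no  p≮0 | no  p^n≮c = inj₂ (≤-<-trans (≮⇒≥ p≮0) p<q ,
    ≤-<-trans (≮⇒≥ p^n≮c) (^-mono-< n (≮⇒≥ p≮0) p<q))

fromℕ : ℕ → ℚ
fromℕ a = + a / 1

fromℕ-nonNeg : ∀ a → 0ℚ ≤ fromℕ a
fromℕ-nonNeg a = nonNegative⁻¹ (fromℕ a) {{normalize-nonNeg a 1}}

HasGrowthRate : (ℕ → ℕ) → ℚ → Set
HasGrowthRate a l = (λ n → root n (fromℕ (a n)) (fromℕ-nonNeg (a n))) ⟶ l

-- Permutations act on {0, …, N}; put c = π(N) and p = π⁻¹(N).  If π(N) ≠ N, then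
-- everything up to position p exceeds everything after it, and since π² avoids 132,
-- either π is an involution, or N lies on a three-cycle N ↦ c ↦ p ↦ N, or π or π⁻¹
-- is a "rotation", equal to a translation x ↦ x + q on a middle interval.
--
-- The 132-avoiding involutions strongly avoid 132 and are counted by the central
-- binomial coefficient C(n, ⌊n/2⌋) ≥ 2ⁿ / (n + 1), which is the lower bound.
--
-- For the upper bound, rotations inject into 132-avoiding involutions.  Three-cycles
-- with c < p are removed one at a time; they can only be put back at skew cuts
-- ("sites"), so these permutations form a generating tree in which a node with l
-- sites has children with 2, …, l + 1 and 2, …, l sites.  The weight 2^(l - 1) of a
-- node grows by a factor of at most 6 per generation, that is, per three steps in n,
-- against 8 for 2ⁿ.  By induction, with B_n a shifted central binomial coefficient,
-- at most 49 B_n permutations have no such three-cycle and at most 14 B_n have one.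
-- Finally 63 B_n < 2ⁿ for large n.

module Submission where

open import Defs renaming (_^_ to _^ℚ_)
open import Data.Nat.Base using (_≤_; _<_)
import Data.Nat.Base as ℕ
open import Data.Product.Base using (_×_; ∃-syntax)

open import Data.Empty using (⊥; ⊥-elim)
open import Data.Fin.Base using (Fin; toℕ; fromℕ<; finToFun; funToFin)
import Data.Fin.Base as Fin
open import Data.Fin.Properties using (toℕ<n; toℕ-fromℕ<; fromℕ<-toℕ; toℕ-injective; injective⇒≤; funToFin-finToFin; finToFun-funToFin)
import Data.Integer.Base as ℤ
import Data.Integer.Properties as ℤ
open import Data.List.Base using (List; []; _∷_; _++_; map; take; drop; length; lookup; [_]; concatMap)
open import Data.List.Membership.Propositional using (_∈_)
open import Data.List.Membership.Propositional.Properties using (∈-map⁺; ∈-map⁻; ∈-++⁺ˡ; ∈-++⁺ʳ; ∈-++⁻; ∈-lookup)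
open import Data.List.Membership.Setoid.Properties using (index-injective)
open import Data.List.Properties using (length-map; length-++; length-take; length-drop)
open import Data.List.Relation.Unary.All as All using (All; []; _∷_)
import Data.List.Relation.Unary.All.Properties as All
open import Data.List.Relation.Unary.AllPairs as AllPairs using (AllPairs; []; _∷_)
import Data.List.Relation.Unary.AllPairs.Properties as AllPairs
open import Data.List.Relation.Unary.Any using (here; there; index)
open import Data.List.Relation.Unary.Unique.Propositional using (Unique)
import Data.List.Relation.Unary.Unique.Propositional.Properties as Unique
open import Data.Nat.Base using (ℕ; zero; suc; pred; _+_; _*_; _∸_; _^_; z≤n; s≤s; NonZero; >-nonZero; >-nonZero⁻¹)
open import Data.Nat.Combinatorics using (_C_; nCk≡nC[n∸k]; nCk+nC[k+1]≡[n+1]C[k+1]; k>n⇒nCk≡0)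
open import Data.Nat.Induction using (<-rec)
open import Data.Nat.Properties
open import Data.Nat.Tactic.RingSolver using (solve-∀)
open import Data.Product.Base using (_,_; proj₁; proj₂)
open import Data.Rational.Base using (ℚ; mkℚ; 0ℚ; 1ℚ; nonNegative; toℚᵘ)
import Data.Rational.Base as ℚ
import Data.Rational.Properties as ℚ
open import Data.Rational.Unnormalised.Base as ℚᵘ using (mkℚᵘ; *≡*; *≤*; *<*)
import Data.Rational.Unnormalised.Properties as ℚᵘ
open import Data.Sum.Base using (_⊎_; inj₁; inj₂; [_,_]′)
open import Data.Vec.Base using (tabulate; count)
open import Function.Base using (_∘_; case_of_; it)
open import Relation.Binary.Definitions using (tri<; tri≈; tri>)
open import Relation.Binary.PropositionalEquality using (_≡_; _≢_; refl; sym; trans; cong; cong₂; subst; subst₂; setoid)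
open import Relation.Nullary using (¬_; Dec; yes; no)
open import Relation.Nullary.Decidable using (_×-dec_)
open import Relation.Unary using (Decidable)

-- Rational powers

-- The constants solve a coupled recurrence. Suppose x B_n bounds the permutations without a
-- removable three-cycle and y B_n those with one. A permutation of the first kind may fix N, and
-- then its restriction to size n - 1 is arbitrary; besides these there are involutions, two kinds
-- of rotation, and inverses of the second kind. Since B_(n+1) ≥ (65/33) B_n after the shift, it
-- suffices that (x + y) 33/65 + 3 + y ≤ x. A permutation of the second kind descends from one of
-- the first kind, three steps of n at a time; with B_(n+3) ≥ (15/2) B_n, and 15/2 above the growth
-- factor 6 of the tree, summing over generations gives y = 2x/7. The values x = 49, y = 14 fit. The
-- number of nodes in a generation does not determine the next one, as fertility depends on the
-- number of sites; so the induction carries a bound for every later generation at once. A constant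
-- times B_n is what yields strictness: B_n is of order 2ⁿ / √n, while a bound of order 2ⁿ would
-- decide nothing.

fromℕᵘ : ∀ a → toℚᵘ (fromℕ a) ℚᵘ.≃ mkℚᵘ (ℤ.+ a) 0
fromℕᵘ a = ℚ.toℚᵘ-fromℚᵘ (mkℚᵘ (ℤ.+ a) 0)

fromℕ-* : ∀ a b → fromℕ (a * b) ≡ fromℕ a ℚ.* fromℕ b
fromℕ-* a b = ℚ.toℚᵘ-injective (ℚᵘ.≃-trans (fromℕᵘ (a * b)) (ℚᵘ.≃-trans
  (*≡* (cong (ℤ._* ℤ.+ 1) (ℤ.pos-* a b)))
  (ℚᵘ.≃-sym (ℚᵘ.≃-trans (ℚ.toℚᵘ-homo-* (fromℕ a) (fromℕ b)) (ℚᵘ.*-cong (fromℕᵘ a) (fromℕᵘ b))))))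

fromℕ-+ : ∀ a b → fromℕ (a + b) ≡ fromℕ a ℚ.+ fromℕ b
fromℕ-+ a b = ℚ.toℚᵘ-injective (ℚᵘ.≃-trans (fromℕᵘ (a + b)) (ℚᵘ.≃-trans
  (*≡* (cong (ℤ._* ℤ.+ 1) (sym (cong₂ ℤ._+_ (ℤ.*-identityʳ (ℤ.+ a)) (ℤ.*-identityʳ (ℤ.+ b))))))
  (ℚᵘ.≃-sym (ℚᵘ.≃-trans (ℚ.toℚᵘ-homo-+ (fromℕ a) (fromℕ b)) (ℚᵘ.+-cong (fromℕᵘ a) (fromℕᵘ b))))))

fromℕ-mono-< : ∀ {a b} → a < b → fromℕ a ℚ.< fromℕ b
fromℕ-mono-< {a} {b} a<b = ℚ.toℚᵘ-cancel-< (ℚᵘ.<-respˡ-≃ (ℚᵘ.≃-sym (fromℕᵘ a)) (ℚᵘ.<-respʳ-≃ (ℚᵘ.≃-sym (fromℕᵘ b))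
  (*<* (ℤ.*-monoʳ-<-pos (ℤ.+ 1) (ℤ.+<+ a<b)))))

archimedean : ∀ ε → 0ℚ ℚ.< ε → ∃[ d ] (1ℚ ℚ.≤ ε ℚ.* fromℕ (suc d))
archimedean (mkℚ (ℤ.+ zero)   d c) (ℚ.*<* (ℤ.+<+ ()))
archimedean (mkℚ ℤ.-[1+ k ]   d c) (ℚ.*<* ())
archimedean ε@(mkℚ (ℤ.+ suc k) d c) _ = d , ℚ.toℚᵘ-cancel-≤ (ℚᵘ.≤-respʳ-≃
  (ℚᵘ.≃-sym (ℚᵘ.≃-trans (ℚ.toℚᵘ-homo-* ε (fromℕ (suc d))) (ℚᵘ.*-cong (ℚᵘ.≃-refl {toℚᵘ ε}) (fromℕᵘ (suc d)))))
  (*≤* (ℤ.+≤+ (subst (1 * (suc d * 1) ≤_) (e k d) (m≤m+n (1 * (suc d * 1)) (k * suc d))))))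
  where
  e : ∀ k d → 1 * (suc d * 1) + k * suc d ≡ suc k * suc d * 1
  e = solve-∀

ℚ-*-mono : ∀ {p q r s} → 0ℚ ℚ.≤ r → 0ℚ ℚ.≤ q → p ℚ.≤ q → r ℚ.≤ s → p ℚ.* r ℚ.≤ q ℚ.* s
ℚ-*-mono {p} {q} {r} {s} 0≤r 0≤q p≤q r≤s = ℚ.≤-trans
  (ℚ.*-monoʳ-≤-nonNeg r {{nonNegative 0≤r}} p≤q) (ℚ.*-monoˡ-≤-nonNeg q {{nonNegative 0≤q}} r≤s)

ℚ-*-nonNeg : ∀ {p q} → 0ℚ ℚ.≤ p → 0ℚ ℚ.≤ q → 0ℚ ℚ.≤ p ℚ.* q
ℚ-*-nonNeg {p} {q} 0≤p 0≤q = ℚ.nonNegative⁻¹ (p ℚ.* q)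
  {{ℚ.nonNeg*nonNeg⇒nonNeg p {{nonNegative 0≤p}} q {{nonNegative 0≤q}}}}

^-nonNegative : ∀ {q} n → 0ℚ ℚ.≤ q → 0ℚ ℚ.≤ q ^ℚ n
^-nonNegative zero    0≤q = fromℕ-nonNeg 1
^-nonNegative (suc n) 0≤q = ℚ-*-nonNeg 0≤q (^-nonNegative n 0≤q)

-- Comparison of powers of q and t / s with denominators cleared, so that the growth estimates can
-- be carried out in ℕ.
^-scale : ∀ {q} s t n → 0ℚ ℚ.≤ q → q ℚ.* fromℕ s ℚ.≤ fromℕ t → q ^ℚ n ℚ.* fromℕ (s ^ n) ℚ.≤ fromℕ (t ^ n)
^-scale     s t zero    0≤q qs≤t = ℚ.≤-reflexive (ℚ.*-identityˡ (fromℕ 1))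
^-scale {q} s t (suc n) 0≤q qs≤t = begin
  q ℚ.* q ^ℚ n ℚ.* fromℕ (s * s ^ n)                ≡⟨ cong (q ℚ.* q ^ℚ n ℚ.*_) (fromℕ-* s (s ^ n)) ⟩
  q ℚ.* q ^ℚ n ℚ.* (fromℕ s ℚ.* fromℕ (s ^ n))      ≡⟨ interchange q (q ^ℚ n) (fromℕ s) (fromℕ (s ^ n)) ⟩
  q ℚ.* fromℕ s ℚ.* (q ^ℚ n ℚ.* fromℕ (s ^ n))      ≤⟨ ℚ-*-mono (ℚ-*-nonNeg (^-nonNegative n 0≤q) (fromℕ-nonNeg (s ^ n))) (fromℕ-nonNeg t) qs≤t (^-scale s t n 0≤q qs≤t) ⟩
  fromℕ t ℚ.* fromℕ (t ^ n)                        ≡⟨ sym (fromℕ-* t (t ^ n)) ⟩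
  fromℕ (t * t ^ n)                                ∎
  where
  open ℚ.≤-Reasoning
  interchange : ∀ a b c d → a ℚ.* b ℚ.* (c ℚ.* d) ≡ a ℚ.* c ℚ.* (b ℚ.* d)
  interchange a b c d = trans (ℚ.*-assoc a b (c ℚ.* d)) (trans (cong (a ℚ.*_)
    (trans (sym (ℚ.*-assoc b c d)) (trans (cong (ℚ._* d) (ℚ.*-comm b c)) (ℚ.*-assoc c b d))))
    (sym (ℚ.*-assoc a c (b ℚ.* d))))

fromℕ-^-≤ : ∀ {q} t n → fromℕ t ℚ.≤ q → fromℕ (t ^ n) ℚ.≤ q ^ℚ n
fromℕ-^-≤     t zero    t≤q = ℚ.≤-refl
fromℕ-^-≤ {q} t (suc n) t≤q = subst (ℚ._≤ q ℚ.* q ^ℚ n) (sym (fromℕ-* t (t ^ n)))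
  (ℚ-*-mono (fromℕ-nonNeg (t ^ n)) (ℚ.≤-trans (fromℕ-nonNeg t) t≤q) t≤q (fromℕ-^-≤ t n t≤q))

-- For M = 2d + 1 this says 2 − ε ≤ 2M / (M + 1).
2-ε-bound : ∀ ε d → 1ℚ ℚ.≤ ε ℚ.* fromℕ (suc d) →
            (fromℕ 2 ℚ.- ε) ℚ.* fromℕ (2 + (d + d)) ℚ.≤ fromℕ (2 * suc (d + d))
2-ε-bound ε d 1≤εd = begin
  (F2 ℚ.- ε) ℚ.* S               ≡⟨ ℚ.*-distribʳ-+ S F2 (ℚ.- ε) ⟩
  F2 ℚ.* S ℚ.+ (ℚ.- ε) ℚ.* S     ≡⟨ cong₂ ℚ._+_ (sym (fromℕ-* 2 (2 + (d + d)))) (sym (ℚ.neg-distribˡ-* ε S)) ⟩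
  fromℕ (2 * (2 + (d + d))) ℚ.- ε ℚ.* S ≤⟨ ℚ.+-monoʳ-≤ (fromℕ (2 * (2 + (d + d)))) (ℚ.neg-antimono-≤ 2≤εS) ⟩
  fromℕ (2 * (2 + (d + d))) ℚ.- F2 ≡⟨ cong (ℚ._- F2) (trans (cong fromℕ (e d)) (fromℕ-+ (2 * suc (d + d)) 2)) ⟩
  fromℕ (2 * suc (d + d)) ℚ.+ F2 ℚ.- F2 ≡⟨ trans (ℚ.+-assoc T F2 (ℚ.- F2)) (trans (cong (T ℚ.+_) (ℚ.+-inverseʳ F2)) (ℚ.+-identityʳ T)) ⟩
  fromℕ (2 * suc (d + d)) ∎
  where
  open ℚ.≤-Reasoning
  F2 = fromℕ 2
  S = fromℕ (2 + (d + d))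
  T = fromℕ (2 * suc (d + d))
  e : ∀ d → 2 * (2 + (d + d)) ≡ 2 * suc (d + d) + 2
  e = solve-∀
  2≤εS : F2 ℚ.≤ ε ℚ.* S
  2≤εS = subst (F2 ℚ.≤_) (trans (sym (ℚ.*-distribˡ-+ ε (fromℕ (suc d)) (fromℕ (suc d))))
    (cong (ε ℚ.*_) (trans (sym (fromℕ-+ (suc d) (suc d))) (cong fromℕ (cong suc (+-suc d d))))))
    (ℚ.+-mono-≤ 1≤εd 1≤εd)

-- Permutations as pairs of mutually inverse functions on ℕ

-- The form `m + b ≤ h` keeps truncated subtraction out of the many counting arguments below.
pigeonhole : ∀ {m b h} (f : ℕ → ℕ) → b ≤ h → (∀ x → x < m → b ≤ f x × f x < h) →
             (∀ x y → x < m → y < m → f x ≡ f y → x ≡ y) → m + b ≤ h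
pigeonhole {m} {b} {h} f b≤h bound inj = subst (m + b ≤_) (m∸n+n≡m b≤h) (+-monoˡ-≤ b (injective⇒≤ {f = g} g-inj))
  where
  g : Fin m → Fin (h ∸ b)
  g i = fromℕ< (∸-monoˡ-< (proj₂ (bound (toℕ i) (toℕ<n i))) (proj₁ (bound (toℕ i) (toℕ<n i))))
  g-inj : ∀ {i j} → g i ≡ g j → i ≡ j
  g-inj {i} {j} eq = toℕ-injective (inj (toℕ i) (toℕ j) (toℕ<n i) (toℕ<n j)
    (∸-cancelʳ-≡ (proj₁ (bound (toℕ i) (toℕ<n i))) (proj₁ (bound (toℕ j) (toℕ<n j)))
      (trans (sym (toℕ-fromℕ< _)) (trans (cong toℕ eq) (toℕ-fromℕ< _)))))

Avoids : ℕ → (ℕ → ℕ) → Set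
Avoids n f = ∀ {i j k} → i < j → j < k → k < n → f i < f k → f k < f j → ⊥

-- Carrying π⁻¹ as data makes inversion a swap of arguments. Values at arguments from n on are
-- unconstrained, so permutations are only ever compared below n.
record Perm (n : ℕ) (π π⁻¹ : ℕ → ℕ) : Set where
  field
    π<   : ∀ {x} → x < n → π x < n
    π⁻¹< : ∀ {x} → x < n → π⁻¹ x < n
    invˡ : ∀ {x} → x < n → π⁻¹ (π x) ≡ x
    invʳ : ∀ {x} → x < n → π (π⁻¹ x) ≡ x

  injective : ∀ {x y} → x < n → y < n → π x ≡ π y → x ≡ y
  injective x<n y<n eq = trans (sym (invˡ x<n)) (trans (cong π⁻¹ eq) (invˡ y<n))

  π-≢ : ∀ {x y} → x < n → y < n → x ≢ y → π x ≢ π y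
  π-≢ x<n y<n x≢y eq = x≢y (injective x<n y<n eq)

open Perm

perm-inverse : ∀ {n π π⁻¹} → Perm n π π⁻¹ → Perm n π⁻¹ π
perm-inverse P = record { π< = π⁻¹< P ; π⁻¹< = π< P ; invˡ = invʳ P ; invʳ = invˡ P }

perm-∘ : ∀ {n π π⁻¹ ρ ρ⁻¹} → Perm n π π⁻¹ → Perm n ρ ρ⁻¹ → Perm n (π ∘ ρ) (ρ⁻¹ ∘ π⁻¹)
perm-∘ {π = π} {ρ = ρ} {ρ⁻¹ = ρ⁻¹} P R = record
  { π<   = π< P ∘ π< R
  ; π⁻¹< = π⁻¹< R ∘ π⁻¹< P
  ; invˡ = λ x<n → trans (cong ρ⁻¹ (invˡ P (π< R x<n))) (invˡ R x<n)
  ; invʳ = λ x<n → trans (cong π (invʳ R (π⁻¹< P x<n))) (invʳ P x<n)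
  }

-- The pattern 132 is its own inverse: an occurrence in π⁻¹ at i, j, k is one in π at the positions
-- π⁻¹ i, π⁻¹ k, π⁻¹ j.
avoids-inverse : ∀ {n π π⁻¹} → Perm n π π⁻¹ → Avoids n π → Avoids n π⁻¹
avoids-inverse {n} {π} {π⁻¹} P av {i} {j} {k} i<j j<k k<n i<k′ k<j′ =
  av i<k′ k<j′ (π⁻¹< P j<n) (subst₂ _<_ (sym (invʳ P i<n)) (sym (invʳ P j<n)) i<j)
    (subst₂ _<_ (sym (invʳ P j<n)) (sym (invʳ P k<n)) j<k)
  where
  j<n = <-trans j<k k<n
  i<n = <-trans i<j j<n

record Strong (n : ℕ) (π π⁻¹ : ℕ → ℕ) : Set where
  field
    perm : Perm n π π⁻¹
    av   : Avoids n π
    av²  : Avoids n (π ∘ π)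

strong-inverse : ∀ {n π π⁻¹} → Strong n π π⁻¹ → Strong n π⁻¹ π
strong-inverse s = record
  { perm = perm-inverse perm
  ; av   = avoids-inverse perm av
  ; av²  = avoids-inverse (perm-∘ perm perm) av²
  }
  where open Strong s

restrict-fixed : ∀ {N π π⁻¹} → Strong (suc N) π π⁻¹ → π N ≡ N → Strong N π π⁻¹
restrict-fixed {N} {π} {π⁻¹} s πN = record
  { perm = record { π< = λ x<N → ≤∧≢⇒< (≤-pred (π< perm (up x<N))) λ eq → <⇒≢ x<N (injective perm (up x<N) (n<1+n N) (trans eq (sym πN)))
    ; π⁻¹< = λ x<N → ≤∧≢⇒< (≤-pred (π⁻¹< perm (up x<N))) λ eq → <⇒≢ x<N
        (trans (sym (invʳ perm (up x<N))) (trans (cong π eq) πN))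
    ; invˡ = invˡ perm ∘ up ; invʳ = invʳ perm ∘ up }
  ; av  = λ i<j j<k k<N → av i<j j<k (up k<N)
  ; av² = λ i<j j<k k<N → av² i<j j<k (up k<N)
  }
  where
  open Strong s
  up : ∀ {x} → x < N → x < suc N
  up = m<n⇒m<1+n

module Maximum {N π π⁻¹} (P : Perm (suc N) π π⁻¹) (av : Avoids (suc N) π)
               {p q} (p+q≡N : p + q ≡ N) (πp≡N : π p ≡ N) where

  p≤N : p ≤ N
  p≤N = subst (p ≤_) p+q≡N (m≤m+n p q)

  p<n : p < suc N
  p<n = s≤s p≤N

  left>right : ∀ {x y} → x ≤ p → p < y → y < suc N → π y < π x
  left>right {x} {y} x≤p p<y y<n with <-cmp (π x) (π y)
  ... | tri> _ _ y<x = y<x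
  ... | tri≈ _ eq _  = ⊥-elim (<⇒≢ (≤-<-trans x≤p p<y) (injective P (≤-<-trans x≤p p<n) y<n eq))
  ... | tri< x<y _ _ with m≤n⇒m<n∨m≡n x≤p
  ...   | inj₂ refl = ⊥-elim (<⇒≱ x<y (subst (π y ≤_) (sym πp≡N) (≤-pred (π< P y<n))))
  ...   | inj₁ x<p  = ⊥-elim (av x<p p<y y<n x<y
            (subst (π y <_) (sym πp≡N) (≤∧≢⇒< (≤-pred (π< P y<n))
              (λ eq → <⇒≢ p<y (sym (injective P y<n p<n (trans eq (sym πp≡N))))))))

  -- There are q positions after p. By `left>right` the first p + 1 entries all exceed the rest, so
  -- counting identifies the two blocks of values as [q, N] and [0, q).
  tail< : ∀ {y} → p < y → y < suc N → π y < q
  tail< {y} p<y y<n = ≰⇒> λ q≤πy → <⇒≱ (s≤s (s≤s q≤πy)) (+-cancelˡ-≤ p _ _ (≤-trans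
      (≤-reflexive (trans (+-suc p (suc (π y))) refl))
      (≤-trans (pigeonhole {m = suc p} {b = suc (π y)} π (π< P y<n)
        (λ x x<p → left>right (≤-pred x<p) p<y y<n , π< P (≤-trans x<p p<n))
        (λ x z x<p z<p → injective P (≤-trans x<p p<n) (≤-trans z<p p<n)))
      (≤-reflexive (trans (cong suc (sym p+q≡N)) (sym (+-suc p q)))))))

  head≥ : ∀ {x} → x ≤ p → q ≤ π x
  head≥ {x} x≤p = subst (_≤ π x) (+-identityʳ q)
    (pigeonhole {m = q} {b = 0} (λ i → π (suc p + i)) z≤n
      (λ i i<q → z≤n , left>right x≤p (m≤m+n (suc p) i) (in-range i<q))
      (λ i j i<q j<q eq → +-cancelˡ-≡ (suc p) i j (injective P (in-range i<q) (in-range j<q) eq)))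
    where
    in-range : ∀ {i} → i < q → suc p + i < suc N
    in-range i<q = s≤s (subst (suc p + _ ≤_) p+q≡N (subst (_≤ p + q) (+-suc p _) (+-monoʳ-≤ p i<q)))

-- Put σ = π².  As σ 0 < Q, a descent of σ between values ≥ Q would form 132 with
-- σ 0; so σ increases where it is ≥ Q, and descending induction shows that it fixes
-- first [h,n), then [Q,n), then everything.
module Exchange {n π π⁻¹} (P : Perm n π π⁻¹) (av² : Avoids n (π ∘ π))
                {h Q} (Q≤h : Q ≤ h) (h≤n : h ≤ n) (0<n : 0 < n)
                (tail< : ∀ {x} → h ≤ x → x < n → π x < Q)
                (head≥ : ∀ {x} → x < h → Q ≤ π x)
                (h≤π0 : h ≤ π 0) where

  private
    σ = π ∘ π
    PP = perm-∘ P P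

  σ0<Q : σ 0 < Q
  σ0<Q = tail< h≤π0 (π< P 0<n)

  σ-mono : ∀ {y z} → y < z → z < n → Q ≤ σ y → Q ≤ σ z → σ y < σ z
  σ-mono {zero}  y<z z<n Qy Qz = ⊥-elim (<⇒≱ σ0<Q Qy)
  σ-mono {suc y} {z} y<z z<n Qy Qz with <-cmp (σ (suc y)) (σ z)
  ... | tri< lt _ _ = lt
  ... | tri≈ _ eq _ = ⊥-elim (<⇒≢ y<z (injective PP (<-trans y<z z<n) z<n eq))
  ... | tri> _ _ gt = ⊥-elim (av² (s≤s z≤n) y<z z<n (<-≤-trans σ0<Q Qz) gt)

  σ-fixes-from : ∀ {l} → Q ≤ l → (∀ {y} → l ≤ y → y < n → Q ≤ σ y) →
                 ∀ k {y} → n ≤ y + k → l ≤ y → y < n → σ y ≡ y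
  σ-fixes-from Q≤l big zero    {y} n≤y l≤y y<n = ⊥-elim (<⇒≱ y<n (subst (n ≤_) (+-identityʳ y) n≤y))
  σ-fixes-from {l} Q≤l big (suc k) {y} n≤y l≤y y<n = go (<-cmp x y)
    where
    x = π⁻¹ (π⁻¹ y)
    σx≡y : σ x ≡ y
    σx≡y = invʳ PP y<n
    x<n : x < n
    x<n = π⁻¹< PP y<n
    ih : ∀ {z} → y < z → z < n → σ z ≡ z
    ih {z} y<z = σ-fixes-from Q≤l big k
      (≤-trans n≤y (subst (_≤ z + k) (sym (+-suc y k)) (+-monoˡ-≤ k y<z)))
      (≤-trans l≤y (<⇒≤ y<z))
    go : _ → σ y ≡ y
    go (tri≈ _ eq _)  = trans (cong σ (sym eq)) σx≡y
    go (tri> _ _ y<x) = ⊥-elim (<⇒≢ y<x (trans (sym σx≡y) (ih y<x x<n)))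
    go (tri< x<y _ _) = ⊥-elim (<⇒≢ y<σy (sym (injective PP (π< PP y<n) y<n (ih y<σy (π< PP y<n)))))
      where
      y<σy : y < σ y
      y<σy = subst (_< σ y) σx≡y (σ-mono x<y y<n (subst (Q ≤_) (sym σx≡y) (≤-trans Q≤l l≤y)) (big l≤y y<n))

  σ-fixes-tail : ∀ {y} → h ≤ y → y < n → σ y ≡ y
  σ-fixes-tail {y} = σ-fixes-from Q≤h (λ h≤y y<n → head≥ (<-≤-trans (tail< h≤y y<n) Q≤h)) n (m≤n+m n y)

  σ-fixes-≥Q : ∀ {y} → Q ≤ y → y < n → σ y ≡ y
  σ-fixes-≥Q {y} = σ-fixes-from ≤-refl (λ Q≤y y<n → head≥ (≰⇒> (stays Q≤y y<n))) n (m≤n+m n y)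
    where
    stays : ∀ {y} → Q ≤ y → y < n → ¬ h ≤ π y
    stays {y} Q≤y y<n h≤πy = <⇒≱ (subst (_< Q) (injective P (π< PP y<n) y<n (σ-fixes-tail h≤πy (π< P y<n)))
      (tail< h≤πy (π< P y<n))) Q≤y

  involutive : ∀ {y} → y < n → σ y ≡ y
  involutive {y} y<n with Q ≤? y
  ... | yes Q≤y = σ-fixes-≥Q Q≤y y<n
  ... | no  Q≰y = trans (cong σ (sym (invʳ P y<n))) (trans (cong π (σ-fixes-tail h≤t (π⁻¹< P y<n))) (invʳ P y<n))
    where
    h≤t : h ≤ π⁻¹ y
    h≤t = ≮⇒≥ λ t<h → Q≰y (subst (Q ≤_) (invʳ P y<n) (head≥ t<h))

-- The position of the maximum

module LateMaximum {N π π⁻¹} (P : Perm (suc N) π π⁻¹) (av : Avoids (suc N) π) (av² : Avoids (suc N) (π ∘ π))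
                   {p q} (p+q≡N : p + q ≡ N) (πp≡N : π p ≡ N)
                   (q≤p : q ≤ p) (p<N : p < N) (π0≤p : π 0 ≤ p) where

  open Maximum P av p+q≡N πp≡N public

  private
    n = suc N
    σ = π ∘ π
    PP = perm-∘ P P
    N<n : N < n
    N<n = n<1+n N

  ≤p⇒<n : ∀ {x} → x ≤ p → x < n
  ≤p⇒<n x≤p = ≤-<-trans x≤p p<n

  q≤⇒≤p : ∀ {x} → x < n → q ≤ π x → x ≤ p
  q≤⇒≤p x<n q≤ = ≮⇒≥ λ p<x → <⇒≱ (tail< p<x x<n) q≤

  c j : ℕ
  c = π N
  j = π c

  c<q : c < q
  c<q = tail< p<N N<n
  c<p : c < p
  c<p = <-≤-trans c<q q≤p
  c<n : c < n
  c<n = ≤p⇒<n (<⇒≤ c<p)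
  j<n : j < n
  j<n = π< P c<n
  q≤j : q ≤ j
  q≤j = head≥ (<⇒≤ c<p)

  j<N : j < N
  j<N = ≤∧≢⇒< (≤-pred j<n) λ j≡N → <⇒≢ c<p (injective P c<n p<n (trans j≡N (sym πp≡N)))

  -- Since π 0 ≤ p < π y, a descent would form 132 together with position 0.
  high-mono : ∀ {x y} → x < y → y ≤ p → p < π x → p < π y → π x < π y
  high-mono {zero}  x<y y≤p p<πx _ = ⊥-elim (<⇒≱ p<πx π0≤p)
  high-mono {suc x} {y} x<y y≤p p<πx p<πy with <-cmp (π (suc x)) (π y)
  ... | tri< lt _ _ = lt
  ... | tri≈ _ eq _ = ⊥-elim (<⇒≢ x<y (injective P (≤p⇒<n (≤-trans (<⇒≤ x<y) y≤p)) (≤p⇒<n y≤p) eq))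
  ... | tri> _ _ gt = ⊥-elim (av (s≤s z≤n) x<y (≤p⇒<n y≤p) (≤-<-trans π0≤p p<πy) gt)

  -- As π s > p forces σ s < q, a descent of σ between values from q on would form 132 with s.
  σ-mono-after : ∀ {s y z} → p < π s → s < y → y < z → z < n → q ≤ σ y → q ≤ σ z → s < n → σ y < σ z
  σ-mono-after {s} {y} {z} p<πs s<y y<z z<n qy qz s<n with <-cmp (σ y) (σ z)
  ... | tri< lt _ _ = lt
  ... | tri≈ _ eq _ = ⊥-elim (<⇒≢ y<z (injective PP (<-trans y<z z<n) z<n eq))
  ... | tri> _ _ gt = ⊥-elim (av² s<y y<z z<n (<-≤-trans (tail< p<πs (π< P s<n)) qz) gt)

  tail-σ≥ : ∀ {t} → p < t → t < n → q ≤ σ t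
  tail-σ≥ p<t t<n = head≥ (≤-trans (<⇒≤ (tail< p<t t<n)) q≤p)

  σ-tail-mono : ∀ {t u} → p < t → t < u → u < n → σ t < σ u
  σ-tail-mono p<t t<u u<n = σ-mono-after (subst (p <_) (sym πp≡N) p<N) p<t t<u u<n
    (tail-σ≥ p<t (<-trans t<u u<n)) (tail-σ≥ (<-trans p<t t<u) u<n) p<n

  -- The values below q stand in the tail (p, N], where σ increases; its last entry there is σ N =
  -- j.
  first≤j : ∀ {k} → k < q → π k ≤ j
  first≤j {k} k<q = subst (λ v → π v ≤ j) (invʳ P k<n) (go (m≤n⇒m<n∨m≡n (≤-pred t<n)))
    where
    k<n = ≤p⇒<n (≤-trans (<⇒≤ k<q) q≤p)
    t = π⁻¹ k
    t<n : t < n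
    t<n = π⁻¹< P k<n
    p<t : p < t
    p<t = ≰⇒> λ t≤p → <⇒≱ k<q (subst (q ≤_) (invʳ P k<n) (head≥ t≤p))
    go : t < N ⊎ t ≡ N → σ t ≤ j
    go (inj₁ t<N) = <⇒≤ (σ-tail-mono p<t t<N N<n)
    go (inj₂ t≡N) = ≤-reflexive (cong σ t≡N)

  above-j≥q : ∀ {x} → j < π x → q ≤ x
  above-j≥q j<πx = ≮⇒≥ λ x<q → <⇒≱ j<πx (first≤j x<q)

  -- Entries above j stand after position c, which carries j, so a descent would complete a 132
  -- starting at c.
  above-j-mono : ∀ {x y} → x < y → y < n → j < π x → j < π y → π x < π y
  above-j-mono {x} {y} x<y y<n j<πx j<πy with <-cmp (π x) (π y)
  ... | tri< lt _ _ = lt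
  ... | tri≈ _ eq _ = ⊥-elim (<⇒≢ x<y (injective P (<-trans x<y y<n) y<n eq))
  ... | tri> _ _ gt = ⊥-elim (av (<-≤-trans c<q (above-j≥q j<πx)) x<y y<n j<πy gt)

  -- Increasing on [q,p] with image the interval (j,N], π is a translation there.
  module _ (middle>j : ∀ {x} → q ≤ x → x ≤ p → j < π x) where

    translation-from : ∀ k {x} → x + k ≡ p → q ≤ x → π x + k ≡ N
    translation-from zero    {x} eq q≤x =
      trans (+-identityʳ (π x)) (trans (cong π (trans (sym (+-identityʳ x)) eq)) πp≡N)
    translation-from (suc k) {x} eq q≤x = trans (+-suc (π x) k) (trans (cong (_+ k) next) ih)
      where
      eq′ : suc x + k ≡ p
      eq′ = trans (sym (+-suc x k)) eq
      sx≤p : suc x ≤ p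
      sx≤p = subst (suc x ≤_) eq′ (m≤m+n (suc x) k)
      ih : π (suc x) + k ≡ N
      ih = translation-from k eq′ (m≤n⇒m≤1+n q≤x)
      j<πx = middle>j q≤x (<⇒≤ sx≤p)
      j<πsx = middle>j (m≤n⇒m≤1+n q≤x) sx≤p
      πx<πsx : π x < π (suc x)
      πx<πsx = above-j-mono (n<1+n x) (≤p⇒<n sx≤p) j<πx j<πsx
      -- If the value 1 + π x were skipped here, monotonicity would place its position y strictly
      -- between x and x + 1.
      next : suc (π x) ≡ π (suc x)
      next with m≤n⇒m<n∨m≡n πx<πsx
      ... | inj₂ e = e
      ... | inj₁ gap = ⊥-elim (≤⇒≯ y≤x x<y)
        where
        w<n = <-trans gap (π< P (≤p⇒<n sx≤p))
        y = π⁻¹ (suc (π x))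
        πy : π y ≡ suc (π x)
        πy = invʳ P w<n
        y<n : y < n
        y<n = π⁻¹< P w<n
        j<πy : j < π y
        j<πy = subst (j <_) (sym πy) (<-trans j<πx (n<1+n (π x)))
        x<y : x < y
        x<y = ≰⇒> λ y≤x → case m≤n⇒m<n∨m≡n y≤x of λ where
          (inj₁ y<x) → <-asym (subst (_< π x) πy (above-j-mono y<x (≤p⇒<n (<⇒≤ sx≤p)) j<πy j<πx)) (n<1+n _)
          (inj₂ y≡x) → <⇒≢ (n<1+n (π x)) (trans (cong π (sym y≡x)) πy)
        y≤x : y ≤ x
        y≤x = ≮⇒≥ λ x<y → case m≤n⇒m<n∨m≡n x<y of λ where
          (inj₁ sx<y) → <-asym (subst (π (suc x) <_) πy (above-j-mono sx<y y<n j<πsx j<πy)) gap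
          (inj₂ sx≡y) → <⇒≢ gap (sym (trans (cong π sx≡y) πy))

    translation : ∀ {x} → q ≤ x → x ≤ p → π x ≡ x + q
    translation {x} q≤x x≤p = +-cancelʳ-≡ (p ∸ x) (π x) (x + q)
      (trans (translation-from (p ∸ x) (m+[n∸m]≡n x≤p) q≤x) (trans (sym p+q≡N)
        (trans (cong (_+ q) (sym (m+[n∸m]≡n x≤p))) (trans (+-assoc x _ q)
          (trans (cong (x +_) (+-comm _ q)) (sym (+-assoc x q _)))))))

  module Below (j<p : j < p) where

    w : ℕ
    w = π⁻¹ p
    πw : π w ≡ p
    πw = invʳ P p<n
    w<n : w < n
    w<n = π⁻¹< P p<n
    j<πw : j < π w
    j<πw = subst (j <_) (sym πw) j<p
    q≤w : q ≤ w
    q≤w = above-j≥q j<πw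
    w≤p : w ≤ p
    w≤p = q≤⇒≤p w<n (subst (q ≤_) (sym πw) q≤p)
    σw : σ w ≡ N
    σw = trans (cong π πw) πp≡N

    -- Otherwise x < w < N would carry σ x < σ N = j < σ w = N, a 132 in π².
    σ-above-j : ∀ {x} → x ≤ w → j < σ x
    σ-above-j {x} x≤w with m≤n⇒m<n∨m≡n x≤w
    ... | inj₂ refl = subst (j <_) (sym σw) j<N
    ... | inj₁ x<w = ≰⇒> λ σx≤j → av² x<w w<N N<n (≤∧≢⇒< σx≤j x≢) (subst (j <_) (sym σw) j<N)
      where
      w<N : w < N
      w<N = ≤-<-trans w≤p p<N
      x≢ : σ x ≢ j
      x≢ eq = <⇒≢ (<-trans x<w w<N) (injective PP (<-trans x<w w<n) N<n eq)

    -- The position y of the value v is not after w, because entries above j increase and π w = p ≥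
    -- v; so y ≤ w and π v = σ y.
    between-above-j : ∀ {v} → j < v → v ≤ p → j < π v
    between-above-j {v} j<v v≤p = subst (λ u → j < π u) πy (σ-above-j (≮⇒≥ λ w<y →
        <⇒≱ (subst₂ _<_ πw πy (above-j-mono w<y y<n j<πw (subst (j <_) (sym πy) j<v))) v≤p))
      where
      y = π⁻¹ v
      πy : π y ≡ v
      πy = invʳ P (≤p⇒<n v≤p)
      y<n : y < n
      y<n = π⁻¹< P (≤p⇒<n v≤p)

    -- The entries above j are the images of q entries of π([0,q)) and of the
    -- p − j entries of (j,p], which leaves no room for the image of e.
    saturated : ∀ {e} → e ≤ j → j < π e → (∀ {k} → k < q → π k ≢ e) → ⊥
    saturated {e} e≤j j<πe fresh = <⇒≱ too-many (pigeonhole {m = q + suc d} {b = suc j} (π ∘ a) (<⇒≤ (s≤s j<N)) bound inj)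
      where
      d = p ∸ j
      j+d : j + d ≡ p
      j+d = m+[n∸m]≡n (<⇒≤ j<p)
      too-many : suc N < q + suc d + suc j
      too-many = ≤-reflexive (sym (trans (cong (_+ suc j) (+-suc q d)) (cong suc (trans (+-assoc q d (suc j))
        (trans (cong (q +_) (trans (+-suc d j) (cong suc (trans (+-comm d j) j+d))))
          (trans (+-suc q p) (cong suc (trans (+-comm q p) p+q≡N))))))))
      rest : ℕ → ℕ
      rest zero    = e
      rest (suc i) = j + suc i
      a : ℕ → ℕ
      a x with x <? q
      ... | yes _ = π x
      ... | no  _ = rest (x ∸ q)
      rest≤p : ∀ {i} → i < suc d → rest i ≤ p
      rest≤p {zero}  _ = ≤-trans e≤j (<⇒≤ j<p)
      rest≤p {suc i} (s≤s i<d) = subst (j + suc i ≤_) j+d (+-monoʳ-≤ j i<d)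
      rest-high : ∀ {i} → i < suc d → j < π (rest i)
      rest-high {zero}  _ = j<πe
      rest-high {suc i} i<d = between-above-j (m<m+n j (s≤s z≤n)) (rest≤p {suc i} i<d)
      rest-injective : ∀ i k → rest i ≡ rest k → i ≡ k
      rest-injective zero    zero    _  = refl
      rest-injective zero    (suc k) eq = ⊥-elim (<⇒≱ (m<m+n j (s≤s z≤n)) (subst (_≤ j) eq e≤j))
      rest-injective (suc i) zero    eq = ⊥-elim (<⇒≱ (m<m+n j (s≤s z≤n)) (subst (_≤ j) (sym eq) e≤j))
      rest-injective (suc i) (suc k) eq = +-cancelˡ-≡ j (suc i) (suc k) eq
      rest-fresh : ∀ {k} → k < q → ∀ i → π k ≢ rest i
      rest-fresh k<q zero    = fresh k<q
      rest-fresh k<q (suc i) eq = <⇒≱ (m<m+n j (s≤s z≤n)) (subst (_≤ j) eq (first≤j k<q))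
      offset : ∀ {x} → ¬ x < q → x < q + suc d → x ∸ q < suc d
      offset {x} x≮q x<m = +-cancelˡ-< q _ _ (subst (_< q + suc d) (sym (m+[n∸m]≡n (≮⇒≥ x≮q))) x<m)
      bound : ∀ x → x < q + suc d → suc j ≤ π (a x) × π (a x) < suc N
      bound x x<m with x <? q
      ... | yes x<q = σ-above-j (≤-trans (<⇒≤ x<q) q≤w) , π< P (π< P (≤p⇒<n (≤-trans (<⇒≤ x<q) q≤p)))
      ... | no  x≮q = rest-high (offset x≮q x<m) , π< P (≤p⇒<n (rest≤p (offset x≮q x<m)))
      a<n : ∀ x → x < q + suc d → a x < n
      a<n x x<m with x <? q
      ... | yes x<q = π< P (≤p⇒<n (≤-trans (<⇒≤ x<q) q≤p))
      ... | no  x≮q = ≤p⇒<n (rest≤p (offset x≮q x<m))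
      a-injective : ∀ x y → a x ≡ a y → x ≡ y
      a-injective x y eq with x <? q | y <? q
      ... | yes x<q | yes y<q = injective P (≤p⇒<n (≤-trans (<⇒≤ x<q) q≤p)) (≤p⇒<n (≤-trans (<⇒≤ y<q) q≤p)) eq
      ... | yes x<q | no  _   = ⊥-elim (rest-fresh x<q (y ∸ q) eq)
      ... | no  _   | yes y<q = ⊥-elim (rest-fresh y<q (x ∸ q) (sym eq))
      ... | no x≮q  | no y≮q  = ∸-cancelʳ-≡ (≮⇒≥ x≮q) (≮⇒≥ y≮q) (rest-injective _ _ eq)
      inj : ∀ x y → x < q + suc d → y < q + suc d → π (a x) ≡ π (a y) → x ≡ y
      inj x y x<m y<m eq = a-injective x y (injective P (a<n x x<m) (a<n y y<m) eq)

    -- If π x ≤ j, then π x itself would be the extra entry excluded by `saturated`, since σ x > j.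
    left>j : ∀ {x} → q ≤ x → x ≤ w → j < π x
    left>j {x} q≤x x≤w = ≰⇒> λ πx≤j → saturated πx≤j (σ-above-j x≤w)
      λ k<q eq → <⇒≱ k<q (subst (q ≤_) (sym (injective P (≤p⇒<n (≤-trans (<⇒≤ k<q) q≤p)) (≤p⇒<n (≤-trans x≤w w≤p)) eq)) q≤x)

    middle>j : ∀ {x} → q ≤ x → x ≤ p → j < π x
    middle>j {x} q≤x x≤p with x ≤? w
    ... | yes x≤w = left>j q≤x x≤w
    -- The 132 sits at y < q < x, with values q, π q and π x. Saturation, applied to the entry at q,
    -- is what puts the position y of the value q before q.
    ... | no  x≰w = ≰⇒> λ πx≤j →
      av y<q (≤-<-trans q≤w (≰⇒> x≰w)) (≤p⇒<n x≤p)
        (subst (_< π x) (sym πy) (≤∧≢⇒< (head≥ x≤p) λ q≡πx → <⇒≱ y<q (subst (q ≤_)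
          (sym (injective P (π⁻¹< P q<n) (≤p⇒<n x≤p) (trans πy q≡πx))) q≤x)))
        (≤-<-trans πx≤j (left>j ≤-refl q≤w))
      where
      q<n = ≤p⇒<n q≤p
      y = π⁻¹ q
      πy : π y ≡ q
      πy = invʳ P q<n
      y<q : y < q
      y<q = ≰⇒> λ q≤y → saturated q≤j (left>j ≤-refl q≤w) λ {k} k<q eq →
        <⇒≱ k<q (subst (q ≤_) (trans (cong π⁻¹ (sym eq)) (invˡ P (≤p⇒<n (≤-trans (<⇒≤ k<q) q≤p)))) q≤y)

  module Above (p<j : p < j) where

    module _ {x} (q≤x : q ≤ x) (x≤p : x ≤ p) (πx≤j : π x ≤ j) where

      private
        x<n = ≤p⇒<n x≤p
        c<x : c < x
        c<x = <-≤-trans c<q q≤x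

      πx≤p : π x ≤ p
      πx≤p = ≮⇒≥ λ p<πx → <⇒≱ (high-mono c<x x≤p p<j p<πx) πx≤j

      x<p : x < p
      x<p = ≤∧≢⇒< x≤p λ x≡p → <⇒≱ p<N (subst (_≤ p) (trans (cong π x≡p) πp≡N) πx≤p)

      x<N : x < N
      x<N = <-trans x<p p<N

      σ≢j : ∀ {y} → y < N → σ y ≢ j
      σ≢j y<N eq = <⇒≢ y<N (injective PP (<-trans y<N N<n) N<n eq)

      -- If σ x > j, avoidance in σ at k < x < N forces σ k > j for every k < q. Let `g` pick π k
      -- when it exceeds p and σ k otherwise: this gives q distinct values besides σ x in (p, N],
      -- which has only q elements.
      σx≤j : σ x ≤ j
      σx≤j = ≮⇒≥ λ j<σx → <⇒≱ too-many (pigeonhole {m = suc q} {b = suc p} (f j<σx) (s≤s (<⇒≤ p<N)) (bound j<σx) (inj j<σx))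
        where
        too-many : suc N < suc q + suc p
        too-many = ≤-reflexive (cong suc (sym (trans (+-suc q p) (cong suc (trans (+-comm q p) p+q≡N)))))
        σk>j : j < σ x → ∀ {k} → k < q → j < σ k
        σk>j j<σx {k} k<q = ≰⇒> λ σk≤j → av² k<x x<N N<n (≤∧≢⇒< σk≤j (σ≢j (<-trans k<x x<N))) j<σx
          where k<x = <-≤-trans k<q q≤x
        g : ℕ → ℕ
        g k with π k ≤? p
        ... | yes _ = σ k
        ... | no  _ = π k
        f : j < σ x → ℕ → ℕ
        f _ k with k <? q
        ... | yes _ = g k
        ... | no  _ = σ x
        k<n : ∀ {k} → k < q → k < n
        k<n k<q = ≤p⇒<n (≤-trans (<⇒≤ k<q) q≤p)
        bound : ∀ h k → k < suc q → suc p ≤ f h k × f h k < suc N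
        bound h k _ with k <? q
        ... | no _ = <-trans p<j h , π< PP x<n
        ... | yes k<q with π k ≤? p
        ...   | yes _ = <-trans p<j (σk>j h k<q) , π< PP (k<n k<q)
        ...   | no ≰p = ≰⇒> ≰p , π< P (k<n k<q)
        g≢ : j < σ x → ∀ {k} → k < q → g k ≢ σ x
        g≢ h {k} k<q eq with π k ≤? p
        ... | yes _ = <⇒≢ (<-≤-trans k<q q≤x) (injective PP (k<n k<q) x<n eq)
        ... | no  _ = <⇒≱ h (subst (_≤ j) eq (first≤j k<q))
        g-inj : j < σ x → ∀ {k l} → k < q → l < q → g k ≡ g l → k ≡ l
        g-inj h {k} {l} k<q l<q eq with π k ≤? p | π l ≤? p
        ... | yes _ | yes _ = injective PP (k<n k<q) (k<n l<q) eq
        ... | no _  | no _  = injective P (k<n k<q) (k<n l<q) eq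
        ... | yes _ | no _  = ⊥-elim (<⇒≱ (σk>j h k<q) (subst (_≤ j) (sym eq) (first≤j l<q)))
        ... | no _  | yes _ = ⊥-elim (<⇒≱ (σk>j h l<q) (subst (_≤ j) eq (first≤j k<q)))
        inj : ∀ h k l → k < suc q → l < suc q → f h k ≡ f h l → k ≡ l
        inj h k l k≤q l≤q eq with k <? q | l <? q
        ... | yes k<q | yes l<q = g-inj h k<q l<q eq
        ... | yes k<q | no _    = ⊥-elim (g≢ h k<q eq)
        ... | no _    | yes l<q = ⊥-elim (g≢ h l<q (sym eq))
        ... | no k≮q  | no l≮q  = trans (≤-antisym (≤-pred k≤q) (≮⇒≥ k≮q)) (≤-antisym (≮⇒≥ l≮q) (≤-pred l≤q))

      -- Each of the q values v in (p, N] can be traced back to its own position before y, whence q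
      -- ≤ y: under π if v ≤ j, because later high entries exceed j, and under σ if v > j, because σ
      -- y < j would start a 132 ending at N.
      no-gap : ∀ {y} → c < y → y < q → ⊥
      no-gap {y} c<y y<q = <⇒≱ y<q (subst (_≤ y) (+-identityʳ q)
          (pigeonhole {m = q} {b = 0} (λ i → f (suc p + i)) z≤n
            (λ i i<q → z≤n , bound (suc p + i) (m≤m+n (suc p) i) (range i<q))
            (λ i k i<q k<q eq → +-cancelˡ-≡ (suc p) i k
              (inj _ _ (m≤m+n (suc p) i) (m≤m+n (suc p) k) (range i<q) (range k<q) eq))))
        where
        range : ∀ {i} → i < q → suc p + i < n
        range i<q = s≤s (subst (suc p + _ ≤_) p+q≡N (subst (_≤ p + q) (+-suc p _) (+-monoʳ-≤ p i<q)))
        y≤p = ≤-trans (<⇒≤ y<q) q≤p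
        y<n = ≤p⇒<n y≤p
        πy≤p : π y ≤ p
        πy≤p = ≮⇒≥ λ p<πy → <⇒≱ (high-mono c<y y≤p p<j p<πy) (first≤j y<q)
        σy<j : σ y < j
        σy<j = <-≤-trans (σ-mono-after p<j c<y (<-≤-trans y<q q≤x) x<n (head≥ πy≤p) (head≥ πx≤p) c<n) σx≤j
        f : ℕ → ℕ
        f v with v ≤? j
        ... | yes _ = π⁻¹ v
        ... | no  _ = π⁻¹ (π⁻¹ v)
        bound : ∀ v → p < v → v < n → f v < y
        bound v p<v v<n with v ≤? j
        ... | yes v≤j = ≤-<-trans (≮⇒≥ λ c<s → <⇒≱ (subst (j <_) (invʳ P v<n)
                (high-mono c<s (q≤⇒≤p (π⁻¹< P v<n) (subst (q ≤_) (sym (invʳ P v<n)) (≤-trans q≤p (<⇒≤ p<v))))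
                  p<j (subst (p <_) (sym (invʳ P v<n)) p<v))) v≤j) c<y
        ... | no v≰j with <-cmp (π⁻¹ (π⁻¹ v)) y
        ...   | tri< lt _ _ = lt
        ...   | tri≈ _ eq _ = ⊥-elim (v≰j (<⇒≤ (subst (_< j) (trans (cong σ (sym eq)) (invʳ PP v<n)) σy<j)))
        ...   | tri> _ _ gt = ⊥-elim (av² gt r<N N<n σy<j (subst (j <_) (sym (invʳ PP v<n)) (≰⇒> v≰j)))
          where
          r<N : π⁻¹ (π⁻¹ v) < N
          r<N = ≤∧≢⇒< (≤-pred (π⁻¹< PP v<n)) λ r≡N → v≰j (≤-reflexive (trans (sym (invʳ PP v<n)) (cong σ r≡N)))
        clash : ∀ {u v} → p < u → u < n → v < n → ¬ v ≤ j → π⁻¹ u ≢ π⁻¹ (π⁻¹ v)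
        clash {u} {v} p<u u<n v<n v≰j eq = <⇒≱ (<-≤-trans (tail< p<u u<n) q≤j)
          (<⇒≤ (subst (j <_) (trans (sym (invʳ PP v<n)) (trans (cong σ (sym eq)) (cong π (invʳ P u<n)))) (≰⇒> v≰j)))
        inj : ∀ u v → p < u → p < v → u < n → v < n → f u ≡ f v → u ≡ v
        inj u v p<u p<v u<n v<n eq with u ≤? j | v ≤? j
        ... | yes _ | yes _ = injective (perm-inverse P) u<n v<n eq
        ... | no _  | no _  = injective (perm-inverse PP) u<n v<n eq
        ... | yes _ | no h  = ⊥-elim (clash p<u u<n v<n h eq)
        ... | no h  | yes _ = ⊥-elim (clash p<v v<n u<n h (sym eq))

      -- `no-gap` leaves c + 1 = q. Then c < x < p is a 132 in σ: σ c = π j < c = σ p < q ≤ σ x.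
      absurd : ⊥
      absurd = av² c<x x<p p<n
          (subst (σ c <_) (sym σp) πj<c)
          (subst (_< σ x) (sym σp) (<-≤-trans c<q (head≥ πx≤p)))
        where
        σp : σ p ≡ c
        σp = cong π πp≡N
        sc≡q : suc c ≡ q
        sc≡q with m≤n⇒m<n∨m≡n c<q
        ... | inj₁ lt = ⊥-elim (no-gap (n<1+n c) lt)
        ... | inj₂ eq = eq
        πj<c : π j < c
        πj<c = ≤∧≢⇒< (≤-pred (subst (π j <_) (sym sc≡q) (tail< p<j j<n)))
          λ eq → <⇒≢ j<N (injective P j<n N<n eq)

    middle>j : ∀ {x} → q ≤ x → x ≤ p → j < π x
    middle>j q≤x x≤p = ≰⇒> (absurd q≤x x≤p)

  three-cycle-or-rotation : π c ≡ p ⊎ (∀ {x} → q ≤ x → x ≤ p → π x ≡ x + q)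
  three-cycle-or-rotation with <-cmp j p
  ... | tri≈ _ eq _  = inj₁ eq
  ... | tri< j<p _ _ = inj₂ (translation (Below.middle>j j<p))
  ... | tri> _ _ p<j = inj₂ (translation (Above.middle>j p<j))

Involutive : ℕ → (ℕ → ℕ) → Set
Involutive n π = ∀ {x} → x < n → π (π x) ≡ x

-- The condition q + q ≤ N makes the interval [q, N - q] nonempty; its last position N - q carries
-- the maximum.
Rotation : ℕ → (ℕ → ℕ) → ℕ → Set
Rotation N π q = 0 < q × q + q ≤ N × (∀ {x} → q ≤ x → x + q ≤ N → π x ≡ x + q)

data Shape (N : ℕ) (π π⁻¹ : ℕ → ℕ) : Set where
  fixed      : π N ≡ N → Shape N π π⁻¹
  involution : Involutive (suc N) π → Shape N π π⁻¹
  threeCycle : π (π N) ≡ π⁻¹ N → Shape N π π⁻¹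
  rotation   : ∀ q → Rotation N π q → Shape N π π⁻¹
  rotation⁻¹ : ∀ q → Rotation N π⁻¹ q → Shape N π π⁻¹

involutive-inverse : ∀ {n π π⁻¹} → Perm n π π⁻¹ → Involutive n π → Involutive n π⁻¹
involutive-inverse {π = π} {π⁻¹} P inv {x} x<n = trans (cong π⁻¹ (sym π≡π⁻¹)) (invˡ P x<n)
  where
  y<n = π⁻¹< P x<n
  π≡π⁻¹ = trans (sym (cong π (invʳ P x<n))) (inv y<n)

shape-inverse : ∀ {N π π⁻¹} → Perm (suc N) π π⁻¹ → Shape N π⁻¹ π → Shape N π π⁻¹
shape-inverse {N} {π} P (fixed eq) = fixed (trans (cong π (sym eq)) (invʳ P (n<1+n N)))
shape-inverse P (involution inv) = involution (involutive-inverse (perm-inverse P) inv)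
shape-inverse {N} {π} P (threeCycle eq) =
  threeCycle (trans (cong π (sym eq)) (invʳ P (π⁻¹< P (n<1+n N))))
shape-inverse P (rotation q r) = rotation⁻¹ q r
shape-inverse P (rotation⁻¹ q r) = rotation q r

module _ {N π π⁻¹} (s : Strong (suc N) π π⁻¹) where

  open Strong s

  private
    n = suc N
    p = π⁻¹ N
    c = π N
    πp : π p ≡ N
    πp = invʳ perm (n<1+n N)
    p≤N : p ≤ N
    p≤N = ≤-pred (π⁻¹< perm (n<1+n N))
    c≤N : c ≤ N
    c≤N = ≤-pred (π< perm (n<1+n N))

  shape-late : c ≢ N → N ∸ p ≤ p → Shape N π π⁻¹
  shape-late c≢N q≤p with π 0 ≤? p
  ... | yes π0≤p = [ threeCycle
                   , (λ tr → rotation (N ∸ p) (m<n⇒0<n∸m p<N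
                       , subst ((N ∸ p) + (N ∸ p) ≤_) (m+[n∸m]≡n p≤N) (+-monoˡ-≤ (N ∸ p) q≤p)
                       , λ {x} q≤x x+q≤N → tr q≤x (+-cancelʳ-≤ (N ∸ p) x p
                           (subst (x + (N ∸ p) ≤_) (sym (m+[n∸m]≡n p≤N)) x+q≤N)))) ]′
                   (LateMaximum.three-cycle-or-rotation perm av av² (m+[n∸m]≡n p≤N) πp q≤p p<N π0≤p)
    where
    p<N : p < N
    p<N = ≤∧≢⇒< p≤N λ eq → c≢N (trans (cong π (sym eq)) πp)
  ... | no π0≰p = involution (Exchange.involutive perm av² (m≤n⇒m≤1+n q≤p) (s≤s p≤N) (s≤s z≤n)
                    (M.tail<) (λ x<sp → M.head≥ (≤-pred x<sp)) (≰⇒> π0≰p))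
    where module M = Maximum perm av (m+[n∸m]≡n p≤N) πp

  -- The two blocks needed by `Exchange` come from π⁻¹, whose maximum is at c: the positions from N
  -- - c on carry exactly the values up to c. The hypothesis p ≤ c gives π 0 ≥ N - p ≥ N - c.
  shape-early : p ≤ c → c < N ∸ c → Shape N π π⁻¹
  shape-early p≤c c<N∸c = involution (Exchange.involutive perm av² {h = N ∸ c} {Q = suc c} c<N∸c
      (m≤n⇒m≤1+n (m∸n≤m N c)) (s≤s z≤n)
      (λ {x} h≤x x<n → ≰⇒> λ c<πx → <⇒≱ (subst (_< N ∸ c) (invˡ perm x<n) (M⁻¹.tail< c<πx (π< perm x<n))) h≤x)
      (λ {x} x<h → ≰⇒> λ πx≤c → <⇒≱ x<h (subst (N ∸ c ≤_)
         (invˡ perm (<-≤-trans x<h (m≤n⇒m≤1+n (m∸n≤m N c)))) (M⁻¹.head≥ πx≤c)))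
      (≤-trans (∸-monoʳ-≤ N p≤c) (M.head≥ z≤n)))
    where
    module M = Maximum perm av (m+[n∸m]≡n p≤N) πp
    module M⁻¹ = Maximum (perm-inverse perm) (avoids-inverse perm av) (m+[n∸m]≡n c≤N) (invˡ perm (n<1+n N))

shape : ∀ {N π π⁻¹} → Strong (suc N) π π⁻¹ → Shape N π π⁻¹
shape {N} {π} {π⁻¹} s with π N ≟ N
... | yes eq = fixed eq
... | no c≢N with N ∸ π⁻¹ N ≤? π⁻¹ N | N ∸ π N ≤? π N
...   | yes q≤p | _ = shape-late s c≢N q≤p
...   | no _ | yes q≤c = shape-inverse perm (shape-late (strong-inverse s)
          (λ eq → c≢N (trans (cong π (sym eq)) (invʳ perm (n<1+n N)))) q≤c)
  where open Strong s
...   | no ¬p | no ¬c with ≤-total (π⁻¹ N) (π N)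
...     | inj₁ p≤c = shape-early s p≤c (≰⇒> ¬c)
...     | inj₂ c≤p = shape-inverse (Strong.perm s) (shape-early (strong-inverse s) c≤p (≰⇒> ¬p))

-- Removing and inserting cycles

abstract
  skip unskip : ℕ → ℕ → ℕ
  skip c x with x <? c
  ... | yes _ = x
  ... | no  _ = suc x
  unskip c y with y <? c
  ... | yes _ = y
  ... | no  _ = pred y

  skip-< : ∀ {c x} → x < c → skip c x ≡ x
  skip-< {c} {x} x<c with x <? c
  ... | yes _   = refl
  ... | no  x≮c = ⊥-elim (x≮c x<c)

  skip-≥ : ∀ {c x} → c ≤ x → skip c x ≡ suc x
  skip-≥ {c} {x} c≤x with x <? c
  ... | yes x<c = ⊥-elim (<⇒≱ x<c c≤x)
  ... | no  _   = refl

  x≤skip : ∀ c x → x ≤ skip c x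
  x≤skip c x with x <? c
  ... | yes _ = ≤-refl
  ... | no  _ = n≤1+n x

  skip≤ : ∀ c x → skip c x ≤ suc x
  skip≤ c x with x <? c
  ... | yes _ = n≤1+n x
  ... | no  _ = ≤-refl

  skip-≢ : ∀ c x → skip c x ≢ c
  skip-≢ c x eq with x <? c
  ... | yes x<c = <⇒≢ x<c eq
  ... | no  x≮c = x≮c (≤-reflexive eq)

  skip-mono : ∀ c {x y} → x < y → skip c x < skip c y
  skip-mono c {x} {y} x<y with x <? c | y <? c
  ... | yes _  | yes _   = x<y
  ... | yes _  | no _    = m<n⇒m<1+n x<y
  ... | no x≮c | yes y<c = ⊥-elim (x≮c (<-trans x<y y<c))
  ... | no _   | no _    = s≤s x<y

  skip-unskip : ∀ {c y} → y ≢ c → skip c (unskip c y) ≡ y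
  skip-unskip {c} {y} y≢c with y <? c
  ... | yes y<c = skip-< y<c
  skip-unskip {c} {zero}  y≢c | no y≮c = ⊥-elim (y≢c (sym (n≤0⇒n≡0 (≮⇒≥ y≮c))))
  skip-unskip {c} {suc y} y≢c | no y≮c = skip-≥ (≤-pred (≤∧≢⇒< (≮⇒≥ y≮c) (y≢c ∘ sym)))

  unskip-< : ∀ {c y m} → y ≢ c → c ≤ m → y < suc m → unskip c y < m
  unskip-< {c} {y} y≢c c≤m y≤m with y <? c
  ... | yes y<c = <-≤-trans y<c c≤m
  unskip-< {c} {zero}  y≢c c≤m y≤m | no y≮c = ⊥-elim (y≢c (sym (n≤0⇒n≡0 (≮⇒≥ y≮c))))
  unskip-< {c} {suc y} y≢c c≤m y≤m | no y≮c = ≤-pred y≤m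

-- e enumerates a π-invariant subset of [0,n) increasingly, and d inverts e there.
record Enumeration (m n : ℕ) (π π⁻¹ e d : ℕ → ℕ) : Set where
  field
    e-mono : ∀ {x y} → x < y → e x < e y
    e<     : ∀ {x} → x < m → e x < n
    d<     : ∀ {x} → x < m → d (π (e x)) < m
    d⁻¹<   : ∀ {x} → x < m → d (π⁻¹ (e x)) < m
    ed     : ∀ {x} → x < m → e (d (π (e x))) ≡ π (e x)
    ed⁻¹   : ∀ {x} → x < m → e (d (π⁻¹ (e x))) ≡ π⁻¹ (e x)

  e-reflects-< : ∀ {x y} → e x < e y → x < y
  e-reflects-< {x} {y} ex<ey with <-cmp x y
  ... | tri< lt _ _   = lt
  ... | tri≈ _ refl _ = ⊥-elim (<-irrefl refl ex<ey)
  ... | tri> _ _ gt   = ⊥-elim (<-asym ex<ey (e-mono gt))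

  e-injective : ∀ {x y} → e x ≡ e y → x ≡ y
  e-injective {x} {y} eq with <-cmp x y
  ... | tri< lt _ _ = ⊥-elim (<⇒≢ (e-mono lt) eq)
  ... | tri≈ _ e _  = e
  ... | tri> _ _ gt = ⊥-elim (<⇒≢ (e-mono gt) (sym eq))

  restriction restriction⁻¹ : ℕ → ℕ
  restriction   = d ∘ π ∘ e
  restriction⁻¹ = d ∘ π⁻¹ ∘ e

  module _ (s : Strong n π π⁻¹) where
    open Strong s

    e² : ∀ {x} → x < m → e (restriction (restriction x)) ≡ π (π (e x))
    e² x<m = trans (ed (d< x<m)) (cong π (ed x<m))

    restriction-strong : Strong m restriction restriction⁻¹
    restriction-strong = record
      { perm = record
        { π<   = d<
        ; π⁻¹< = d⁻¹<
        ; invˡ = λ x<m → e-injective (trans (ed⁻¹ (d< x<m)) (trans (cong π⁻¹ (ed x<m)) (invˡ perm (e< x<m))))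
        ; invʳ = λ x<m → e-injective (trans (ed (d⁻¹< x<m)) (trans (cong π (ed⁻¹ x<m)) (invʳ perm (e< x<m))))
        }
      ; av  = λ i<j j<k k<m p q → let j<m = <-trans j<k k<m ; i<m = <-trans i<j j<m in
          av (e-mono i<j) (e-mono j<k) (e< k<m)
            (subst₂ _<_ (ed i<m) (ed k<m) (e-mono p)) (subst₂ _<_ (ed k<m) (ed j<m) (e-mono q))
      ; av² = λ i<j j<k k<m p q → let j<m = <-trans j<k k<m ; i<m = <-trans i<j j<m in
          av² (e-mono i<j) (e-mono j<k) (e< k<m)
            (subst₂ _<_ (e² i<m) (e² k<m) (e-mono p)) (subst₂ _<_ (e² k<m) (e² j<m) (e-mono q))
      }

-- The last t positions carry the t smallest values.
Site : ℕ → (ℕ → ℕ) → ℕ → Set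
Site n f t = ∀ {x} → x < n → n ≤ x + t → f x < t

-- By counting, an entry above π N in one of these places would follow one below π N.
late-below-last : ∀ {N π π⁻¹} → Perm (suc N) π π⁻¹ → Avoids (suc N) π → ∀ {y} → y < N → N ≤ y + π N → π y < π N
late-below-last {N} {π} {π⁻¹} P av {y} y<N N≤y+c with <-cmp (π y) (π N)
... | tri< lt _ _ = lt
... | tri≈ _ eq _ = ⊥-elim (<⇒≢ y<N (injective P (m<n⇒m<1+n y<N) (n<1+n N) eq))
... | tri> _ _ gt = ⊥-elim (<⇒≱ (subst (N <_) (trans (cong suc (+-comm y c)) (sym (+-suc c y))) (s≤s N≤y+c))
      (pigeonhole {m = c} {b = suc y} {h = N} π⁻¹ y<N
        (λ v v<c → after v<c , before v<c)
        (λ u v u<c v<c → injective (perm-inverse P) (small u<c) (small v<c))))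
  where
  c = π N
  small : ∀ {v} → v < c → v < suc N
  small v<c = <-trans v<c (π< P (n<1+n N))
  after : ∀ {v} → v < c → y < π⁻¹ v
  after {v} v<c with <-cmp y (π⁻¹ v)
  ... | tri< lt _ _   = lt
  ... | tri≈ _ eq _   = ⊥-elim (<-asym gt (subst (_< c) (trans (sym (invʳ P (small v<c))) (cong π (sym eq))) v<c))
  ... | tri> _ _ x<y  = ⊥-elim (av x<y y<N (n<1+n N) (subst (_< c) (sym (invʳ P (small v<c))) v<c) gt)
  before : ∀ {v} → v < c → π⁻¹ v < N
  before {v} v<c = ≤∧≢⇒< (≤-pred (π⁻¹< P (small v<c)))
    λ eq → <⇒≢ v<c (trans (sym (invʳ P (small v<c))) (cong π eq))

-- The maximum N lies on a three-cycle N ↦ c ↦ p ↦ N with c < p.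
ThreeCycle : ℕ → (ℕ → ℕ) → Set
ThreeCycle zero    π = ⊥
ThreeCycle (suc N) π = π N < π (π N) × π (π (π N)) ≡ N

threeCycle? : ∀ n π → Dec (ThreeCycle n π)
threeCycle? zero    π = no λ ()
threeCycle? (suc N) π with π N <? π (π N) | π (π (π N)) ≟ N
... | yes a | yes b = yes (a , b)
... | no ¬a | _     = no λ t → ¬a (proj₁ t)
... | _     | no ¬b = no λ t → ¬b (proj₂ t)

-- A strictly increasing self-map of the finite interval (p, N] has no room to move: induction from
-- the left gives t ≤ g t, from the right g t ≤ t.
mono⇒identity : ∀ {p N} (g : ℕ → ℕ) → (∀ {t} → p < t → t ≤ N → p < g t) → (∀ {t} → p < t → t ≤ N → g t ≤ N) →
                (∀ {t u} → p < t → t < u → u ≤ N → g t < g u) → ∀ {t} → p < t → t ≤ N → g t ≡ t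
mono⇒identity {p} {N} g g> g≤ g-mono {t₀} p<t₀ t₀≤N =
  ≤-antisym (upper (N ∸ t₀) (m+[n∸m]≡n t₀≤N) p<t₀) (lower t₀ p<t₀ t₀≤N)
  where
  lower : ∀ t → p < t → t ≤ N → t ≤ g t
  lower (suc t) p<t t≤N with m≤n⇒m<n∨m≡n (≤-pred p<t)
  ... | inj₁ p<t′ = ≤-<-trans (lower t p<t′ (<⇒≤ t≤N)) (g-mono p<t′ (n<1+n t) t≤N)
  ... | inj₂ refl = g> p<t t≤N
  upper : ∀ k {t} → t + k ≡ N → p < t → g t ≤ t
  upper zero    {t} eq p<t = subst (g t ≤_) (sym t≡N) (g≤ p<t (≤-reflexive t≡N))
    where t≡N = trans (sym (+-identityʳ t)) eq
  upper (suc k) {t} eq p<t = ≤-pred (<-≤-trans (g-mono p<t (n<1+n t) (subst (suc t ≤_) eq′ (m≤m+n (suc t) k)))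
      (upper k eq′ (m<n⇒m<1+n p<t)))
    where eq′ = trans (sym (+-suc t k)) eq

module RemoveThreeCycle {m π π⁻¹} (s : Strong (3 + m) π π⁻¹) (three : ThreeCycle (3 + m) π) where

  open Strong s

  N c p : ℕ
  N = 2 + m
  c = π N
  p = π c

  private
    n = 3 + m
    σ = π ∘ π
    PP = perm-∘ perm perm
    N<n : N < n
    N<n = n<1+n N

  c<p : c < p
  c<p = proj₁ three
  πp≡N : π p ≡ N
  πp≡N = proj₂ three
  c<n : c < n
  c<n = π< perm N<n
  p<n : p < n
  p<n = π< perm c<n

  p<N : p < N
  p<N = ≤∧≢⇒< (≤-pred p<n) λ p≡N →
    <⇒≢ c<p (trans (cong π (sym p≡N)) (trans πp≡N (sym p≡N)))

  c<N : c < N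
  c<N = <-trans c<p p<N

  q′ : ℕ
  q′ = N ∸ suc p

  p+q≡N : p + suc q′ ≡ N
  p+q≡N = trans (+-suc p q′) (m+[n∸m]≡n p<N)

  open Maximum perm av p+q≡N πp≡N using (tail<; head≥)

  c≤q′ : c ≤ q′
  c≤q′ = ≤-pred (tail< p<N N<n)

  q≤p : suc q′ ≤ p
  q≤p = head≥ (<⇒≤ c<p)

  -- Otherwise `Exchange` would make π an involution, although π (π N) = p differs from N.
  π0≤p : π 0 ≤ p
  π0≤p = ≮⇒≥ λ p<π0 → <⇒≢ p<N (Exchange.involutive perm av² (m≤n⇒m≤1+n q≤p) p<n (s≤s z≤n)
    tail< (λ x<sp → head≥ (≤-pred x<sp)) p<π0 N<n)

  open LateMaximum perm av av² p+q≡N πp≡N q≤p p<N π0≤p using (first≤j; high-mono; σ-tail-mono; σ-mono-after)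

  -- Were σ k ≤ p, the q values of (p,N] would all be attained by σ on [0,k).
  first-σ>p : ∀ {k} → k < suc q′ → p < σ k
  first-σ>p {k} k<q = ≰⇒> λ σk≤p → <⇒≱ k<q (subst (_≤ k) (+-identityʳ (suc q′))
      (pigeonhole {m = suc q′} {b = 0} (λ i → σ⁻¹ (suc p + i)) z≤n
        (λ i i<q → z≤n , bound σk≤p (m≤m+n (suc p) i) (range i<q))
        (λ i l i<q l<q eq → +-cancelˡ-≡ (suc p) i l (injective (perm-inverse PP) (range i<q) (range l<q) eq))))
    where
    σ⁻¹ = π⁻¹ ∘ π⁻¹
    k<N : k < N
    k<N = ≤-<-trans (≤-trans (≤-pred k<q) (<⇒≤ q≤p)) p<N
    k<n = <-trans k<N N<n
    range : ∀ {i} → i < suc q′ → suc p + i < n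
    range {i} i<q = s≤s (subst (suc p + i ≤_) p+q≡N (subst (_≤ p + suc q′) (+-suc p i) (+-monoʳ-≤ p i<q)))
    bound : σ k ≤ p → ∀ {t} → p < t → t < n → σ⁻¹ t < k
    bound σk≤p {t} p<t t<n with <-cmp (σ⁻¹ t) k
    ... | tri< lt _ _ = lt
    ... | tri≈ _ eq _ = ⊥-elim (<⇒≱ p<t (subst (_≤ p) (trans (cong σ (sym eq)) (invʳ PP t<n)) σk≤p))
    ... | tri> _ _ gt = ⊥-elim (av² gt r<N N<n
        (≤∧≢⇒< σk≤p λ eq → <⇒≢ k<N (injective PP k<n N<n eq))
        (subst (p <_) (sym (invʳ PP t<n)) p<t))
      where
      r<N : σ⁻¹ t < N
      r<N = ≤∧≢⇒< (≤-pred (π⁻¹< PP t<n)) λ r≡N → <⇒≢ p<t (trans (cong σ (sym r≡N)) (invʳ PP t<n))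

  -- π³ is an increasing self-map of (p, N]: σ increases on the tail with values at most p, by
  -- `first≤j` with j = p; the images of these values exceed p, by `first-σ>p`; and π increases
  -- where its values exceed p.
  cube-tail : ∀ {t} → p < t → t ≤ N → π (σ t) ≡ t
  cube-tail = mono⇒identity (π ∘ σ)
    (λ p<t t≤N → first-σ>p (tail< p<t (s≤s t≤N)))
    (λ p<t t≤N → ≤-pred (π< perm (π< perm (π< perm (s≤s t≤N)))))
    (λ p<t t<u u≤N → high-mono (σ-tail-mono p<t t<u (s≤s u≤N))
      (first≤j (tail< (<-trans p<t t<u) (s≤s u≤N)))
      (first-σ>p (tail< p<t (s≤s (≤-trans (<⇒≤ t<u) u≤N))))
      (first-σ>p (tail< (<-trans p<t t<u) (s≤s u≤N))))

  e d : ℕ → ℕ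
  e x = skip p (skip c x)
  d y = unskip c (unskip p y)

  private
    e<N : ∀ {x} → x < m → e x < N
    e<N {x} x<m = ≤-<-trans (skip≤ p _) (s≤s (≤-<-trans (skip≤ c x) (s≤s x<m)))

    e≢c : ∀ x → e x ≢ c
    e≢c x eq with skip c x <? p
    ... | yes <p = skip-≢ c x (trans (sym (skip-< <p)) eq)
    ... | no ≮p = ≮p (<-trans (n<1+n _) (subst (_< p) (trans (sym eq) (skip-≥ (≮⇒≥ ≮p))) c<p))

    unskip-p≢c : ∀ {y} → y ≢ c → y ≢ p → unskip p y ≢ c
    unskip-p≢c y≢c y≢p eq = y≢c (trans (sym (skip-unskip y≢p)) (trans (cong (skip p) eq) (skip-< c<p)))

    p≤1+m : p ≤ suc m
    p≤1+m = ≤-pred p<N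

  ed-id : ∀ {y} → y ≢ c → y ≢ p → e (d y) ≡ y
  ed-id y≢c y≢p = trans (cong (skip p) (skip-unskip (unskip-p≢c y≢c y≢p))) (skip-unskip y≢p)

  d<m : ∀ {y} → y < N → y ≢ c → y ≢ p → d y < m
  d<m y<N y≢c y≢p = unskip-< (unskip-p≢c y≢c y≢p) (≤-pred (<-≤-trans c<p p≤1+m)) (unskip-< y≢p p≤1+m y<N)

  private
    module _ {y} (y<N : y < N) (y≢c : y ≢ c) (y≢p : y ≢ p) where
      y<n = <-trans y<N N<n
      π≢c : π y ≢ c
      π≢c = π-≢ perm y<n N<n (<⇒≢ y<N)
      π≢p : π y ≢ p
      π≢p = π-≢ perm y<n c<n y≢c
      πy<N : π y < N
      πy<N = ≤∧≢⇒< (≤-pred (π< perm y<n)) λ eq → π-≢ perm y<n p<n y≢p (trans eq (sym πp≡N))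
      undo : ∀ {v} → π⁻¹ y ≡ v → y ≡ π v
      undo eq = trans (sym (invʳ perm y<n)) (cong π eq)
      π⁻¹≢c : π⁻¹ y ≢ c
      π⁻¹≢c eq = y≢p (undo eq)
      π⁻¹≢p : π⁻¹ y ≢ p
      π⁻¹≢p eq = <⇒≢ y<N (trans (undo eq) πp≡N)
      π⁻¹y<N : π⁻¹ y < N
      π⁻¹y<N = ≤∧≢⇒< (≤-pred (π⁻¹< perm y<n)) λ eq → y≢c (undo eq)

  enumeration : Enumeration m n π π⁻¹ e d
  enumeration = record
    { e-mono = skip-mono p ∘ skip-mono c
    ; e<   = λ x<m → <-trans (e<N x<m) N<n
    ; d<   = λ {x} x<m → d<m (πy<N (e<N x<m) (e≢c x) (skip-≢ p _)) (π≢c (e<N x<m) (e≢c x) (skip-≢ p _)) (π≢p (e<N x<m) (e≢c x) (skip-≢ p _))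
    ; d⁻¹< = λ {x} x<m → d<m (π⁻¹y<N (e<N x<m) (e≢c x) (skip-≢ p _)) (π⁻¹≢c (e<N x<m) (e≢c x) (skip-≢ p _)) (π⁻¹≢p (e<N x<m) (e≢c x) (skip-≢ p _))
    ; ed   = λ {x} x<m → ed-id (π≢c (e<N x<m) (e≢c x) (skip-≢ p _)) (π≢p (e<N x<m) (e≢c x) (skip-≢ p _))
    ; ed⁻¹ = λ {x} x<m → ed-id (π⁻¹≢c (e<N x<m) (e≢c x) (skip-≢ p _)) (π⁻¹≢p (e<N x<m) (e≢c x) (skip-≢ p _))
    }

  open Enumeration enumeration public

  π′ = restriction

  rest : Strong m restriction restriction⁻¹
  rest = restriction-strong s

  private
    e-late : ∀ {x} → p ≤ suc x → e x ≡ 2 + x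
    e-late {x} p≤sx = trans (cong (skip p) (skip-≥ c≤x)) (skip-≥ p≤sx)
      where c≤x = ≤-pred (<-≤-trans c<p p≤sx)

    e-middle : ∀ {x} → c ≤ x → suc x < p → e x ≡ suc x
    e-middle c≤x sx<p = trans (cong (skip p) (skip-≥ c≤x)) (skip-< sx<p)

    e≥⇒≥ : ∀ {v t} → t ≤ v → t ≤ e v
    e≥⇒≥ {v} t≤v = ≤-trans t≤v (≤-trans (x≤skip c v) (x≤skip p _))

    m≡p+q′ : suc m ≡ p + q′
    m≡p+q′ = suc-injective (trans (sym p+q≡N) (+-suc p q′))

  private
    e<⇒< : ∀ {v t} → e v < t → v < t
    e<⇒< {v} h = ≤-<-trans (e≥⇒≥ {v} ≤-refl) h

    e<suc⇒< : ∀ {v t} → c ≤ t → t < p → e v < suc t → v < t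
    e<suc⇒< {v} {t} c≤t t<p h with v <? t
    ... | yes lt = lt
    ... | no ≮t = ⊥-elim (<⇒≱ h (<-≤-trans (subst (t <_) (sym (skip-≥ c≤v)) (s≤s t≤v)) (x≤skip p _)))
      where
      t≤v = ≮⇒≥ ≮t
      c≤v = ≤-trans c≤t t≤v

  site-q′ : Site m π′ q′
  site-q′ {x} x<m m≤x+q′ = e<suc⇒< c≤q′ q≤p (subst (_< suc q′) (sym (ed x<m)) (tail< p<ex (e< x<m)))
    where
    p≤sx : p ≤ suc x
    p≤sx = +-cancelʳ-≤ q′ p (suc x) (subst (_≤ suc x + q′) m≡p+q′ (s≤s m≤x+q′))
    p<ex : p < e x
    p<ex = subst (p <_) (sym (e-late p≤sx)) (s≤s p≤sx)

  site-c : Site m π′ c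
  site-c {x} x<m m≤x+c = e<⇒< (subst (_< c) (sym (ed x<m)) (late-below-last perm av (e<N x<m)
      (subst (λ v → N ≤ v + c) (sym (e-late p≤sx)) (s≤s (s≤s m≤x+c)))))
    where
    p≤sx : p ≤ suc x
    p≤sx = +-cancelʳ-≤ q′ p (suc x) (subst (_≤ suc x + q′) m≡p+q′ (s≤s (≤-trans m≤x+c (+-monoʳ-≤ x c≤q′))))

  -- A nonempty block of last positions contains N, hence the value c; unless it is everything, it
  -- must not contain p, where the maximum stands. This gives c ≤ u ≤ q′.
  sites : ∀ {t} → t < n → Site n π t → t ≡ 0 ⊎ ∃[ u ] (t ≡ suc u × c ≤ u × u ≤ q′ × Site m π′ u)
  sites {zero}  _   _  = inj₁ refl
  sites {suc u} t<n st = inj₂ (u , refl , c≤u , u≤q′ , λ {x} x<m m≤x+u → e<suc⇒< c≤u (<-≤-trans (s≤s u≤q′) q≤p)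
      (subst (_< suc u) (sym (ed x<m)) (st (e< x<m) (subst (n ≤_) (sym (+-suc (e x) u)) (s≤s
        (subst (λ v → N ≤ v + u) (sym (e-late (p≤sx m≤x+u))) (s≤s (s≤s m≤x+u))))))))
    where
    c≤u : c ≤ u
    c≤u = ≤-pred (st N<n (subst (n ≤_) (sym (+-suc N u)) (s≤s (m≤m+n N u))))
    u≤q′ : u ≤ q′
    u≤q′ = ≮⇒≥ λ q′<u → <⇒≱ t<n (subst (_≤ suc u) (cong suc πp≡N) (st p<n
      (subst (_≤ p + suc u) (trans (+-suc p (suc q′)) (cong suc p+q≡N)) (+-monoʳ-≤ p (s≤s q′<u)))))
    p≤sx : ∀ {x} → m ≤ x + u → p ≤ suc x
    p≤sx {x} m≤x+u = +-cancelʳ-≤ q′ p (suc x) (subst (_≤ suc x + q′) m≡p+q′ (s≤s (≤-trans m≤x+u (+-monoʳ-≤ x u≤q′))))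

  q′≡0⊎<m : q′ ≡ 0 ⊎ q′ < m
  q′≡0⊎<m with q′ in eq
  ... | zero  = inj₁ refl
  ... | suc r = inj₂ (≤-pred (subst (2 + suc r ≤_) (trans (cong (p +_) (sym eq)) (sym m≡p+q′))
          (+-monoˡ-≤ (suc r) {2} (≤-trans (s≤s (s≤s z≤n)) (subst (λ v → suc v ≤ p) eq q≤p)))))

  module _ (0<q′ : 0 < q′) {M} (m≡1+M : m ≡ suc M) where

    private
      p<m+1 : p < suc m
      p<m+1 = ≤-pred (subst (2 + p ≤_) (cong suc (sym m≡p+q′)) (s≤s (subst (_≤ p + q′) (+-comm p 1) (+-monoʳ-≤ p 0<q′))))

      1+m≤N : suc m ≤ N
      1+m≤N = n≤1+n (suc m)

      eM : e M ≡ suc m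
      eM = trans (e-late (≤-pred (subst (λ v → p < suc v) m≡1+M p<m+1))) (cong suc (sym m≡1+M))

      M<m : M < m
      M<m = subst (M <_) (sym m≡1+M) (n<1+n M)

      a b : ℕ
      a = π (suc m)
      b = π a

      a<q : a < suc q′
      a<q = tail< p<m+1 (s≤s 1+m≤N)
      πb : π b ≡ suc m
      πb = cube-tail p<m+1 1+m≤N
      q≤b : suc q′ ≤ b
      q≤b = ≮⇒≥ λ b<q → <⇒≱ p<m+1 (subst (_≤ p) πb (first≤j b<q))
      b<n : b < n
      b<n = π< perm (π< perm (s≤s 1+m≤N))
      b≤p : b ≤ p
      b≤p = ≮⇒≥ λ p<b → <⇒≱ (tail< p<b b<n) (≤-trans q≤p (subst (p ≤_) (sym πb) (<⇒≤ p<m+1)))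
      b<p : b < p
      b<p = ≤∧≢⇒< b≤p λ eq → <⇒≢ (n<1+n (suc m)) (trans (sym πb) (trans (cong π eq) πp≡N))

      eπ′M : e (restriction M) ≡ a
      eπ′M = trans (ed {M} M<m) (cong π eM)
      eπ′²M : e (restriction (restriction M)) ≡ b
      eπ′²M = trans (ed {restriction M} (d< {M} M<m)) (cong π eπ′M)

    -- When q′ > 0, position N - 1 also lies after p, so `cube-tail` puts it on a three-cycle, and
    -- removal makes this the cycle of the new maximum.
    restriction-threeCycle : restriction M < restriction (restriction M) × restriction (restriction (restriction M)) ≡ M
    restriction-threeCycle =
      e-reflects-< (subst₂ _<_ (sym eπ′M) (sym eπ′²M) (<-≤-trans a<q q≤b)) ,
      e-injective (trans (ed {restriction (restriction M)} (d< {restriction M} (d< {M} M<m))) (trans (cong π eπ′²M) (trans πb (sym eM))))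

    -- A position y = π⁻¹ (1 + b) strictly between would form 132 with 0 and c.
    maximum-before-p : c ≢ 0 → suc b ≡ p
    maximum-before-p c≢0 = ≤-antisym b<p (≮⇒≥ gap)
      where
      between : ∀ {x} → b < x → x < p → ¬ p < π x
      between {x} b<x x<p p<πx = <⇒≱
        (subst (π x <_) πp≡N (high-mono {x} {p} x<p ≤-refl p<πx (subst (p <_) (sym πp≡N) p<N)))
        (subst (_< π x) πb (high-mono {b} {x} b<x (<⇒≤ x<p) (subst (p <_) (sym πb) p<m+1) p<πx))
      π0≤b : π 0 ≤ b
      π0≤b = ≮⇒≥ λ b<π0 → between {π 0} b<π0
        (≤∧≢⇒< π0≤p λ eq → c≢0 (sym (injective perm (s≤s z≤n) c<n eq)))
        (first-σ>p {0} (s≤s z≤n))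
      gap : ¬ suc b < p
      gap z<p = av {0} {c} {y} (n≢0⇒n>0 c≢0) (<-≤-trans (s≤s c≤q′) q≤y) (π⁻¹< perm z<n)
              (subst (π 0 <_) (sym πy) (s≤s π0≤b))
              (subst (_< p) (sym πy) z<p)
        where
        z<n : suc b < n
        z<n = <-trans z<p p<n
        y = π⁻¹ (suc b)
        πy : π y ≡ suc b
        πy = invʳ perm z<n
        q≤y : suc q′ ≤ y
        q≤y = ≮⇒≥ λ y<q → between {suc b} (n<1+n b) z<p (subst (λ v → p < π v) πy (first-σ>p {y} y<q))

    -- The old maximum at b = p - 1 moves to b - 1 when c is removed, and p + q′ = m + 1. So q′ is
    -- its distance from the end, which `Describes.head` identifies with the first listed site.
    head-site : c ≢ 0 → restriction⁻¹ M + q′ ≡ M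
    head-site c≢0 = suc-injective (suc-injective (trans (cong (λ v → suc (suc v) + q′) p″≡)
        (trans (cong (λ v → suc v + q′) (suc-pred-b)) (trans (cong (_+ q′) (maximum-before-p c≢0))
          (trans (sym m≡p+q′) (cong suc m≡1+M))))))
      where
      c<b : c < b
      c<b = <-≤-trans (s≤s c≤q′) q≤b
      suc-pred-b : suc (pred b) ≡ b
      suc-pred-b = suc-pred b {{>-nonZero (≤-<-trans z≤n c<b)}}
      p″≡ : restriction⁻¹ M ≡ pred b
      p″≡ = e-injective (trans (ed⁻¹ {M} M<m) (trans (cong π⁻¹ eM) (trans (cong π⁻¹ (sym πb)) (trans (invˡ perm b<n)
        (trans (sym suc-pred-b) (sym (e-middle (≤-pred (subst (c <_) (sym suc-pred-b) c<b))
          (subst (_< p) (sym suc-pred-b) b<p))))))))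

  reinsert : ∀ {y} → y < N → y ≢ c → y ≢ p → π y ≡ e (restriction (d y))
  reinsert y<N y≢c y≢p = trans (cong π (sym (ed-id y≢c y≢p))) (sym (ed (d<m y<N y≢c y≢p)))

-- Two-cycles through the maximum of an involution

infix 4 _≈[_]_
_≈[_]_ : (ℕ → ℕ) → ℕ → (ℕ → ℕ) → Set
f ≈[ n ] g = ∀ {x} → x < n → f x ≡ g x

involution-strong : ∀ {n π} → Perm n π π → Avoids n π → Strong n π π
involution-strong {n} P av = record { perm = P ; av = av ; av² = λ i<j j<k k<n p q →
  <-asym j<k (subst₂ _<_ (invʳ P k<n) (invʳ P (<-trans j<k k<n)) q) }

module RemoveTwoCycle {m π} (s : Strong (2 + m) π π) (c<N : π (suc m) < suc m) where

  open Strong s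

  N c : ℕ
  N = suc m
  c = π N

  private
    n = 2 + m
    N<n : N < n
    N<n = n<1+n N
    πc : π c ≡ N
    πc = invʳ perm N<n
    open Maximum perm av {p = c} (m+[n∸m]≡n (<⇒≤ c<N)) πc using (tail<)

  2c≤m : c + c ≤ m
  2c≤m = ≤-pred (subst (c + c <_) (m+[n∸m]≡n (<⇒≤ c<N)) (+-monoʳ-< c (tail< c<N N<n)))

  private
    c≤m : c ≤ m
    c≤m = ≤-pred c<N
    e = skip c
    d = unskip c
    e<N : ∀ {x} → x < m → e x < N
    e<N {x} x<m = ≤-<-trans (skip≤ c x) (s≤s x<m)
    π≢c : ∀ {y} → y < N → π y ≢ c
    π≢c y<N = π-≢ perm (<-trans y<N N<n) N<n (<⇒≢ y<N)
    π<N : ∀ {y} → y < N → y ≢ c → π y < N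
    π<N y<N y≢c = ≤∧≢⇒< (≤-pred (π< perm (<-trans y<N N<n)))
      λ eq → π-≢ perm (<-trans y<N N<n) (<-trans c<N N<n) y≢c (trans eq (sym πc))
    d<m : ∀ {x} → x < m → d (π (e x)) < m
    d<m {x} x<m = unskip-< (π≢c (e<N x<m)) c≤m (π<N (e<N x<m) (skip-≢ c x))

  enumeration : Enumeration m n π π (skip c) (unskip c)
  enumeration = record
    { e-mono = skip-mono c
    ; e<   = λ x<m → <-trans (e<N x<m) N<n
    ; d<   = d<m
    ; d⁻¹< = d<m
    ; ed   = λ x<m → skip-unskip (π≢c (e<N x<m))
    ; ed⁻¹ = λ x<m → skip-unskip (π≢c (e<N x<m))
    }

  open Enumeration enumeration public

  rest : Strong m restriction restriction
  rest = restriction-strong s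

  private
    late : ∀ {x u} → c ≤ u → u + u ≤ m → m ≤ x + u → c ≤ x
    late {x} {u} c≤u 2u≤m m≤x+u = ≤-trans c≤u (+-cancelʳ-≤ u u x (≤-trans 2u≤m m≤x+u))

  site-c : Site m restriction c
  site-c {x} x<m m≤x+c = ≤-<-trans (x≤skip c _) (subst (_< c) (sym (ed x<m)) (late-below-last perm av (e<N x<m)
    (subst (λ v → N ≤ v + c) (sym (skip-≥ (late ≤-refl 2c≤m m≤x+c))) (s≤s m≤x+c))))

  -- Only sites up to half the size are tracked: by `2c≤m` no insertion uses a larger one, and 2u ≤
  -- m is the same as 2(u + 1) ≤ m + 2.
  sites : ∀ {t} → t + t ≤ n → Site n π t → t ≡ 0 ⊎ ∃[ u ] (t ≡ suc u × c ≤ u × u + u ≤ m × Site m restriction u)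
  sites {zero}  _    _  = inj₁ refl
  sites {suc u} 2t≤n st = inj₂ (u , refl , c≤u , 2u≤m , site)
    where
    c≤u : c ≤ u
    c≤u = ≤-pred (st N<n (subst (n ≤_) (sym (+-suc N u)) (s≤s (m≤m+n N u))))
    2u≤m : u + u ≤ m
    2u≤m = ≤-pred (≤-pred (subst (_≤ n) (cong suc (+-suc u u)) 2t≤n))
    site : Site m restriction u
    site {x} x<m m≤x+u = ≰⇒> λ u≤v → <⇒≱ below (subst (suc u ≤_) (sym (skip-≥ (≤-trans c≤u u≤v))) (s≤s u≤v))
      where
      below : e (restriction x) < suc u
      below = subst (_< suc u) (sym (ed x<m)) (st (e< x<m)
        (subst (λ v → n ≤ v + suc u) (sym (skip-≥ (late c≤u 2u≤m m≤x+u)))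
          (subst (n ≤_) (sym (+-suc (suc x) u)) (s≤s (s≤s m≤x+u)))))

abstract
  insertTwoCycle : ℕ → ℕ → (ℕ → ℕ) → ℕ → ℕ
  insertTwoCycle N c f y with y ≟ N | y ≟ c
  ... | yes _ | _     = c
  ... | no _  | yes _ = N
  ... | no _  | no _  = skip c (f (unskip c y))

  insert-N : ∀ {N c f} → insertTwoCycle N c f N ≡ c
  insert-N {N} with N ≟ N
  ... | yes _ = refl
  ... | no ≢N = ⊥-elim (≢N refl)

  insert-c : ∀ {N c f} → c ≢ N → insertTwoCycle N c f c ≡ N
  insert-c {N} {c} c≢N with c ≟ N | c ≟ c
  ... | yes eq | _     = ⊥-elim (c≢N eq)
  ... | no _   | yes _ = refl
  ... | no _   | no ≢c = ⊥-elim (≢c refl)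

  insert-other : ∀ {N c f y} → y ≢ N → y ≢ c → insertTwoCycle N c f y ≡ skip c (f (unskip c y))
  insert-other {N} {c} {f} {y} y≢N y≢c with y ≟ N | y ≟ c
  ... | yes eq | _      = ⊥-elim (y≢N eq)
  ... | no _   | yes eq = ⊥-elim (y≢c eq)
  ... | no _   | no _   = refl

unskip-skip : ∀ {c x} → unskip c (skip c x) ≡ x
unskip-skip {c} {x} with <-cmp (unskip c (skip c x)) x
... | tri≈ _ eq _ = eq
... | tri< lt _ _ = ⊥-elim (<⇒≢ (skip-mono c lt) (skip-unskip (skip-≢ c x)))
... | tri> _ _ gt = ⊥-elim (<⇒≢ (skip-mono c gt) (sym (skip-unskip (skip-≢ c x))))

insert-skip : ∀ {m c f x} → x < m → insertTwoCycle (suc m) c f (skip c x) ≡ skip c (f x)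
insert-skip {m} {c} {f} {x} x<m = trans
  (insert-other (<⇒≢ (≤-<-trans (skip≤ c x) (s≤s x<m))) (skip-≢ c x))
  (cong (skip c ∘ f) unskip-skip)

insert-≈ : ∀ {m c f g} → c ≤ m → f ≈[ m ] g → insertTwoCycle (suc m) c f ≈[ 2 + m ] insertTwoCycle (suc m) c g
insert-≈ {m} {c} c≤m f≈g {y} y<n with y ≟ suc m | y ≟ c
... | yes refl | _     = trans insert-N (sym insert-N)
... | no y≢N | yes refl = trans (insert-c y≢N) (sym (insert-c y≢N))
... | no y≢N | no y≢c = trans (insert-other y≢N y≢c) (trans
  (cong (skip c) (f≈g (unskip-< y≢c c≤m (≤∧≢⇒< (≤-pred y<n) y≢N)))) (sym (insert-other y≢N y≢c)))

module _ {m π} (s : Strong (2 + m) π π) (c<N : π (suc m) < suc m) where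
  open RemoveTwoCycle s c<N
  open Strong s

  insert-restriction : insertTwoCycle N c restriction ≈[ 2 + m ] π
  insert-restriction {y} y<n with y ≟ N | y ≟ c
  ... | yes refl | _ = insert-N
  ... | no y≢N | yes refl = trans (insert-c y≢N) (sym (invʳ perm (n<1+n N)))
  ... | no y≢N | no y≢c = trans (insert-other y≢N y≢c) (trans (ed (unskip-< y≢c (≤-pred c<N) (≤∧≢⇒< (≤-pred y<n) y≢N))) (cong π (skip-unskip y≢c)))

module InsertTwoCycle {m f} (s : Strong m f f) {c} (2c≤m : c + c ≤ m) (site : Site m f c) where

  open Strong s

  private
    n = 2 + m
    N = suc m
    e = skip c
    g = insertTwoCycle N c f
    c≤m : c ≤ m
    c≤m = ≤-trans (m≤m+n c c) 2c≤m
    c<N : c < N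
    c<N = s≤s c≤m
    gN : g N ≡ c
    gN = insert-N {N} {c} {f}
    gc : g c ≡ N
    gc = insert-c {N} {c} {f} (<⇒≢ c<N)
    ge : ∀ {x} → x < m → g (e x) ≡ e (f x)
    ge = insert-skip {m} {c} {f}
    e<N : ∀ {x} → x < m → e x < N
    e<N {x} x<m = ≤-<-trans (skip≤ c x) (s≤s x<m)

  data View : ℕ → Set where
    top  : View N
    mate : View c
    old  : ∀ {x} → x < m → View (e x)

  view : ∀ {y} → y < n → View y
  view {y} y<n with y ≟ N | y ≟ c
  ... | yes refl | _ = top
  ... | no _ | yes refl = mate
  ... | no y≢N | no y≢c = subst View (skip-unskip y≢c) (old (unskip-< y≢c c≤m (≤∧≢⇒< (≤-pred y<n) y≢N)))

  private
    below : ∀ {y} → View y → g y < n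
    below top     = subst (_< n) (sym gN) (m<n⇒m<1+n c<N)
    below mate    = subst (_< n) (sym gc) (n<1+n N)
    below (old x<m) = subst (_< n) (sym (ge x<m)) (m<n⇒m<1+n (e<N (π< perm x<m)))
    invol : ∀ {y} → View y → g (g y) ≡ y
    invol top     = trans (cong g gN) gc
    invol mate    = trans (cong g gc) gN
    invol (old x<m) = trans (cong g (ge x<m)) (trans (ge (π< perm x<m)) (cong e (invʳ perm x<m)))

    -- By counting, only the last c entries are smaller than c.
    site⁻¹ : ∀ {x} → x < m → f x < c → m ≤ x + c
    site⁻¹ {x} x<m fx<c = ≮⇒≥ λ x+c<m → <⇒≱ (n<1+n c) (subst (_≤ c) (+-identityʳ (suc c))
        (pigeonhole {m = suc c} {b = 0} (f ∘ a) z≤n (λ i _ → z≤n , a-small i) (λ i j i≤c j≤c eq → a-inj x+c<m i j i≤c j≤c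
          (injective perm (a<m i) (a<m j) eq))))
      where
      a : ℕ → ℕ
      a i with i <? c
      ... | yes _ = m ∸ suc i
      ... | no  _ = x
      late : ∀ {i} → i < c → m ≤ (m ∸ suc i) + c
      late {i} i<c = subst (_≤ m ∸ suc i + c) (m∸n+n≡m (≤-trans i<c c≤m)) (+-monoʳ-≤ (m ∸ suc i) i<c)
      low : ∀ {i} → i < c → m ∸ suc i < m
      low {i} i<c = ∸-monoʳ-< {m} {suc i} {0} (s≤s z≤n) (≤-trans i<c c≤m)
      a<m : ∀ i → a i < m
      a<m i with i <? c
      ... | yes i<c = low i<c
      ... | no  _   = x<m
      a-small : ∀ i → f (a i) < c
      a-small i with i <? c
      ... | yes i<c = site (low i<c) (late i<c)
      ... | no  _   = fx<c
      a-inj : x + c < m → ∀ i j → i < suc c → j < suc c → a i ≡ a j → i ≡ j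
      a-inj x+c<m i j i≤c j≤c eq with i <? c | j <? c
      ... | yes i<c | yes j<c = suc-injective (∸-cancelˡ-≡ (≤-trans i<c c≤m) (≤-trans j<c c≤m) eq)
      ... | yes i<c | no _    = ⊥-elim (<⇒≱ x+c<m (subst (λ v → m ≤ v + c) eq (late i<c)))
      ... | no _    | yes j<c = ⊥-elim (<⇒≱ x+c<m (subst (λ v → m ≤ v + c) (sym eq) (late j<c)))
      ... | no i≮c  | no j≮c  = trans (≤-antisym (≤-pred i≤c) (≮⇒≥ i≮c)) (≤-antisym (≮⇒≥ j≮c) (≤-pred j≤c))

    c≤-late : ∀ {x} → m ≤ x + c → c ≤ x
    c≤-late {x} h = +-cancelʳ-≤ c c x (≤-trans 2c≤m h)

    e-reflects : ∀ {x y} → e x < e y → x < y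
    e-reflects {x} {y} ex<ey with <-cmp x y
    ... | tri< lt _ _   = lt
    ... | tri≈ _ refl _ = ⊥-elim (<-irrefl refl ex<ey)
    ... | tri> _ _ gt   = ⊥-elim (<-asym ex<ey (skip-mono c gt))

    small-e : ∀ {x} → e x < c → x < c
    small-e {x} h = ≤-<-trans (x≤skip c x) h

    large-e : ∀ {x} → c < e x → c ≤ x
    large-e {x} h = ≮⇒≥ λ x<c → <-asym h (subst (_< c) (sym (skip-< x<c)) x<c)

    -- By the site condition the last c positions carry the c smallest values; as f is an
    -- involution, the first c positions then carry the c largest. Together these exclude a 132
    -- through the new pair.
    avoid : ∀ {i j k} → View i → View j → View k → i < j → j < k → k < n → g i < g k → g k < g j → ⊥
    avoid {j = j} _ vj mate _ _ _ _ gk<gj = <⇒≱ (subst (_< g j) gc gk<gj) (≤-pred (below vj))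
    avoid _ top (old _) _ N<k k<n _ _ = <⇒≱ N<k (≤-pred k<n)
    avoid top _ _ N<j j<k k<n _ _ = <⇒≱ (<-trans N<j j<k) (≤-pred k<n)
    avoid {k = k} mate _ vk _ _ _ gi<gk _ = <⇒≱ (subst (_< g k) gc gi<gk) (≤-pred (below vk))
    avoid (old {x} x<m) top top _ j<k _ _ _ = <-irrefl refl j<k
    avoid (old {x} x<m) mate top i<c _ _ gi<gk _ = <⇒≱ (small-e i<c) (c≤-late (site⁻¹ x<m fx<c))
      where fx<c = small-e (subst₂ _<_ (ge x<m) gN gi<gk)
    avoid (old {x} x<m) (old {y} y<m) top i<j _ _ gi<gk gk<gj = <⇒≱ (subst₂ _<_ gN (ge y<m) gk<gj)
        (<⇒≤ (subst (_< c) (sym (skip-< fy<c)) fy<c))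
      where
      fx<c = small-e (subst₂ _<_ (ge x<m) gN gi<gk)
      fy<c = site y<m (≤-trans (site⁻¹ x<m fx<c) (+-monoˡ-≤ c (<⇒≤ (e-reflects i<j))))
    -- Here x < c ≤ z, so f x is among the c largest values and f z is not.
    avoid (old {x} x<m) mate (old {z} z<m) i<c c<k _ gi<gk _ = <⇒≱ fx<fz (+-cancelʳ-≤ c (f z) (f x)
        (≤-trans (<⇒≤ (≰⇒> λ h → <⇒≱ (subst (_< c) (invʳ perm z<m) (site (π< perm z<m) h)) (large-e c<k)))
          (site⁻¹ (π< perm x<m) (subst (_< c) (sym (invʳ perm x<m)) (small-e i<c)))))
      where fx<fz = e-reflects (subst₂ _<_ (ge x<m) (ge z<m) gi<gk)
    avoid (old x<m) (old y<m) (old z<m) i<j j<k _ gi<gk gk<gj =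
      av (e-reflects i<j) (e-reflects j<k) z<m
        (e-reflects (subst₂ _<_ (ge x<m) (ge z<m) gi<gk)) (e-reflects (subst₂ _<_ (ge z<m) (ge y<m) gk<gj))

  inserted : Strong n g g
  inserted = involution-strong
    (record { π< = below ∘ view ; π⁻¹< = below ∘ view ; invˡ = invol ∘ view ; invʳ = invol ∘ view })
    (λ i<j j<k k<n → avoid (view (<-trans i<j (<-trans j<k k<n))) (view (<-trans j<k k<n)) (view k<n) i<j j<k k<n)

  inserted-site : ∀ {u} → c ≤ u → u + u ≤ m → Site m f u → Site n g (suc u)
  inserted-site {u} c≤u 2u≤m st y<n h = go (view y<n) h
    where
    early : ∀ {x} → x ≤ u → n ≤ x + suc u → ⊥
    early {x} x≤u h = <⇒≱ (s≤s (s≤s 2u≤m)) (≤-trans h (subst (_≤ suc (u + u)) (sym (+-suc x u)) (s≤s (+-monoˡ-≤ u x≤u))))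
    go : ∀ {y} → View y → n ≤ y + suc u → g y < suc u
    go top  _ = subst (_< suc u) (sym gN) (s≤s c≤u)
    go mate h = ⊥-elim (early c≤u h)
    go (old {x} x<m) h with x <? c
    ... | yes x<c = ⊥-elim (early (≤-trans (<⇒≤ x<c) c≤u) (subst (λ v → n ≤ v + suc u) (skip-< x<c) h))
    ... | no  x≮c = subst (_< suc u) (sym (ge x<m)) (≤-<-trans (skip≤ c (f x)) (s≤s (st x<m
            (≤-pred (≤-pred (subst (n ≤_) (+-suc (suc x) u) (subst (λ v → n ≤ v + suc u) (skip-≥ (≮⇒≥ x≮c)) h)))))))

-- Counting involutions

-- The default 0 past the end lies below every entry, which spares `take-≥nth` a hypothesis on the
-- length.
nth : ℕ → List ℕ → ℕ
nth i       []       = 0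
nth zero    (x ∷ xs) = x
nth (suc i) (x ∷ xs) = nth i xs

Descending : List ℕ → Set
Descending = AllPairs (λ x y → y < x)

nth-∈ : ∀ {i xs} → i < length xs → nth i xs ∈ xs
nth-∈ {zero}  {x ∷ xs} _         = here refl
nth-∈ {suc i} {x ∷ xs} (s≤s i<l) = there (nth-∈ i<l)

∈-nth : ∀ {x xs} → x ∈ xs → ∃[ i ] (i < length xs × nth i xs ≡ x)
∈-nth (here refl) = 0 , s≤s z≤n , refl
∈-nth (there x∈xs) with i , i<l , eq ← ∈-nth x∈xs = suc i , s≤s i<l , eq

∈-take⁻ : ∀ k {x} (xs : List ℕ) → x ∈ take k xs → x ∈ xs
∈-take⁻ (suc k) (y ∷ ys) (here eq) = here eq
∈-take⁻ (suc k) (y ∷ ys) (there h) = there (∈-take⁻ k ys h)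

take-≥nth : ∀ i {x xs} → Descending xs → x ∈ take (suc i) xs → nth i xs ≤ x
take-≥nth zero    {xs = y ∷ ys} _       (here refl) = ≤-refl
take-≥nth (suc i) {xs = y ∷ []} _       _ = z≤n
take-≥nth (suc i) {xs = y ∷ z ∷ ys} (py ∷ d) (here refl) with i <? length (z ∷ ys)
... | yes i<l = <⇒≤ (All.lookup py (nth-∈ i<l))
... | no i≮l  = ≤-trans (≤-reflexive (past i (z ∷ ys) i≮l)) z≤n
  where
  past : ∀ i xs → ¬ i < length xs → nth i xs ≡ 0
  past i       []       _ = refl
  past zero    (x ∷ xs) h = ⊥-elim (h (s≤s z≤n))
  past (suc i) (x ∷ xs) h = past i xs (h ∘ s≤s)
take-≥nth (suc i) {xs = y ∷ z ∷ ys} (_ ∷ d) (there h) = take-≥nth i d h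

∈-take⁺ : ∀ i {x xs} → Descending xs → x ∈ xs → nth i xs ≤ x → x ∈ take (suc i) xs
∈-take⁺ i       _        (here eq)  _ = here eq
∈-take⁺ zero    (py ∷ _) (there h)  y≤x = ⊥-elim (<⇒≱ (All.lookup py h) y≤x)
∈-take⁺ (suc i) (_ ∷ d)  (there h)  le = there (∈-take⁺ i d h le)

nth-injective : ∀ {i k xs} → Descending xs → i < length xs → k < length xs → nth i xs ≡ nth k xs → i ≡ k
nth-injective {zero}  {zero}  _ _ _ _ = refl
nth-injective {zero}  {suc k} (py ∷ _) _ (s≤s k<l) eq = ⊥-elim (<⇒≢ (All.lookup py (nth-∈ k<l)) (sym eq))
nth-injective {suc i} {zero}  (py ∷ _) (s≤s i<l) _ eq = ⊥-elim (<⇒≢ (All.lookup py (nth-∈ i<l)) eq)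
nth-injective {suc i} {suc k} (_ ∷ d) (s≤s i<l) (s≤s k<l) eq = cong suc (nth-injective d i<l k<l eq)

-- The sites after an insertion, given the segment of surviving old sites.
child : List ℕ → List ℕ
child seg = map suc seg ++ [ 0 ]

child-descending : ∀ {seg} → Descending seg → Descending (child seg)
child-descending d = AllPairs.++⁺ (AllPairs.map⁺ (AllPairs.map s≤s d)) ([] ∷ [])
  (All.map⁺ (All.universal (λ _ → s≤s z≤n ∷ []) _))

child-length : ∀ seg → length (child seg) ≡ suc (length seg)
child-length seg = trans (length-++ (map suc seg)) (trans (+-comm _ 1) (cong suc (length-map suc seg)))

0∈child : ∀ seg → 0 ∈ child seg
0∈child seg = ∈-++⁺ʳ (map suc seg) (here refl)

suc∈child : ∀ {u seg} → u ∈ seg → suc u ∈ child seg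
suc∈child h = ∈-++⁺ˡ (∈-map⁺ suc h)

child⁻ : ∀ {t} seg → t ∈ child seg → t ≡ 0 ⊎ ∃[ u ] (t ≡ suc u × u ∈ seg)
child⁻ seg h with ∈-++⁻ (map suc seg) h
... | inj₂ (here eq) = inj₁ eq
... | inj₁ h′ with u , u∈ , eq ← ∈-map⁻ suc h′ = inj₂ (u , eq , u∈)

Site-0 : ∀ {n} f → Site n f 0
Site-0 {n} f {x} x<n n≤x = ⊥-elim (<⇒≱ x<n (subst (n ≤_) (+-identityʳ x) n≤x))

abstract
  extend : ℕ → (ℕ → ℕ) → ℕ → ℕ
  extend n f y with y ≟ n
  ... | yes _ = n
  ... | no  _ = f y

  extend-n : ∀ {n f} → extend n f n ≡ n
  extend-n {n} with n ≟ n
  ... | yes _ = refl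
  ... | no ≢n = ⊥-elim (≢n refl)

  extend-< : ∀ {n f x} → x < n → extend n f x ≡ f x
  extend-< {n} {f} {x} x<n with x ≟ n
  ... | yes eq = ⊥-elim (<⇒≢ x<n eq)
  ... | no  _  = refl

extend-strong : ∀ {n f} → Strong n f f → Strong (suc n) (extend n f) (extend n f)
extend-strong {n} {f} s = involution-strong
  (record { π< = below ; π⁻¹< = below ; invˡ = invol ; invʳ = invol }) avoid
  where
  open Strong s
  split : ∀ {y} → y < suc n → y < n ⊎ y ≡ n
  split y<n = m≤n⇒m<n∨m≡n (≤-pred y<n)
  below : ∀ {y} → y < suc n → extend n f y < suc n
  below y<n with split y<n
  ... | inj₁ lt   = subst (_< suc n) (sym (extend-< lt)) (m<n⇒m<1+n (π< perm lt))
  ... | inj₂ refl = subst (_< suc n) (sym extend-n) (n<1+n n)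
  invol : ∀ {y} → y < suc n → extend n f (extend n f y) ≡ y
  invol y<n with split y<n
  ... | inj₁ lt   = trans (cong (extend n f) (extend-< lt)) (trans (extend-< (π< perm lt)) (invˡ perm lt))
  ... | inj₂ refl = trans (cong (extend n f) extend-n) extend-n
  avoid : Avoids (suc n) (extend n f)
  avoid {j = j} i<j j<k k<n p q with split k<n
  ... | inj₂ refl = <⇒≱ (subst (_< extend n f j) extend-n q) (≤-pred (below (<-trans j<k k<n)))
  ... | inj₁ lt = av i<j j<k lt
    (subst₂ _<_ (extend-< (<-trans i<j (<-trans j<k lt))) (extend-< lt) p)
    (subst₂ _<_ (extend-< lt) (extend-< (<-trans j<k lt)) q)

-- Construction histories of 132-avoiding involutions: `ins i x` inserts a new
-- maximum and its partner at the i-th largest site of x.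
data Code : Set where
  empty : Code
  fix   : Code → Code
  ins   : ℕ → Code → Code

-- `label x` is one less than the number of sites of a valid x (`Good.len`). Validity is thus a
-- condition on numbers alone, and codes can be counted without looking at their permutations.
size label : Code → ℕ
size empty     = 0
size (fix x)   = suc (size x)
size (ins i x) = 2 + size x
label empty     = 0
label (fix x)   = 0
label (ins i x) = suc i

sitesOf : Code → List ℕ
sitesOf empty     = [ 0 ]
sitesOf (fix x)   = [ 0 ]
sitesOf (ins i x) = child (take (suc i) (sitesOf x))

fun : Code → ℕ → ℕ
fun empty     = λ y → y
fun (fix x)   = extend (size x) (fun x)
fun (ins i x) = insertTwoCycle (suc (size x)) (nth i (sitesOf x)) (fun x)

data Valid : Code → Set where
  empty : Valid empty
  fix   : ∀ {x} → Valid x → Valid (fix x)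
  ins   : ∀ {i x} → i ≤ label x → Valid x → Valid (ins i x)

record Good (x : Code) : Set where
  field
    strong : Strong (size x) (fun x) (fun x)
    desc   : Descending (sitesOf x)
    len    : length (sitesOf x) ≡ suc (label x)
    sound  : ∀ {t} → t ∈ sitesOf x → t + t ≤ size x × Site (size x) (fun x) t

  i<len : ∀ {i} → i ≤ label x → i < length (sitesOf x)
  i<len {i} i≤l = subst (i <_) (sym len) (s≤s i≤l)

  nth-site : ∀ {i} → i ≤ label x → nth i (sitesOf x) ∈ sitesOf x
  nth-site i≤l = nth-∈ (i<len i≤l)

  nth≤ : ∀ {i} → i ≤ label x → nth i (sitesOf x) ≤ size x
  nth≤ i≤l = ≤-trans (m≤m+n _ _) (proj₁ (sound (nth-site i≤l)))

good : ∀ {x} → Valid x → Good x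
good empty = record
  { strong = involution-strong (record { π< = λ () ; π⁻¹< = λ () ; invˡ = λ () ; invʳ = λ () }) (λ _ _ ())
  ; desc = [] ∷ [] ; len = refl ; sound = λ { (here refl) → z≤n , (λ ()) } }
good (fix {x} v) = record
  { strong = extend-strong (Good.strong (good v))
  ; desc = [] ∷ [] ; len = refl ; sound = λ { (here refl) → z≤n , Site-0 (fun (fix x)) } }
good (ins {i} {x} i≤l v) = record
  { strong = inserted
  ; desc   = child-descending (AllPairs.take⁺ (suc i) desc)
  ; len    = trans (child-length (take (suc i) (sitesOf x))) (cong suc
      (trans (length-take (suc i) (sitesOf x)) (m≤n⇒m⊓n≡m (i<len i≤l))))
  ; sound  = λ {t} t∈ → snd (child⁻ (take (suc i) (sitesOf x)) t∈)
  }
  where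
  open Good (good v)
  open InsertTwoCycle strong (proj₁ (sound (nth-site i≤l))) (proj₂ (sound (nth-site i≤l)))
  snd : ∀ {t} → t ≡ 0 ⊎ ∃[ u ] (t ≡ suc u × u ∈ take (suc i) (sitesOf x)) → t + t ≤ 2 + size x × Site (2 + size x) (fun (ins i x)) t
  snd (inj₁ refl) = z≤n , Site-0 (fun (ins i x))
  snd (inj₂ (u , refl , u∈)) with st ← sound (∈-take⁻ (suc i) (sitesOf x) u∈) =
    s≤s (subst (_≤ suc (size x)) (sym (+-suc u u)) (s≤s (proj₁ st))) ,
    inserted-site (take-≥nth i desc u∈) (proj₁ st) (proj₂ st)

-- `all-sites` is the converse of `Good.sound`: the induction has to find in the list the site at
-- which the removed two-cycle is put back.
record Encoding (n : ℕ) (π : ℕ → ℕ) : Set where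
  field
    code  : Code
    valid : Valid code
    size≡ : size code ≡ n
    fun≈  : fun code ≈[ n ] π
    all-sites : ∀ {t} → t + t ≤ n → Site n π t → t ∈ sitesOf code

encode : ∀ n {π} → Strong n π π → Encoding n π
encode = <-rec _ step
  where
  step : ∀ n → (∀ {m} → m < n → ∀ {π} → Strong m π π → Encoding m π) → ∀ {π} → Strong n π π → Encoding n π
  step zero _ _ = record { code = empty ; valid = empty ; size≡ = refl ; fun≈ = λ ()
    ; all-sites = λ {t} 2t≤0 _ → here (n≤0⇒n≡0 (≤-trans (m≤m+n t t) 2t≤0)) }
  step (suc N) ih {π} s with m≤n⇒m<n∨m≡n (≤-pred (π< (Strong.perm s) (n<1+n N)))
  ... | inj₂ πN = record { code = fix code ; valid = fix valid ; size≡ = cong suc size≡ ; fun≈ = same ; all-sites = only-0 }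
    where
    open Encoding (ih (n<1+n N) (restrict-fixed s πN))
    same : fun (fix code) ≈[ suc N ] π
    same {x} x<n with m≤n⇒m<n∨m≡n (≤-pred x<n)
    ... | inj₁ x<N  = trans (extend-< (subst (x <_) (sym size≡) x<N)) (fun≈ x<N)
    ... | inj₂ refl = subst (λ v → extend v (fun code) N ≡ π N) (sym size≡) (trans extend-n (sym πN))
    only-0 : ∀ {t} → t + t ≤ suc N → Site (suc N) π t → t ∈ [ 0 ]
    only-0 {zero}  _    _  = here refl
    only-0 {suc u} 2t≤n st = ⊥-elim (<⇒≱ (subst (_< suc u) πN (st (n<1+n N)
      (subst (suc N ≤_) (sym (+-suc N u)) (s≤s (m≤m+n N u))))) (≤-pred (≤-trans (s≤s (m≤n+m (suc u) u)) 2t≤n)))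
  step (suc (suc m)) ih {π} s | inj₁ c<N = finish (∈-nth (all-sites 2c≤m site-c))
    where
    open RemoveTwoCycle s c<N using (N; c; 2c≤m; site-c; restriction; rest; sites)
    open Encoding (ih (<-trans (n<1+n m) (n<1+n (suc m))) rest)
    G = good valid
    finish : ∃[ i ] (i < length (sitesOf code) × nth i (sitesOf code) ≡ c) → Encoding (2 + m) π
    finish (i , i<l , eq) = record
      { code = ins i code
      ; valid = ins (≤-pred (subst (i <_) (Good.len G) i<l)) valid
      ; size≡ = cong (2 +_) size≡
      ; fun≈ = λ x<n → trans (cong₂ (λ v w → insertTwoCycle (suc v) w (fun code) _) size≡ eq)
          (trans (insert-≈ (≤-pred c<N) fun≈ x<n) (insert-restriction s c<N x<n))
      ; all-sites = λ 2t≤n st → keep (sites 2t≤n st)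
      }
      where
      keep : ∀ {t} → t ≡ 0 ⊎ ∃[ u ] (t ≡ suc u × c ≤ u × u + u ≤ m × Site m restriction u) → t ∈ sitesOf (ins i code)
      keep (inj₁ refl) = 0∈child (take (suc i) (sitesOf code))
      keep (inj₂ (u , refl , c≤u , 2u≤m , st)) = suc∈child (∈-take⁺ i (Good.desc G) (all-sites 2u≤m st) (subst (_≤ u) (sym eq) c≤u))

-- The value at the last position reveals the last step: the position itself for `fix`, and
-- otherwise the chosen site, whose index is unique because the list of sites descends.
fun-injective : ∀ {x y} → Valid x → Valid y → size x ≡ size y → fun x ≈[ size x ] fun y → x ≡ y
fun-injective empty empty _ _ = refl
fun-injective {fix x} {fix y} (fix v) (fix w) sz eq = cong fix (fun-injective v w sz′ λ {z} z<n →
    trans (sym (extend-< z<n)) (trans (eq (m<n⇒m<1+n z<n)) (extend-< (subst (z <_) sz′ z<n))))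
  where sz′ = suc-injective sz
fun-injective {fix x} {ins i y} (fix v) (ins i≤l w) sz eq = ⊥-elim (<⇒≱ (s≤s (Good.nth≤ (good w) i≤l))
    (≤-reflexive (trans (sym szN) (trans (sym extend-n) (trans (eq (n<1+n (size x)))
      (subst (λ v → insertTwoCycle (suc (size y)) _ (fun y) v ≡ _) (sym szN) insert-N))))))
  where szN = suc-injective sz
fun-injective {ins i x} {fix y} (ins i≤l v) (fix w) sz eq =
  sym (fun-injective (fix w) (ins i≤l v) (sym sz) λ {z} z<n → sym (eq (subst (z <_) (sym sz) z<n)))
fun-injective {ins i x} {ins k y} (ins i≤l v) (ins k≤l w) sz eq = same (fun-injective v w sz′ λ {z} z<m → old z<m)
  where
  sz′ : size x ≡ size y
  sz′ = suc-injective (suc-injective sz)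
  m = size x
  c = nth i (sitesOf x)
  c≡ : c ≡ nth k (sitesOf y)
  c≡ = trans (sym insert-N) (trans (eq (n<1+n (suc m)))
    (subst (λ u → insertTwoCycle (suc (size y)) (nth k (sitesOf y)) (fun y) (suc u) ≡ nth k (sitesOf y)) (sym sz′) insert-N))
  old : ∀ {z} → z < m → fun x z ≡ fun y z
  old {z} z<m = trans (sym unskip-skip) (trans (cong (unskip c)
      (trans (sym (insert-skip z<m)) (trans (eq (≤-<-trans (skip≤ c z) (s≤s (m<n⇒m<1+n z<m))))
        (trans (cong (λ d → insertTwoCycle (suc (size y)) d (fun y) (skip c z)) (sym c≡))
          (insert-skip (subst (z <_) sz′ z<m)))))) unskip-skip)
  same : x ≡ y → ins i x ≡ ins k y
  same refl = cong (λ i → ins i x) (nth-injective (Good.desc (good v)) (Good.i<len (good v) i≤l) (Good.i<len (good v) k≤l) c≡)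

label-size : ∀ {x} → Valid x → label x + label x ≤ size x
label-size empty = z≤n
label-size (fix v) = z≤n
label-size (ins {i} {x} i≤l v) = s≤s (subst (_≤ suc (size x)) (sym (+-suc i i)) (s≤s (≤-trans (+-mono-≤ i≤l i≤l) (label-size v))))

-- The codes of size a + j and label at least j: either the label exceeds j,
-- or the last step is determined by j.  This is Pascal's recurrence, folded at j = 0.
codes : ℕ → ℕ → List Code
codes zero    zero    = [ empty ]
codes zero    (suc j) = []
codes (suc a) zero    = codes a 1 ++ map fix (codes a 0)
codes (suc a) (suc j) = codes a (2 + j) ++ map (ins j) (codes a j)

-- For j ≤ a this is the binomial coefficient `a C k` with k = ⌊(a - j) / 2⌋; see `walks≡C`.
walks : ℕ → ℕ → ℕ
walks zero    zero    = 1
walks zero    (suc j) = 0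
walks (suc a) zero    = walks a 1 + walks a 0
walks (suc a) (suc j) = walks a (2 + j) + walks a j

length-codes : ∀ a j → length (codes a j) ≡ walks a j
length-codes zero    zero    = refl
length-codes zero    (suc j) = refl
length-codes (suc a) zero    = trans (length-++ (codes a 1)) (cong₂ _+_ (length-codes a 1)
  (trans (length-map fix (codes a 0)) (length-codes a 0)))
length-codes (suc a) (suc j) = trans (length-++ (codes a (2 + j))) (cong₂ _+_ (length-codes a (2 + j))
  (trans (length-map (ins j) (codes a j)) (length-codes a j)))

codes-sound : ∀ a j {x} → x ∈ codes a j → Valid x × size x ≡ a + j × j ≤ label x
codes-sound zero zero (here refl) = empty , refl , z≤n
codes-sound (suc a) zero h with ∈-++⁻ (codes a 1) h
... | inj₁ h′ with v , sz , l ← codes-sound a 1 h′ = v , trans sz (+-suc a 0) , z≤n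
... | inj₂ h′ with y , y∈ , refl ← ∈-map⁻ fix h′ with v , sz , l ← codes-sound a 0 y∈ = fix v , cong suc sz , z≤n
codes-sound (suc a) (suc j) h with ∈-++⁻ (codes a (2 + j)) h
... | inj₁ h′ with v , sz , l ← codes-sound a (2 + j) h′ = v , trans sz (+-suc a (suc j)) , <⇒≤ l
... | inj₂ h′ with y , y∈ , refl ← ∈-map⁻ (ins j) h′ with v , sz , l ← codes-sound a j y∈ =
  ins l v , cong suc (trans (cong suc sz) (sym (+-suc a j))) , ≤-refl

codes-complete : ∀ a j {x} → Valid x → size x ≡ a + j → j ≤ label x → x ∈ codes a j
codes-complete zero zero empty refl _ = here refl
codes-complete zero zero {fix _} v () _
codes-complete zero zero {ins _ _} v () _
codes-complete zero (suc j) {x} v sz l = ⊥-elim (<⇒≱ (+-mono-<-≤ (s≤s z≤n) l) (≤-trans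
  (≤-trans (+-monoˡ-≤ (label x) l) (label-size v)) (≤-reflexive sz)))
codes-complete (suc a) zero {x} v sz _ with 1 ≤? label x
... | yes 1≤l = ∈-++⁺ˡ (codes-complete a 1 v (trans sz (sym (+-suc a 0))) 1≤l)
codes-complete (suc a) zero {empty} v () _ | no _
codes-complete (suc a) zero {ins _ _} v sz _ | no 1≰l = ⊥-elim (1≰l (s≤s z≤n))
codes-complete (suc a) zero {fix x} (fix v) sz _ | no _ =
  ∈-++⁺ʳ (codes a 1) (∈-map⁺ fix (codes-complete a 0 v (suc-injective sz) z≤n))
codes-complete (suc a) (suc j) {x} v sz l with m≤n⇒m<n∨m≡n l
... | inj₁ lt = ∈-++⁺ˡ (codes-complete a (2 + j) v (trans sz (sym (+-suc a (suc j)))) lt)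
codes-complete (suc a) (suc j) {ins i x} (ins i≤l v) sz _ | inj₂ refl =
  ∈-++⁺ʳ (codes a (2 + j)) (∈-map⁺ (ins j) (codes-complete a j v (suc-injective (suc-injective (trans sz (cong suc (+-suc a j))))) i≤l))

codes-unique : ∀ a j → Unique (codes a j)
codes-unique zero zero = [] ∷ []
codes-unique zero (suc j) = []
codes-unique (suc a) zero = Unique.++⁺ (codes-unique a 1) (Unique.map⁺ (λ { refl → refl }) (codes-unique a 0)) disjoint
  where
  disjoint : ∀ {x} → x ∈ codes a 1 × x ∈ map fix (codes a 0) → ⊥
  disjoint (h , h′) with y , _ , refl ← ∈-map⁻ fix h′ = <⇒≱ (proj₂ (proj₂ (codes-sound a 1 h))) z≤n
codes-unique (suc a) (suc j) = Unique.++⁺ (codes-unique a (2 + j)) (Unique.map⁺ (λ { refl → refl }) (codes-unique a j)) disjoint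
  where
  disjoint : ∀ {x} → x ∈ codes a (2 + j) × x ∈ map (ins j) (codes a j) → ⊥
  disjoint (h , h′) with y , _ , refl ← ∈-map⁻ (ins j) h′ = <⇒≱ (proj₂ (proj₂ (codes-sound a (2 + j) h))) ≤-refl

-- Covers

abstract
  insertThreeCycle : ℕ → ℕ → ℕ → (ℕ → ℕ) → ℕ → ℕ
  insertThreeCycle N c p f y with y ≟ N | y ≟ c | y ≟ p
  ... | yes _ | _     | _     = c
  ... | no _  | yes _ | _     = p
  ... | no _  | no _  | yes _ = N
  ... | no _  | no _  | no _  = skip p (skip c (f (unskip c (unskip p y))))

  insertThreeCycle-unique : ∀ {N c p f} (π : ℕ → ℕ) {y} → π N ≡ c → π c ≡ p → π p ≡ N →
    (y ≢ N → y ≢ c → y ≢ p → skip p (skip c (f (unskip c (unskip p y)))) ≡ π y) →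
    insertThreeCycle N c p f y ≡ π y
  insertThreeCycle-unique {N} {c} {p} {f} π {y} πN πc πp other with y ≟ N | y ≟ c | y ≟ p
  ... | yes refl | _     | _     = sym πN
  ... | no _  | yes refl | _     = sym πc
  ... | no _  | no _  | yes refl = sym πp
  ... | no y≢N | no y≢c | no y≢p = other y≢N y≢c y≢p

-- The generating tree of three-cycles

Node : Set
Node = (ℕ → ℕ) × List ℕ

-- q counts the positions strictly between p and the last one, so `2 + m ∸ suc q` is p.
grow : ℕ → ℕ → ℕ → List ℕ → (ℕ → ℕ) → Node
grow m q c seg f = insertThreeCycle (2 + m) c (2 + m ∸ suc q) f , child seg

-- The two families of children: p directly after the old maximum, or c = 0.
prefixChild suffixChild : ℕ → Node → ℕ → Node
prefixChild m (f , Σ) i = grow m (nth 0 Σ) (nth i Σ) (take (suc i) Σ) f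
suffixChild m (f , Σ) k = grow m (nth (length Σ ∸ suc k) Σ) 0 (drop (length Σ ∸ suc k) Σ) f

listTo : ∀ {A : Set} → ℕ → (ℕ → A) → List A
listTo zero    a = []
listTo (suc l) a = a l ∷ listTo l a

sumTo : ℕ → (ℕ → ℕ) → ℕ
sumTo zero    h = 0
sumTo (suc l) h = h l + sumTo l h

∈-listTo : ∀ {A : Set} {l i} {a : ℕ → A} → i < l → a i ∈ listTo l a
∈-listTo {l = suc l} {i} i<l with m≤n⇒m<n∨m≡n (≤-pred i<l)
... | inj₁ lt   = there (∈-listTo lt)
... | inj₂ refl = here refl

-- The suffix family omits the largest site as q, because with c = 0 that child already is a prefix
-- child.
children : ℕ → Node → List Node
children m ν = listTo (length (proj₂ ν)) (prefixChild m ν) ++ listTo (length (proj₂ ν) ∸ 1) (suffixChild m ν)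

-- j counts generations, and l is the number of sites of the ancestor.
descendants : ℕ → ℕ → ℕ
descendants zero    l = 1
descendants (suc j) l = sumTo l (λ i → descendants j (2 + i)) + sumTo (l ∸ 1) (λ i → descendants j (2 + i))

weight : ℕ → List Node → ℕ
weight j []             = 0
weight j ((f , Σ) ∷ νs) = descendants j (length Σ) + weight j νs

weight-++ : ∀ j νs μs → weight j (νs ++ μs) ≡ weight j νs + weight j μs
weight-++ j []             μs = refl
weight-++ j ((f , Σ) ∷ νs) μs = trans (cong (descendants j (length Σ) +_) (weight-++ j νs μs)) (sym (+-assoc (descendants j (length Σ)) _ _))

weight-listTo : ∀ j {l} {a : ℕ → Node} (h : ℕ → ℕ) → (∀ {i} → i < l → length (proj₂ (a i)) ≡ h i) →
                weight j (listTo l a) ≡ sumTo l (λ i → descendants j (h i))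
weight-listTo j {zero}  h eq = refl
weight-listTo j {suc l} h eq = cong₂ _+_ (cong (descendants j) (eq (n<1+n l))) (weight-listTo j h (λ i<l → eq (m<n⇒m<1+n i<l)))

weight-children : ∀ j m ν → weight j (children m ν) ≡ descendants (suc j) (length (proj₂ ν))
weight-children j m ν@(f , Σ) = trans (weight-++ j (listTo l (prefixChild m ν)) _) (cong₂ _+_
    (weight-listTo j (2 +_) λ {i} i<l → trans (child-length (take (suc i) Σ)) (cong suc
      (trans (length-take (suc i) Σ) (m≤n⇒m⊓n≡m i<l))))
    (weight-listTo j (2 +_) λ {k} k<l → trans (child-length (drop (l ∸ suc k) Σ)) (cong suc
      (trans (length-drop (l ∸ suc k) Σ) (m∸[m∸n]≡n (≤-trans k<l (m∸n≤m l 1)))))))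
  where l = length Σ

weight-concatMap : ∀ j m νs → weight j (concatMap (children m) νs) ≡ weight (suc j) νs
weight-concatMap j m []       = refl
weight-concatMap j m (ν ∷ νs) = trans (weight-++ j (children m ν) (concatMap (children m) νs)) (cong₂ _+_ (weight-children j m ν) (weight-concatMap j m νs))

weight-0 : ∀ νs → weight 0 νs ≡ length νs
weight-0 []       = refl
weight-0 (ν ∷ νs) = cong suc (weight-0 νs)

-- Only an upper bound is wanted, so members may repeat and need not satisfy P.
record Cover (n : ℕ) (P : (ℕ → ℕ) → (ℕ → ℕ) → Set) (bound : ℕ) : Set where
  field
    members : List (ℕ → ℕ)
    count≤  : length members ≤ bound
    covers  : ∀ {π π⁻¹} → P π π⁻¹ → ∃[ f ] (f ∈ members × f ≈[ n ] π)

Primitive : ℕ → (ℕ → ℕ) → (ℕ → ℕ) → Set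
Primitive n π π⁻¹ = Strong n π π⁻¹ × ¬ ThreeCycle n π

-- The list may be larger than the set of sites, which only adds candidates. Its first entry is
-- pinned down by `head`, since the choice between the two families of children depends on it.
record Describes (n : ℕ) (π π⁻¹ : ℕ → ℕ) (ν : Node) : Set where
  field
    same    : proj₁ ν ≈[ n ] π
    desc    : Descending (proj₂ ν)
    zero∈   : 0 ∈ proj₂ ν
    site∈   : ∀ {t} → t < n → Site n π t → t ∈ proj₂ ν
    head    : ∀ {N} → n ≡ suc N → π⁻¹ N + nth 0 (proj₂ ν) ≡ N

-- The bound is a function of the generation because one removal step trades generation j of the
-- children for generation j + 1 of their parents.
record CycleCover (n : ℕ) (bound : ℕ → ℕ) : Set where
  field
    nodes   : List Node
    weight≤ : ∀ j → weight j nodes ≤ bound j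
    covers  : ∀ {π π⁻¹} → Strong n π π⁻¹ → ThreeCycle n π → ∃[ ν ] (ν ∈ nodes × Describes n π π⁻¹ ν)

∈-concatMap : ∀ {m ν μ νs} → ν ∈ νs → μ ∈ children m ν → μ ∈ concatMap (children m) νs
∈-concatMap (here refl) μ∈ = ∈-++⁺ˡ μ∈
∈-concatMap {m} {νs = ν ∷ _} (there ν∈) μ∈ = ∈-++⁺ʳ (children m ν) (∈-concatMap ν∈ μ∈)

nth-drop : ∀ i xs → nth 0 (drop i xs) ≡ nth i xs
nth-drop zero    xs       = refl
nth-drop (suc i) []       = refl
nth-drop (suc i) (x ∷ xs) = nth-drop i xs

∈-drop⁺ : ∀ i {x xs} → Descending xs → i < length xs → x ∈ xs → x ≤ nth i xs → x ∈ drop i xs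
∈-drop⁺ zero    _ _ x∈ _ = x∈
∈-drop⁺ (suc i) (py ∷ _) (s≤s i<l) (here refl) x≤ = ⊥-elim (<⇒≱ (All.lookup py (nth-∈ i<l)) x≤)
∈-drop⁺ (suc i) (_ ∷ d)  (s≤s i<l) (there x∈)  x≤ = ∈-drop⁺ i d i<l x∈ x≤

nonempty-child : ∀ {x} seg → x ∈ seg → nth 0 (child seg) ≡ suc (nth 0 seg)
nonempty-child (x ∷ seg) _ = refl

no-small-threeCycle : ∀ {n π π⁻¹} → n < 3 → Strong n π π⁻¹ → ¬ ThreeCycle n π
no-small-threeCycle {suc zero} _ s (c<p , _) = <⇒≱ (≤-<-trans z≤n c<p) (≤-pred (π< (Strong.perm s) (π< (Strong.perm s) (s≤s z≤n))))
no-small-threeCycle {suc (suc zero)} {π} _ s (c<p , πp) = <⇒≢ c<p (trans c≡0 (sym p≡0))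
  where
  open Strong s
  p<2 = π< perm (π< perm (n<1+n 1))
  p≡1⊎ : π (π 1) ≡ 1
  p≡1⊎ = ≤-antisym (≤-pred p<2) (≤-<-trans z≤n c<p)
  c≡0 : π 1 ≡ 0
  c≡0 = n≤0⇒n≡0 (≤-pred (<-≤-trans c<p (≤-pred p<2)))
  p≡0 : π (π 1) ≡ 0
  p≡0 = ⊥-elim (<⇒≢ (s≤s z≤n) (trans (trans (sym c≡0) (cong π (sym p≡1⊎))) πp))
no-small-threeCycle {suc (suc (suc n))} (s≤s (s≤s (s≤s ()))) _ _

smallCycleCover : ∀ {n} → n < 3 → CycleCover n (λ _ → 0)
smallCycleCover n<3 = record { nodes = [] ; weight≤ = λ _ → z≤n ; covers = λ s t → ⊥-elim (no-small-threeCycle n<3 s t) }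

module _ {m π π⁻¹} (s : Strong (3 + m) π π⁻¹) (three : ThreeCycle (3 + m) π) where
  open RemoveThreeCycle s three using (N; c; p; q′; πp≡N; p<N; p<n; c≤q′; p+q≡N; rest; restriction; restriction⁻¹; reinsert; site-q′; site-c; sites; q′≡0⊎<m; restriction-threeCycle; head-site)
  open Strong s

  insertThreeCycle-≈ : ∀ {f} → f ≈[ m ] restriction → insertThreeCycle N c (N ∸ suc q′) f ≈[ 3 + m ] π
  insertThreeCycle-≈ {f} f≈ {y} y<n = trans (cong (λ v → insertThreeCycle N c v f y) p≡)
    (insertThreeCycle-unique π refl refl πp≡N λ y≢N y≢c y≢p →
      trans (cong (λ v → skip p (skip c v)) (f≈ (RemoveThreeCycle.d<m s three (≤∧≢⇒< (≤-pred y<n) y≢N) y≢c y≢p)))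
        (sym (reinsert (≤∧≢⇒< (≤-pred y<n) y≢N) y≢c y≢p)))
    where
    p≡ : N ∸ suc q′ ≡ p
    p≡ = trans (cong (_∸ suc q′) (sym p+q≡N)) (m+n∸n≡m p (suc q′))

  grow-describes : ∀ {f seg} → f ≈[ m ] restriction → Descending seg → nth 0 seg ≡ q′ →
    (∀ {u} → c ≤ u → u ≤ q′ → Site m restriction u → u ∈ seg) → Describes (3 + m) π π⁻¹ (grow m q′ c seg f)
  grow-describes {seg = seg} f≈ d hd keep = record
    { same  = insertThreeCycle-≈ f≈
    ; desc  = child-descending d
    ; zero∈ = 0∈child seg
    ; site∈ = λ t<n st → include (sites t<n st)
    ; head  = λ { refl → trans (cong₂ _+_ (trans (cong π⁻¹ (sym πp≡N)) (invˡ perm p<n))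
        (trans (nonempty-child seg (keep c≤q′ ≤-refl site-q′)) (cong suc hd))) p+q≡N }
    }
    where
    include : ∀ {t} → t ≡ 0 ⊎ ∃[ u ] (t ≡ suc u × c ≤ u × u ≤ q′ × Site m restriction u) → t ∈ child seg
    include (inj₁ refl) = 0∈child seg
    include (inj₂ (u , refl , c≤u , u≤q′ , st)) = suc∈child (keep c≤u u≤q′ st)

  -- By `restriction-threeCycle`, q′ > 0 would leave a removable three-cycle behind. So q′ = c = 0,
  -- and the new node lists just the two sites 1 and 0.
  root-describes : ∀ {f} → f ≈[ m ] restriction → ¬ ThreeCycle m restriction → Describes (3 + m) π π⁻¹ (prefixChild m (f , [ 0 ]) 0)
  root-describes {f} f≈ ¬three = subst₂ (λ q c → Describes (3 + m) π π⁻¹ (grow m q c [ 0 ] f)) q≡0 c≡0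
      (grow-describes f≈ ([] ∷ []) (sym q≡0) λ {u} _ u≤q′ _ → here (n≤0⇒n≡0 (subst (u ≤_) q≡0 u≤q′)))
    where
    positive : ∀ {k} → m ≡ k → 0 < q′ → q′ < k → ⊥
    positive {suc M} eq 0<q′ _ = ¬three (subst (λ v → ThreeCycle v restriction) (sym eq) (restriction-threeCycle 0<q′ eq))
    q≡0 : q′ ≡ 0
    q≡0 with q′≡0⊎<m
    ... | inj₁ eq = eq
    ... | inj₂ q′<m = n≤0⇒n≡0 (≮⇒≥ λ 0<q′ → positive refl 0<q′ q′<m)
    c≡0 : c ≡ 0
    c≡0 = n≤0⇒n≡0 (subst (c ≤_) q≡0 c≤q′)

  -- If q′ is the first listed site, c may be any site; otherwise `head-site` rules out c ≠ 0. These
  -- are the two families of children.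
  child-describes : ∀ {ν} → ThreeCycle m restriction → Describes m restriction restriction⁻¹ ν →
                    ∃[ μ ] (μ ∈ children m ν × Describes (3 + m) π π⁻¹ μ)
  child-describes {f , Σ} three′ D = go (q′ ≟ nth 0 Σ)
    where
    open Describes D
    l = length Σ
    small∈ : ∀ {u} → u ≤ q′ → Site m restriction u → u ∈ Σ
    small∈ {zero}  _   _  = zero∈
    small∈ {suc u} u≤q′ st with q′≡0⊎<m
    ... | inj₁ eq = ⊥-elim (<⇒≱ (≤-trans (s≤s z≤n) u≤q′) (≤-reflexive eq))
    ... | inj₂ q′<m = site∈ (≤-<-trans u≤q′ q′<m) st
    go : Dec (q′ ≡ nth 0 Σ) → ∃[ μ ] (μ ∈ children m (f , Σ) × Describes (3 + m) π π⁻¹ μ)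
    go (yes q≡) with i , i<l , c≡ ← ∈-nth (small∈ c≤q′ site-c) =
      prefixChild m (f , Σ) i , ∈-++⁺ˡ (∈-listTo i<l) ,
      subst₂ (λ q c → Describes (3 + m) π π⁻¹ (grow m q c (take (suc i) Σ) f)) q≡ (sym c≡)
        (grow-describes same (AllPairs.take⁺ (suc i) desc) (trans (nth-take Σ) (sym q≡))
          (λ c≤u u≤q′ st → ∈-take⁺ i desc (small∈ u≤q′ st) (subst (_≤ _) (sym c≡) c≤u)))
      where
      nth-take : ∀ xs → nth 0 (take (suc i) xs) ≡ nth 0 xs
      nth-take []       = refl
      nth-take (x ∷ xs) = refl
    go (no q≢) with i , i<l , q≡ ← ∈-nth (small∈ ≤-refl site-q′) =
      suffixChild m (f , Σ) k , ∈-++⁺ʳ (listTo l (prefixChild m (f , Σ))) (∈-listTo k<l) ,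
      subst₂ (λ a b → Describes (3 + m) π π⁻¹ (grow m a b (drop (l ∸ suc k) Σ) f)) (trans (sym q≡) (cong (λ v → nth v Σ) (sym i≡))) c≡0
        (subst (λ v → Describes (3 + m) π π⁻¹ (grow m q′ c (drop v Σ) f)) (sym i≡)
          (grow-describes same (AllPairs.drop⁺ i desc) (trans (nth-drop i Σ) q≡)
            (λ _ u≤q′ st → ∈-drop⁺ i desc i<l (small∈ u≤q′ st) (subst (_ ≤_) (sym q≡) u≤q′))))
      where
      k = l ∸ suc i
      0<i : 0 < i
      0<i = n≢0⇒n>0 λ { refl → q≢ (sym q≡) }
      k<l : k < l ∸ 1
      k<l = ∸-monoʳ-< {l} (s≤s 0<i) i<l
      i≡ : l ∸ suc k ≡ i
      i≡ = trans (cong (l ∸_) (sym (+-∸-assoc 1 i<l))) (m∸[m∸n]≡n (<⇒≤ i<l))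
      not-head : ∀ {M} → m ≡ M → ThreeCycle M restriction → c ≡ 0
      not-head {suc M} eq _ with c ≟ 0
      ... | yes c≡0 = c≡0
      ... | no  c≢0 = ⊥-elim (q≢ (+-cancelˡ-≡ (restriction⁻¹ M) q′ (nth 0 Σ)
              (trans (head-site (<-≤-trans (n≢0⇒n>0 c≢0) c≤q′) eq c≢0) (sym (head eq)))))
      c≡0 : c ≡ 0
      c≡0 = not-head refl three′

cycleCover-step : ∀ {m b r} → CycleCover m b → Cover m (Primitive m) r →
                  CycleCover (3 + m) (λ j → b (suc j) + r * descendants j 2)
cycleCover-step {m} {b} {r} C R = record
  { nodes   = concatMap (children m) C.nodes ++ map rootNode R.members
  ; weight≤ = λ j → subst (_≤ b (suc j) + r * descendants j 2)
      (sym (trans (weight-++ j (concatMap (children m) C.nodes) _) (cong₂ _+_ (weight-concatMap j m C.nodes) (weight-roots j R.members))))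
      (+-mono-≤ (C.weight≤ (suc j)) (*-monoˡ-≤ (descendants j 2) R.count≤))
  ; covers  = λ s t → locate s t (threeCycle? m (RemoveThreeCycle.restriction s t))
  }
  where
  module C = CycleCover C
  module R = Cover R
  rootNode : (ℕ → ℕ) → Node
  rootNode f = prefixChild m (f , [ 0 ]) 0
  weight-roots : ∀ j fs → weight j (map rootNode fs) ≡ length fs * descendants j 2
  weight-roots j []       = refl
  weight-roots j (f ∷ fs) = cong (descendants j 2 +_) (weight-roots j fs)
  locate : ∀ {π π⁻¹} (s : Strong (3 + m) π π⁻¹) (t : ThreeCycle (3 + m) π) → Dec (ThreeCycle m (RemoveThreeCycle.restriction s t)) →
           ∃[ ν ] (ν ∈ concatMap (children m) C.nodes ++ map rootNode R.members × Describes (3 + m) π π⁻¹ ν)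
  locate s t (yes t′) with ν , ν∈ , D ← C.covers (RemoveThreeCycle.rest s t) t′
                      with μ , μ∈ , E ← child-describes s t t′ D =
    μ , ∈-++⁺ˡ (∈-concatMap ν∈ μ∈) , E
  locate s t (no ¬t′) with f , f∈ , f≈ ← R.covers (RemoveThreeCycle.rest s t , ¬t′) =
    rootNode f , ∈-++⁺ʳ (concatMap (children m) C.nodes) (∈-map⁺ rootNode f∈) , root-describes s t f≈ ¬t′

-- Recovering inverses and rotations

abstract
  -- The largest x < k with g x ≡ t x, or 0.
  lastAgreement : ℕ → (ℕ → ℕ) → (ℕ → ℕ) → ℕ
  lastAgreement zero    g t = 0
  lastAgreement (suc k) g t with g k ≟ t k
  ... | yes _ = k
  ... | no  _ = lastAgreement k g t

  lastAgreement-≡ : ∀ {g t x} k → x < k → g x ≡ t x → (∀ {y} → x < y → y < k → g y ≢ t y) → lastAgreement k g t ≡ x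
  lastAgreement-≡ {g} {t} (suc k) x<k eq last with g k ≟ t k | m≤n⇒m<n∨m≡n (≤-pred x<k)
  ... | yes _ | inj₂ refl = refl
  ... | yes e | inj₁ lt   = ⊥-elim (last lt (n<1+n k) e)
  ... | no ne | inj₂ refl = ⊥-elim (ne eq)
  ... | no _  | inj₁ lt   = lastAgreement-≡ k lt eq (λ x<y y<k → last x<y (m<n⇒m<1+n y<k))

-- A cover lists functions without their inverses, so an inverse has to be searched for.
invert : ℕ → (ℕ → ℕ) → ℕ → ℕ
invert n g y = lastAgreement n g (λ _ → y)

invert-≈ : ∀ {n π π⁻¹ g} → Perm n π π⁻¹ → g ≈[ n ] π⁻¹ → invert n g ≈[ n ] π
invert-≈ {n} {π} P g≈ {y} y<n = lastAgreement-≡ n (π< P y<n) (trans (g≈ (π< P y<n)) (invˡ P y<n))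
  λ {z} πy<z z<n eq → <⇒≢ πy<z (trans (cong π (sym (trans (sym (g≈ z<n)) eq))) (invʳ P z<n))

strengthen : ∀ {n π π⁻¹} → Strong n π π⁻¹ → Involutive n π → Strong n π π
strengthen s inv = involution-strong (record { π< = π< perm ; π⁻¹< = π< perm ; invˡ = inv ; invʳ = inv }) av
  where open Strong s

extend-≈ : ∀ {N f π} → f ≈[ N ] π → π N ≡ N → extend N f ≈[ suc N ] π
extend-≈ f≈ πN x<n with m≤n⇒m<n∨m≡n (≤-pred x<n)
... | inj₁ x<N  = trans (extend-< x<N) (f≈ x<N)
... | inj₂ refl = trans extend-n (sym πN)

-- A rotation π is determined by q and the involution that agrees with π⁻¹ on
-- [0,q), with π on (p,N], and fixes exactly [q,p].
abstract
  fold : ℕ → ℕ → (ℕ → ℕ) → (ℕ → ℕ) → ℕ → ℕ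
  fold q p π π⁻¹ x with x <? q | x ≤? p
  ... | yes _ | _     = π⁻¹ x
  ... | no _  | yes _ = x
  ... | no _  | no _  = π x

  fold-low : ∀ {q p π π⁻¹ x} → x < q → fold q p π π⁻¹ x ≡ π⁻¹ x
  fold-low {q} {p} {x = x} x<q with x <? q | x ≤? p
  ... | yes _ | _ = refl
  ... | no h  | _ = ⊥-elim (h x<q)

  fold-mid : ∀ {q p π π⁻¹ x} → q ≤ x → x ≤ p → fold q p π π⁻¹ x ≡ x
  fold-mid {q} {p} {x = x} q≤x x≤p with x <? q | x ≤? p
  ... | yes h | _     = ⊥-elim (<⇒≱ h q≤x)
  ... | no _  | yes _ = refl
  ... | no _  | no h  = ⊥-elim (h x≤p)

  fold-high : ∀ {q p π π⁻¹ x} → q ≤ p → p < x → fold q p π π⁻¹ x ≡ π x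
  fold-high {q} {p} {x = x} q≤p p<x with x <? q | x ≤? p
  ... | yes h | _     = ⊥-elim (<⇒≱ h (≤-trans q≤p (<⇒≤ p<x)))
  ... | no _  | yes h = ⊥-elim (<⇒≱ p<x h)
  ... | no _  | no _  = refl

  unfold : ℕ → ℕ → (ℕ → ℕ) → ℕ → ℕ
  unfold q p ι x with x <? q | x ≤? p
  ... | yes _ | _     = ι x ∸ (suc p ∸ q)
  ... | no _  | yes _ = x + q
  ... | no _  | no _  = ι x

  unfold-unique : ∀ {q p ι} (π : ℕ → ℕ) {x} → (x < q → ι x ∸ (suc p ∸ q) ≡ π x) → (q ≤ x → x ≤ p → x + q ≡ π x) →
                  (p < x → ι x ≡ π x) → unfold q p ι x ≡ π x
  unfold-unique {q} {p} π {x} low mid high with x <? q | x ≤? p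
  ... | yes h | _     = low h
  ... | no h  | yes k = mid (≮⇒≥ h) k
  ... | no _  | no k  = high (≰⇒> k)

-- Beyond p the entries of the folded involution drop below q ≤ p, so p is its last fixed point;
-- then q = N - p.
decodeRotation : ℕ → (ℕ → ℕ) → ℕ → ℕ
decodeRotation N ι = unfold (N ∸ p) p ι
  where p = lastAgreement (suc N) ι (λ x → x)

module _ {N π π⁻¹ q} (s : Strong (suc N) π π⁻¹) (rot : Rotation N π q) where

  open Strong s

  private
    n = suc N
    p = N ∸ q
    0<q = proj₁ rot
    q≤N : q ≤ N
    q≤N = ≤-trans (m≤m+n q q) (proj₁ (proj₂ rot))
    p+q≡N : p + q ≡ N
    p+q≡N = m∸n+n≡m q≤N
    q≤p : q ≤ p
    q≤p = +-cancelʳ-≤ q q p (subst (q + q ≤_) (sym p+q≡N) (proj₁ (proj₂ rot)))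
    shift : ∀ {x} → q ≤ x → x ≤ p → π x ≡ x + q
    shift {x} q≤x x≤p = proj₂ (proj₂ rot) q≤x (subst (x + q ≤_) p+q≡N (+-monoˡ-≤ q x≤p))
    πp : π p ≡ N
    πp = trans (shift q≤p ≤-refl) p+q≡N
    open Maximum perm av p+q≡N πp
    p<N : p < N
    p<N = subst (p <_) p+q≡N (m<m+n p 0<q)
    σ = π ∘ π
    PP = perm-∘ perm perm
    ι = fold q p π π⁻¹

    low⇒<n : ∀ {x} → x < q → x < n
    low⇒<n x<q = ≤-trans x<q (m≤n⇒m≤1+n q≤N)

    π⁻¹-low : ∀ {x} → x < q → p < π⁻¹ x
    π⁻¹-low {x} x<q = ≰⇒> λ h → <⇒≱ x<q (subst (q ≤_) (invʳ perm (low⇒<n x<q)) (head≥ h))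

    data Part (x : ℕ) : Set where
      low  : x < q → Part x
      mid  : q ≤ x → x ≤ p → Part x
      high : p < x → Part x

    part : ∀ x → Part x
    part x with x <? q | x ≤? p
    ... | yes h | _     = low h
    ... | no h  | yes k = mid (≮⇒≥ h) k
    ... | no _  | no k  = high (≰⇒> k)

    ι-low : ∀ {x} → x < q → ι x ≡ π⁻¹ x
    ι-low = fold-low
    ι-mid : ∀ {x} → q ≤ x → x ≤ p → ι x ≡ x
    ι-mid = fold-mid
    ι-high : ∀ {x} → p < x → ι x ≡ π x
    ι-high = fold-high q≤p

    ι< : ∀ {x} → x < n → ι x < n
    ι< {x} x<n with part x
    ... | low h   = subst (_< n) (sym (ι-low h)) (π⁻¹< perm x<n)
    ... | mid h k = subst (_< n) (sym (ι-mid h k)) x<n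
    ... | high h  = subst (_< n) (sym (ι-high h)) (π< perm x<n)

    ιι : ∀ {x} → x < n → ι (ι x) ≡ x
    ιι {x} x<n with part x
    ... | low h   = trans (cong ι (ι-low h)) (trans (ι-high (π⁻¹-low h)) (invʳ perm x<n))
    ... | mid h k = trans (cong ι (ι-mid h k)) (ι-mid h k)
    ... | high h  = trans (cong ι (ι-high h)) (trans (ι-low (tail< h x<n)) (invˡ perm x<n))

    -- The three blocks decrease, so an ascent stays within one block.
    ι-avoids : Avoids n ι
    ι-avoids {i} {j} {k} i<j j<k k<n a b with part i | part k
    ... | low hi | low hk = avoids-inverse perm av i<j j<k k<n
          (subst₂ _<_ (ι-low hi) (ι-low hk) a) (subst₂ _<_ (ι-low hk) (ι-low (<-trans j<k hk)) b)
    ... | low hi | mid hk kk = <⇒≱ (subst₂ _<_ (ι-low hi) (ι-mid hk kk) a) (≤-trans kk (<⇒≤ (π⁻¹-low hi)))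
    ... | low hi | high hk = <⇒≱ (subst₂ _<_ (ι-low hi) (ι-high hk) a)
          (≤-trans (<⇒≤ (tail< hk k<n)) (≤-trans q≤p (<⇒≤ (π⁻¹-low hi))))
    ... | mid hi _ | low hk = <⇒≱ (<-trans i<j j<k) (≤-trans (<⇒≤ hk) hi)
    ... | mid hi ki | mid hk kk = <-asym j<k (subst₂ _<_ (ι-mid hk kk) (ι-mid (≤-trans hi (<⇒≤ i<j)) (≤-trans (<⇒≤ j<k) kk)) b)
    ... | mid hi ki | high hk = <⇒≱ (subst₂ _<_ (ι-mid hi ki) (ι-high hk) a) (≤-trans (<⇒≤ (tail< hk k<n)) hi)
    ... | high hi | low hk = <⇒≱ (<-trans i<j j<k) (≤-trans (<⇒≤ hk) (≤-trans q≤p (<⇒≤ hi)))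
    ... | high hi | mid _ kk = <⇒≱ (<-trans i<j j<k) (≤-trans kk (<⇒≤ hi))
    ... | high hi | high hk = av i<j j<k k<n (subst₂ _<_ (ι-high hi) (ι-high hk) a)
          (subst₂ _<_ (ι-high hk) (ι-high (<-trans hi i<j)) b)

    d = suc p ∸ q
    q+d : q + d ≡ suc p
    q+d = m+[n∸m]≡n (m≤n⇒m≤1+n q≤p)

    tail-σ≥ : ∀ {t} → p < t → t < n → q ≤ σ t
    tail-σ≥ p<t t<n = head≥ (≤-trans (<⇒≤ (tail< p<t t<n)) q≤p)

    -- The values from 2q on are used up by the translation on [q, p].
    low-π<2q : ∀ {x} → x < q → π x < q + q
    low-π<2q {x} x<q = ≰⇒> λ 2q≤v → <⇒≱ x<q (≤-trans (q≤u 2q≤v) (≤-reflexive (injective perm (u<n 2q≤v) (low⇒<n x<q)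
        (trans (shift (q≤u 2q≤v) (u≤p 2q≤v)) (u+q 2q≤v)))))
      where
      u = π x ∸ q
      u+q : q + q ≤ π x → u + q ≡ π x
      u+q h = m∸n+n≡m (≤-trans (m≤m+n q q) h)
      q≤u : q + q ≤ π x → q ≤ u
      q≤u h = +-cancelʳ-≤ q q u (subst (q + q ≤_) (sym (u+q h)) h)
      u≤p : q + q ≤ π x → u ≤ p
      u≤p h = +-cancelʳ-≤ q u p (subst₂ _≤_ (sym (u+q h)) (sym p+q≡N) (≤-pred (π< perm (low⇒<n x<q))))
      u<n : q + q ≤ π x → u < n
      u<n h = ≤-<-trans (u≤p h) p<n

    σ-tail-mono : ∀ {t u} → p < t → t < u → u < n → σ t < σ u
    σ-tail-mono {t} {u} p<t t<u u<n with <-cmp (σ t) (σ u)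
    ... | tri< lt _ _ = lt
    ... | tri≈ _ eq _ = ⊥-elim (<⇒≢ t<u (injective PP (<-trans t<u u<n) u<n eq))
    ... | tri> _ _ gt = ⊥-elim (av² p<t t<u u<n
          (<-≤-trans (subst (_< q) (cong π (sym πp)) (tail< p<N (n<1+n N))) (tail-σ≥ (<-trans p<t t<u) u<n)) gt)

    -- On the tail σ increases with values in [q, 2q), so adding d = p + 1 - q yields an increasing
    -- self-map of (p, N]. In terms of π this expresses π on [0, q) by π⁻¹, which is why the folded
    -- involution determines π there.
    σ-tail : ∀ {t} → p < t → t ≤ N → σ t + d ≡ t
    σ-tail = mono⇒identity (λ t → σ t + d)
      (λ {t} p<t t≤N → subst (_≤ σ t + d) q+d (+-monoˡ-≤ d (tail-σ≥ p<t (s≤s t≤N))))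
      (λ p<t t≤N → ≤-pred (<-≤-trans (+-monoˡ-< d (low-π<2q (tail< p<t (s≤s t≤N))))
        (≤-reflexive (trans (+-assoc q q d) (trans (cong (q +_) q+d) (trans (+-suc q p) (cong suc (trans (+-comm q p) p+q≡N))))))))
      (λ p<t t<u u≤N → +-monoˡ-< d (σ-tail-mono p<t t<u (s≤s u≤N)))

    π-low : ∀ {x} → x < q → π x + d ≡ π⁻¹ x
    π-low {x} x<q = trans (cong (λ v → π v + d) (sym (invʳ perm x<n))) (σ-tail (π⁻¹-low x<q) (≤-pred (π⁻¹< perm x<n)))
      where x<n = low⇒<n x<q

  fold-strong : Strong n (fold q (N ∸ q) π π⁻¹) (fold q (N ∸ q) π π⁻¹)
  fold-strong = involution-strong (record { π< = ι< ; π⁻¹< = ι< ; invˡ = ιι ; invʳ = ιι }) ι-avoids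

  decode-fold : ∀ {f} → f ≈[ n ] fold q (N ∸ q) π π⁻¹ → decodeRotation N f ≈[ n ] π
  decode-fold {f} f≈ {x} x<n = trans (cong (λ v → unfold (N ∸ v) v f x) last)
      (trans (cong (λ v → unfold v p f x) (m∸[m∸n]≡n q≤N))
        (unfold-unique π
          (λ h → trans (cong (_∸ d) (trans (f≈ x<n) (trans (ι-low h) (sym (π-low h))))) (m+n∸n≡m (π x) d))
          (λ h k → sym (shift h k))
          (λ h → trans (f≈ x<n) (ι-high h))))
    where
    last : lastAgreement n f (λ x → x) ≡ p
    last = lastAgreement-≡ n p<n (trans (f≈ p<n) (ι-mid q≤p ≤-refl))
      λ {y} p<y y<n eq → <⇒≢ (<-≤-trans (tail< p<y y<n) (≤-trans q≤p (<⇒≤ p<y)))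
        (trans (sym (ι-high p<y)) (trans (sym (f≈ y<n)) eq))

covers-∪ : ∀ {n P Q R a b} → Cover n P a → Cover n Q b → (∀ {π π⁻¹} → R π π⁻¹ → P π π⁻¹ ⊎ Q π π⁻¹) → Cover n R (a + b)
covers-∪ {n} {P} {Q} {R} {a} {b} A B split = record
  { members = A.members ++ B.members
  ; count≤  = subst (_≤ a + b) (sym (length-++ A.members)) (+-mono-≤ A.count≤ B.count≤)
  ; covers  = λ {π} {π⁻¹} r → pick {π} {π⁻¹} (split r)
  }
  where
  module A = Cover A
  module B = Cover B
  pick : ∀ {π π⁻¹} → P π π⁻¹ ⊎ Q π π⁻¹ → ∃[ f ] (f ∈ A.members ++ B.members × f ≈[ n ] π)
  pick {π} {π⁻¹} (inj₁ p) with f , f∈ , f≈ ← A.covers {π} {π⁻¹} p = f , ∈-++⁺ˡ f∈ , f≈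
  pick {π} {π⁻¹} (inj₂ q) with f , f∈ , f≈ ← B.covers {π} {π⁻¹} q = f , ∈-++⁺ʳ A.members f∈ , f≈

cover-map : ∀ {m n P Q a} (F : (ℕ → ℕ) → ℕ → ℕ) → Cover m P a →
            (∀ {π π⁻¹} → Q π π⁻¹ → ∃[ ρ ] ∃[ ρ⁻¹ ] (P ρ ρ⁻¹ × (∀ {f} → f ≈[ m ] ρ → F f ≈[ n ] π))) → Cover n Q a
cover-map {m} {n} {P} {Q} {a} F A lift = record
  { members = map F A.members
  ; count≤  = subst (_≤ a) (sym (length-map F A.members)) A.count≤
  ; covers  = pick
  }
  where
  module A = Cover A
  pick : ∀ {π π⁻¹} → Q π π⁻¹ → ∃[ f ] (f ∈ map F A.members × f ≈[ n ] π)
  pick r with ρ , ρ⁻¹ , p , ok ← lift r with f , f∈ , f≈ ← A.covers p = F f , ∈-map⁺ F f∈ , ok f≈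

inverse-cover : ∀ {n P a} → (∀ {π π⁻¹} → P π π⁻¹ → Perm n π π⁻¹) → Cover n P a → Cover n (λ π π⁻¹ → P π⁻¹ π) a
inverse-cover {n} perm A = cover-map (invert n) A λ {π} {π⁻¹} p → π⁻¹ , π , p , invert-≈ (perm-inverse (perm p))

threeCycle-cover : ∀ {n b} → CycleCover n b → Cover n (λ π π⁻¹ → Strong n π π⁻¹ × ThreeCycle n π) (b 0)
threeCycle-cover {n} {b} C = record
  { members = map proj₁ nodes
  ; count≤  = subst (_≤ b 0) (trans (weight-0 nodes) (sym (length-map proj₁ nodes))) (weight≤ 0)
  ; covers  = λ (s , t) → let (ν , ν∈ , D) = covers s t in proj₁ ν , ∈-map⁺ proj₁ ν∈ , Describes.same D
  }
  where open CycleCover C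

involution-cover : ∀ n → Cover n (λ π _ → Strong n π π) (walks n 0)
involution-cover n = record
  { members = map fun (codes n 0)
  ; count≤  = ≤-reflexive (trans (length-map fun (codes n 0)) (length-codes n 0))
  ; covers  = λ s → let open Encoding (encode n s) in fun code ,
      ∈-map⁺ fun (codes-complete n 0 valid (trans size≡ (sym (+-identityʳ n))) z≤n) , fun≈
  }

IsRotation : ℕ → (ℕ → ℕ) → (ℕ → ℕ) → Set
IsRotation N π π⁻¹ = Strong (suc N) π π⁻¹ × ∃[ q ] Rotation N π q

rotation-cover : ∀ N → Cover (suc N) (IsRotation N) (walks (suc N) 0)
rotation-cover N = cover-map (decodeRotation N) (involution-cover (suc N))
  λ {π} {π⁻¹} (s , q , rot) → fold q (N ∸ q) π π⁻¹ , fold q (N ∸ q) π π⁻¹ , fold-strong s rot , decode-fold s rot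

strong-cover : ∀ {n r b} → Cover n (Primitive n) r → CycleCover n b → Cover n (Strong n) (r + b 0)
strong-cover {n} R C = covers-∪ R (threeCycle-cover C) λ {π} s → case threeCycle? n π of λ where
  (yes t) → inj₂ (s , t)
  (no ¬t) → inj₁ (s , ¬t)

-- A three-cycle of the other orientation becomes removable in π⁻¹, and a rotation may be one of π
-- or of π⁻¹. Hence `b 0` occurs once and the number of involutions three times; `a` counts the
-- permutations that fix N.
primitive-cover : ∀ {N a b} → Cover N (Strong N) a → CycleCover (suc N) b →
                  Cover (suc N) (Primitive (suc N)) (a + (walks (suc N) 0 + (b 0 + (walks (suc N) 0 + walks (suc N) 0))))
primitive-cover {N} {a} {b} A C =
  covers-∪ fixed-cover (covers-∪ (involution-cover n)
    (covers-∪ (inverse-cover (Strong.perm ∘ proj₁) (threeCycle-cover C))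
      (covers-∪ (rotation-cover N) (inverse-cover (Strong.perm ∘ proj₁) (rotation-cover N)) (λ x → x)) (λ x → x)) (λ x → x)) classify
  where
  n = suc N
  Fixed : (ℕ → ℕ) → (ℕ → ℕ) → Set
  Fixed π π⁻¹ = Strong n π π⁻¹ × π N ≡ N
  fixed-cover : Cover n Fixed a
  fixed-cover = cover-map (extend N) A λ {π} {π⁻¹} (s , πN) → π , π⁻¹ , restrict-fixed s πN , λ f≈ → extend-≈ f≈ πN
  classify : ∀ {π π⁻¹} → Primitive n π π⁻¹ → Fixed π π⁻¹ ⊎ (Strong n π π ⊎
    ((Strong n π⁻¹ π × ThreeCycle n π⁻¹) ⊎ (IsRotation N π π⁻¹ ⊎ IsRotation N π⁻¹ π)))
  classify {π} {π⁻¹} (s , ¬t) with shape s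
  ... | fixed eq         = inj₁ (s , eq)
  ... | involution inv   = inj₂ (inj₁ (strengthen s inv))
  ... | rotation q rot   = inj₂ (inj₂ (inj₂ (inj₁ (s , q , rot))))
  ... | rotation⁻¹ q rot = inj₂ (inj₂ (inj₂ (inj₂ (strong-inverse s , q , rot))))
  ... | threeCycle eq    with <-cmp (π N) (π⁻¹ N)
  ...   | tri< c<p _ _ = ⊥-elim (¬t (subst (π N <_) (sym eq) c<p , trans (cong π eq) (invʳ (Strong.perm s) (n<1+n N))))
  -- With c = p the cycle degenerates: π c = c = π N, so c = N is a fixed point.
  ...   | tri≈ _ e _ = inj₁ (s , trans (cong π (sym fixed-c)) (trans (cong π e) (invʳ perm (n<1+n N))))
    where
    open Strong s
    fixed-c : π N ≡ N
    fixed-c = injective perm (π< perm (n<1+n N)) (n<1+n N) (trans eq (sym e))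
  ...   | tri> _ _ p<c = inj₂ (inj₂ (inj₁ (strong-inverse s , subst (π⁻¹ N <_) (sym ppN) p<c ,
            trans (cong π⁻¹ ppN) (invˡ perm (n<1+n N)))))
    where
    open Strong s
    ppN : π⁻¹ (π⁻¹ N) ≡ π N
    ppN = trans (cong π⁻¹ (sym eq)) (invˡ perm (π< perm (n<1+n N)))

-- Estimates

open ≤-Reasoning

sumTo-+ : ∀ n {f g : ℕ → ℕ} → sumTo n (λ i → f i + g i) ≡ sumTo n f + sumTo n g
sumTo-+ zero            = refl
sumTo-+ (suc n) {f} {g} = trans (cong (f n + g n +_) (sumTo-+ n)) (exchange (f n) (g n) (sumTo n f) (sumTo n g))
  where
  exchange : ∀ a b c d → a + b + (c + d) ≡ a + c + (b + d)
  exchange = solve-∀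

sumTo-* : ∀ n k {f : ℕ → ℕ} → sumTo n (λ i → k * f i) ≡ k * sumTo n f
sumTo-* zero    k     = sym (*-zeroʳ k)
sumTo-* (suc n) k {f} = trans (cong (k * f n +_) (sumTo-* n k)) (sym (*-distribˡ-+ k (f n) (sumTo n f)))

sumTo-≤ : ∀ n {f g : ℕ → ℕ} → (∀ i → f i ≤ g i) → sumTo n f ≤ sumTo n g
sumTo-≤ zero    f≤g = z≤n
sumTo-≤ (suc n) f≤g = +-mono-≤ (f≤g n) (sumTo-≤ n f≤g)

-- The sum over i < k of 2^i 15^(k-1-i) descendants (j + i) l.  A generation adds
-- three to the size, which multiplies the majorant below by at least 15/2.
series : ℕ → ℕ → ℕ → ℕ
series zero    j l = 0
series (suc k) j l = 15 ^ k * descendants j l + 2 * series k (suc j) l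

overChildren : ℕ → (ℕ → ℕ) → ℕ
overChildren l h = sumTo l (λ i → h (2 + i)) + sumTo (l ∸ 1) (λ i → h (2 + i))

overChildren-+* : ∀ l a b {f g : ℕ → ℕ} →
                  overChildren l (λ i → a * f i + b * g i) ≡ a * overChildren l f + b * overChildren l g
overChildren-+* l a b {f} {g} = trans (cong₂ _+_ (lin l) (lin (l ∸ 1))) (regroup a b _ _ _ _)
  where
  lin : ∀ n → sumTo n (λ i → a * f (2 + i) + b * g (2 + i)) ≡ a * sumTo n (λ i → f (2 + i)) + b * sumTo n (λ i → g (2 + i))
  lin n = trans (sumTo-+ n) (cong₂ _+_ (sumTo-* n a) (sumTo-* n b))
  regroup : ∀ a b s t u v → a * s + b * t + (a * u + b * v) ≡ a * (s + u) + b * (t + v)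
  regroup = solve-∀

overChildren-0 : ∀ l → overChildren l (λ _ → 0) ≡ 0
overChildren-0 l = cong₂ _+_ (zeros l) (zeros (l ∸ 1))
  where
  zeros : ∀ n → sumTo n (λ _ → 0) ≡ 0
  zeros zero    = refl
  zeros (suc n) = zeros n

series-suc : ∀ k j l → series k (suc j) l ≡ overChildren l (series k j)
series-suc zero    j l = sym (overChildren-0 l)
series-suc (suc k) j l = trans (cong (λ v → 15 ^ k * descendants (suc j) l + 2 * v) (series-suc k (suc j) l))
  (sym (overChildren-+* l (15 ^ k) 2 {descendants j} {series k (suc j)}))

geometric : ∀ n → sumTo n (λ i → 2 ^ suc i) + 2 ≡ 2 ^ suc n
geometric zero    = refl
geometric (suc n) = trans (+-assoc (2 ^ suc n) _ 2) (trans (cong (2 ^ suc n +_) (geometric n)) (cong (2 ^ suc n +_) (sym (+-identityʳ (2 ^ suc n)))))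

-- Put V = 2^(l - 1) for a node with l = 2 + d sites. Its children have total weight 6V - 4, so K V
-- bounds the series of ratio 2/15 if 1 + (2/15) K (6V - 4) ≤ K V. The smallest case V = 2 dictates
-- K = 15/14.
series-bound : ∀ k d → 14 * series k 0 (2 + d) ≤ 15 ^ k * 2 ^ suc d
series-bound zero    d = z≤n
series-bound (suc k) d = begin
  14 * (15 ^ k * 1 + 2 * series k 1 (2 + d))              ≡⟨ cong (λ v → 14 * (15 ^ k * 1 + 2 * v)) (series-suc k 0 (2 + d)) ⟩
  14 * (15 ^ k * 1 + 2 * (X + Y))                         ≡⟨ expand (15 ^ k) X Y ⟩
  15 ^ k * 14 + 2 * (14 * X + 14 * Y)                     ≤⟨ +-monoʳ-≤ (15 ^ k * 14) (*-monoʳ-≤ 2 (+-mono-≤ (part (2 + d)) (part (1 + d)))) ⟩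
  15 ^ k * 14 + 2 * (15 ^ k * P + 15 ^ k * Q)             ≡⟨ collect (15 ^ k) P Q ⟩
  15 ^ k * (2 * (P + 2) + 2 * (Q + 2) + 6)                ≡⟨ cong₂ (λ u v → 15 ^ k * (2 * u + 2 * v + 6)) (geometric (2 + d)) (geometric (1 + d)) ⟩
  15 ^ k * (2 * (2 * (2 * D)) + 2 * (2 * D) + 6)          ≤⟨ *-monoʳ-≤ (15 ^ k) (+-monoʳ-≤ (2 * (2 * (2 * D)) + 2 * (2 * D)) (*-monoʳ-≤ 3 2≤D)) ⟩
  15 ^ k * (2 * (2 * (2 * D)) + 2 * (2 * D) + 3 * D)      ≡⟨ finish (15 ^ k) D ⟩
  15 ^ suc k * D                                          ∎
  where
  D = 2 ^ suc d
  X = sumTo (2 + d) (λ i → series k 0 (2 + i))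
  Y = sumTo (1 + d) (λ i → series k 0 (2 + i))
  P = sumTo (2 + d) (λ i → 2 ^ suc i)
  Q = sumTo (1 + d) (λ i → 2 ^ suc i)
  2≤D : 2 ≤ D
  2≤D = *-monoʳ-≤ 2 (m^n>0 2 d)
  part : ∀ n → 14 * sumTo n (λ i → series k 0 (2 + i)) ≤ 15 ^ k * sumTo n (λ i → 2 ^ suc i)
  part n = begin
    14 * sumTo n (λ i → series k 0 (2 + i)) ≡⟨ sym (sumTo-* n 14) ⟩
    sumTo n (λ i → 14 * series k 0 (2 + i)) ≤⟨ sumTo-≤ n (series-bound k) ⟩
    sumTo n (λ i → 15 ^ k * 2 ^ suc i)      ≡⟨ sumTo-* n (15 ^ k) ⟩
    15 ^ k * sumTo n (λ i → 2 ^ suc i)      ∎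
  expand : ∀ a x y → 14 * (a * 1 + 2 * (x + y)) ≡ a * 14 + 2 * (14 * x + 14 * y)
  expand = solve-∀
  collect : ∀ a p q → a * 14 + 2 * (a * p + a * q) ≡ a * (2 * (p + 2) + 2 * (q + 2) + 6)
  collect = solve-∀
  finish : ∀ a d → a * (2 * (2 * (2 * d)) + 2 * (2 * d) + 3 * d) ≡ 15 * a * d
  finish = solve-∀

-- Central binomial coefficients

nC0≡1 : ∀ n → n C 0 ≡ 1
nC0≡1 n = refl

walks-0 : ∀ {a j} → a < j → walks a j ≡ 0
walks-0 {zero}  {suc j} _ = refl
walks-0 {suc a} {suc j} (s≤s a<j) = cong₂ _+_ (walks-0 (m<n⇒m<1+n (m<n⇒m<1+n a<j))) (walks-0 a<j)

middle-symmetric : ∀ k → suc (k + k) C k ≡ suc (k + k) C suc k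
middle-symmetric k = trans (nCk≡nC[n∸k] (m≤n⇒m≤1+n (m≤m+n k k)))
  (cong (suc (k + k) C_) (trans (cong (_∸ k) (sym (+-suc k k))) (m+n∸m≡n k (suc k))))

-- Pascal's rule in each case. Only when the predecessor a is odd and j = 0 does the second summand
-- come out as `a C k` in place of `a C suc k`; these are the two equal middle coefficients.
walks≡C : ∀ a j k → k + k + j ≡ a ⊎ k + k + suc j ≡ a → walks a j ≡ a C k
walks≡C zero zero    zero    _         = refl
walks≡C zero zero    (suc k) (inj₁ ())
walks≡C zero zero    (suc k) (inj₂ ())
walks≡C zero (suc j) zero    (inj₁ ())
walks≡C zero (suc j) zero    (inj₂ ())
walks≡C zero (suc j) (suc k) (inj₁ ())
walks≡C zero (suc j) (suc k) (inj₂ ())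
walks≡C (suc a) zero zero (inj₁ ())
walks≡C (suc a) zero zero (inj₂ refl) = refl
walks≡C (suc a) zero (suc k) (inj₁ eq) =
  trans (cong₂ _+_ (walks≡C a 1 k (inj₁ a≡)) (trans (walks≡C a 0 k (inj₂ a≡))
    (subst (λ v → v C k ≡ v C suc k) (trans (+-comm 1 (k + k)) a≡) (middle-symmetric k))))
    (nCk+nC[k+1]≡[n+1]C[k+1] a k)
  where
  a≡ : k + k + 1 ≡ a
  a≡ = suc-injective (trans (e k) eq)
    where e : ∀ k → suc (k + k + 1) ≡ suc k + suc k + 0
          e = solve-∀
walks≡C (suc a) zero (suc k) (inj₂ eq) =
  trans (cong₂ _+_ (walks≡C a 1 k (inj₂ (suc-injective (trans (e k) eq))))
    (walks≡C a 0 (suc k) (inj₁ (suc-injective (trans (sym (+-suc (suc k + suc k) 0)) eq)))))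
    (nCk+nC[k+1]≡[n+1]C[k+1] a k)
  where
  e : ∀ k → suc (k + k + 2) ≡ suc k + suc k + 1
  e = solve-∀
walks≡C (suc a) (suc j) zero h = trans (cong₂ _+_ (walks-0 (lt h)) (walks≡C a j zero (down h))) (trans (nC0≡1 a) (sym (nC0≡1 (suc a))))
  where
  lt : suc j ≡ suc a ⊎ suc (suc j) ≡ suc a → a < 2 + j
  lt (inj₁ eq) = m<n⇒m<1+n (≤-reflexive (sym eq))
  lt (inj₂ eq) = ≤-reflexive (sym (cong suc (suc-injective eq)) )
  down : suc j ≡ suc a ⊎ suc (suc j) ≡ suc a → j ≡ a ⊎ suc j ≡ a
  down (inj₁ eq) = inj₁ (suc-injective eq)
  down (inj₂ eq) = inj₂ (suc-injective eq)
walks≡C (suc a) (suc j) (suc k) h = trans (cong₂ _+_ (walks≡C a (2 + j) k (left h)) (walks≡C a j (suc k) (right h)))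
    (nCk+nC[k+1]≡[n+1]C[k+1] a k)
  where
  left : suc k + suc k + suc j ≡ suc a ⊎ suc k + suc k + suc (suc j) ≡ suc a → k + k + (2 + j) ≡ a ⊎ k + k + suc (2 + j) ≡ a
  left (inj₁ eq) = inj₁ (suc-injective (trans (e k j) eq))
    where e : ∀ k j → suc (k + k + (2 + j)) ≡ suc k + suc k + suc j
          e = solve-∀
  left (inj₂ eq) = inj₂ (suc-injective (trans (e k j) eq))
    where e : ∀ k j → suc (k + k + suc (2 + j)) ≡ suc k + suc k + suc (suc j)
          e = solve-∀
  right : suc k + suc k + suc j ≡ suc a ⊎ suc k + suc k + suc (suc j) ≡ suc a → suc k + suc k + j ≡ a ⊎ suc k + suc k + suc j ≡ a
  right (inj₁ eq) = inj₁ (suc-injective (trans (sym (+-suc (suc k + suc k) j)) eq))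
  right (inj₂ eq) = inj₂ (suc-injective (trans (sym (+-suc (suc k + suc k) (suc j))) eq))

absorption : ∀ n k → suc k * (suc n C suc k) ≡ suc n * (n C k)
absorption zero    zero    = refl
absorption zero    (suc k) = trans (cong ((2 + k) *_) (k>n⇒nCk≡0 {1} {suc (suc k)} (s≤s (s≤s z≤n)))) (trans (*-zeroʳ (2 + k)) (cong (1 *_) (sym (k>n⇒nCk≡0 {0} {suc k} (s≤s z≤n)))))
absorption (suc n) zero    = trans (*-identityˡ _) (trans (sym (nCk+nC[k+1]≡[n+1]C[k+1] (suc n) 0))
  (trans (cong₂ _+_ (nC0≡1 (suc n)) (trans (sym (*-identityˡ _)) (trans (absorption n 0) (trans (cong (suc n *_) (nC0≡1 n)) (*-identityʳ _)))))
    (trans (sym (*-identityʳ (2 + n))) (cong ((2 + n) *_) (sym (nC0≡1 (suc n)))))))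
absorption (suc n) (suc k) = begin-equality
  (2 + k) * (suc (suc n) C (2 + k))      ≡⟨ cong ((2 + k) *_) (sym (nCk+nC[k+1]≡[n+1]C[k+1] (suc n) (suc k))) ⟩
  (2 + k) * (A + (suc n C (2 + k)))      ≡⟨ split k A _ ⟩
  A + (suc k * A + (2 + k) * (suc n C (2 + k))) ≡⟨ cong (A +_) (cong₂ _+_ (absorption n k) (absorption n (suc k))) ⟩
  A + (suc n * (n C k) + suc n * (n C suc k)) ≡⟨ cong (A +_) (sym (*-distribˡ-+ (suc n) (n C k) _)) ⟩
  A + suc n * (n C k + n C suc k)        ≡⟨ cong (λ v → A + suc n * v) (nCk+nC[k+1]≡[n+1]C[k+1] n k) ⟩
  (2 + n) * A                            ∎
  where
  A = suc n C suc k
  split : ∀ k a b → (2 + k) * (a + b) ≡ a + (suc k * a + (2 + k) * b)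
  split = solve-∀

central : ℕ → ℕ
central n = walks n 0

central-odd : ∀ k → suc k * central (suc (k + k)) ≡ suc (k + k) * central (k + k)
central-odd k = trans (cong (suc k *_) (trans (walks≡C (suc (k + k)) 0 k (inj₂ (+-comm (k + k) 1))) (middle-symmetric k)))
  (trans (absorption (k + k) k) (cong (suc (k + k) *_) (sym (walks≡C (k + k) 0 k (inj₁ (+-identityʳ (k + k)))))))

central-even : ∀ k → central (2 + (k + k)) ≡ 2 * central (suc (k + k))
central-even k = cong₂ _+_ (trans (walks≡C n 1 k (inj₁ (+-comm (k + k) 1))) (sym (walks≡C n 0 k (inj₂ (+-comm (k + k) 1))))) (sym (+-identityʳ _))
  where n = suc (k + k)

data Parity : ℕ → Set where
  even : ∀ k → Parity (k + k)
  odd  : ∀ k → Parity (suc (k + k))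

parity : ∀ n → Parity n
parity zero = even 0
parity (suc n) with parity n
... | even k = odd k
... | odd k  = subst Parity (cong suc (+-suc k k)) (even (suc k))

central-mono : ∀ n → central n ≤ central (suc n)
central-mono n = m≤n+m (central n) (walks n 1)

central-mono-+ : ∀ n k → central n ≤ central (n + k)
central-mono-+ n zero    = ≤-reflexive (cong central (sym (+-identityʳ n)))
central-mono-+ n (suc k) = ≤-trans (central-mono-+ n k) (≤-trans (central-mono (n + k)) (≤-reflexive (cong central (sym (+-suc n k)))))

central>0 : ∀ n → 0 < central n
central>0 n = central-mono-+ 0 n

-- From 2k to 2k + 1 the factor is (2k + 1) / (k + 1), which reaches 65/33 at k = 32; from odd to
-- even it is 2.
central-growth : ∀ n → 64 ≤ n → 65 * central n ≤ 33 * central (suc n)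
central-growth n 64≤n with parity n
... | odd k  = ≤-trans (*-monoˡ-≤ (central (suc (k + k))) {65} {66} (n≤1+n 65))
      (≤-reflexive (trans (*-assoc 33 2 (central (suc (k + k)))) (cong (33 *_) (sym (central-even k)))))
... | even k = *-cancelˡ-≤ (suc k) (begin
  suc k * (65 * A)             ≡⟨ e₁ k A ⟩
  (65 * k + 33 + 32) * A       ≤⟨ *-monoˡ-≤ A (+-monoʳ-≤ (65 * k + 33) 32≤k) ⟩
  (65 * k + 33 + k) * A        ≡⟨ e₂ k A ⟩
  33 * (suc (k + k) * A)       ≡⟨ cong (33 *_) (sym (central-odd k)) ⟩
  33 * (suc k * B)             ≡⟨ e₃ k B ⟩
  suc k * (33 * B)             ∎)
  where
  A = central (k + k)
  B = central (suc (k + k))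
  32≤k : 32 ≤ k
  32≤k = ≮⇒≥ λ k<32 → <⇒≱ (+-mono-< k<32 k<32) 64≤n
  e₁ : ∀ k a → suc k * (65 * a) ≡ (65 * k + 33 + 32) * a
  e₁ = solve-∀
  e₂ : ∀ k a → (65 * k + 33 + k) * a ≡ 33 * (suc (k + k) * a)
  e₂ = solve-∀
  e₃ : ∀ k b → 33 * (suc k * b) ≡ suc k * (33 * b)
  e₃ = solve-∀

central-lower : ∀ n → 2 ^ n ≤ suc n * central n
central-lower zero = ≤-refl
central-lower (suc n) with parity n
... | even k = begin
  2 * 2 ^ (k + k)                          ≤⟨ *-monoʳ-≤ 2 (central-lower (k + k)) ⟩
  2 * (suc (k + k) * central (k + k))      ≡⟨ cong (2 *_) (sym (central-odd k)) ⟩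
  2 * (suc k * central (suc (k + k)))      ≡⟨ e k (central (suc (k + k))) ⟩
  (2 + (k + k)) * central (suc (k + k))    ∎
  where
  e : ∀ k b → 2 * (suc k * b) ≡ (2 + (k + k)) * b
  e = solve-∀
... | odd k = begin
  2 * 2 ^ suc (k + k)                            ≤⟨ *-monoʳ-≤ 2 (central-lower (suc (k + k))) ⟩
  2 * ((2 + (k + k)) * central (suc (k + k)))    ≡⟨ e k (central (suc (k + k))) ⟩
  (2 + (k + k)) * (2 * central (suc (k + k)))    ≡⟨ cong ((2 + (k + k)) *_) (sym (central-even k)) ⟩
  (2 + (k + k)) * central (2 + (k + k))          ≤⟨ *-monoˡ-≤ (central (2 + (k + k))) (n≤1+n (2 + (k + k))) ⟩
  (3 + (k + k)) * central (2 + (k + k))          ∎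
  where
  e : ∀ k b → 2 * ((2 + (k + k)) * b) ≡ (2 + (k + k)) * (2 * b)
  e = solve-∀

-- This is the estimate C(2k, k) ≤ 4^k / √(2k + 1), squared; the induction step rests on (2k + 1)(2k
-- + 3) < (2k + 2)².
central-square : ∀ k → suc (k + k) * (central (k + k) * central (k + k)) ≤ 2 ^ (k + k) * 2 ^ (k + k)
central-square zero    = ≤-refl
central-square (suc k) = *-cancelˡ-≤ (suc k * suc k) (subst (λ v → suc k * suc k * (suc v * (central v * central v)) ≤ suc k * suc k * (2 ^ v * 2 ^ v))
  (cong suc (sym (+-suc k k))) (begin
    suc k * suc k * ((3 + (k + k)) * (central (2 + (k + k)) * central (2 + (k + k))))
      ≡⟨ cong (λ v → suc k * suc k * ((3 + (k + k)) * (v * v))) (central-even k) ⟩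
    suc k * suc k * ((3 + (k + k)) * (2 * B * (2 * B)))
      ≡⟨ e₁ k B ⟩
    4 * ((3 + (k + k)) * (suc k * B * (suc k * B)))
      ≡⟨ cong (λ v → 4 * ((3 + (k + k)) * (v * v))) (central-odd k) ⟩
    4 * ((3 + (k + k)) * (suc (k + k) * A * (suc (k + k) * A)))
      ≡⟨ e₂ k A ⟩
    4 * ((3 + (k + k)) * suc (k + k)) * (suc (k + k) * (A * A))
      ≤⟨ *-mono-≤ (*-monoʳ-≤ 4 (m+n≤o⇒m≤o ((3 + (k + k)) * suc (k + k)) (≤-reflexive (e₃ k)))) (central-square k) ⟩
    4 * (4 * (suc k * suc k)) * (E * E)
      ≡⟨ e₄ k E ⟩
    suc k * suc k * (2 ^ (2 + (k + k)) * 2 ^ (2 + (k + k))) ∎))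
  where
  A = central (k + k)
  B = central (suc (k + k))
  E = 2 ^ (k + k)
  e₁ : ∀ k b → suc k * suc k * ((3 + (k + k)) * (2 * b * (2 * b))) ≡ 4 * ((3 + (k + k)) * (suc k * b * (suc k * b)))
  e₁ = solve-∀
  e₂ : ∀ k a → 4 * ((3 + (k + k)) * (suc (k + k) * a * (suc (k + k) * a))) ≡ 4 * ((3 + (k + k)) * suc (k + k)) * (suc (k + k) * (a * a))
  e₂ = solve-∀
  e₃ : ∀ k → (3 + (k + k)) * suc (k + k) + 1 ≡ 4 * (suc k * suc k)
  e₃ = solve-∀
  e₄ : ∀ k e → 4 * (4 * (suc k * suc k)) * (e * e) ≡ suc k * suc k * (2 * (2 * e) * (2 * (2 * e)))
  e₄ = solve-∀

≤-of-squares : ∀ {x y} → x * x ≤ y * y → x ≤ y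
≤-of-squares {x} {y} h = ≮⇒≥ λ y<x → <⇒≱ (*-mono-< y<x y<x) h

-- The saving of order √n in `central-square` eventually beats any constant factor M.
central-small : ∀ M n → M * M ≤ n → M * central n ≤ 2 ^ n
central-small M n M²≤n with parity n
... | even k = even-case k (m≤n⇒m≤1+n M²≤n)
  where
  even-case : ∀ k → M * M ≤ suc (k + k) → M * central (k + k) ≤ 2 ^ (k + k)
  even-case k h = ≤-of-squares (begin
    M * A * (M * A)        ≡⟨ e M A ⟩
    M * M * (A * A)        ≤⟨ *-monoˡ-≤ (A * A) h ⟩
    suc (k + k) * (A * A)  ≤⟨ central-square k ⟩
    2 ^ (k + k) * 2 ^ (k + k) ∎)
    where
    A = central (k + k)
    e : ∀ m a → m * a * (m * a) ≡ m * m * (a * a)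
    e = solve-∀
... | odd k = *-cancelˡ-≤ (suc k) (begin
  suc k * (M * B)             ≡⟨ e₁ k M B ⟩
  M * (suc k * B)             ≡⟨ cong (M *_) (central-odd k) ⟩
  M * (suc (k + k) * A)       ≤⟨ *-monoʳ-≤ M (*-monoˡ-≤ A (n≤1+n (suc (k + k)))) ⟩
  M * ((2 + (k + k)) * A)     ≡⟨ e₂ k M A ⟩
  suc k * (2 * (M * A))       ≤⟨ *-monoʳ-≤ (suc k) (*-monoʳ-≤ 2 MA≤) ⟩
  suc k * (2 * 2 ^ (k + k))   ∎)
  where
  A = central (k + k)
  B = central (suc (k + k))
  e₁ : ∀ k m b → suc k * (m * b) ≡ m * (suc k * b)
  e₁ = solve-∀
  e₂ : ∀ k m a → m * ((2 + (k + k)) * a) ≡ suc k * (2 * (m * a))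
  e₂ = solve-∀
  e₀ : ∀ m a → m * a * (m * a) ≡ m * m * (a * a)
  e₀ = solve-∀
  MA≤ : M * A ≤ 2 ^ (k + k)
  MA≤ = ≤-of-squares (≤-trans (≤-reflexive (e₀ M A)) (≤-trans (*-monoˡ-≤ (A * A) M²≤n) (central-square k)))

-- The shift by 64 raises the growth factor to 65/33.
abstract
  majorant : ℕ → ℕ
  majorant n = central (n + 64)

  majorant≡ : ∀ n → majorant n ≡ central (n + 64)
  majorant≡ n = refl

  majorant-growth : ∀ n → 65 * majorant n ≤ 33 * majorant (suc n)
  majorant-growth n = central-growth (n + 64) (m≤n+m 64 n)

  central≤majorant : ∀ n → central n ≤ majorant n
  central≤majorant n = central-mono-+ n 64

-- The coefficients are variables to keep them from being unfolded.
three-steps : ∀ x y p q {a b c d} .{{_ : NonZero y}} → x * a ≤ y * b → x * b ≤ y * c → x * c ≤ y * d →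
              p * (y * (y * y)) ≤ q * (x * (x * x)) → p * a ≤ q * d
three-steps x y p q {a} {b} {c} {d} h₁ h₂ h₃ h = *-cancelˡ-≤ (y * (y * y)) {{m*n≢0 y (y * y) {{it}} {{m*n≢0 y y}}}} (begin
  y * (y * y) * (p * a)     ≡⟨ e₁ y p a ⟩
  p * (y * (y * y)) * a     ≤⟨ *-monoˡ-≤ a h ⟩
  q * (x * (x * x)) * a     ≡⟨ e₂ q x a ⟩
  q * (x * (x * (x * a)))   ≤⟨ *-monoʳ-≤ q (*-monoʳ-≤ x (*-monoʳ-≤ x h₁)) ⟩
  q * (x * (x * (y * b)))   ≡⟨ e₃ q x y b ⟩
  q * (y * (x * (x * b)))   ≤⟨ *-monoʳ-≤ q (*-monoʳ-≤ y (*-monoʳ-≤ x h₂)) ⟩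
  q * (y * (x * (y * c)))   ≡⟨ e₄ q x y c ⟩
  q * (y * (y * (x * c)))   ≤⟨ *-monoʳ-≤ q (*-monoʳ-≤ y (*-monoʳ-≤ y h₃)) ⟩
  q * (y * (y * (y * d)))   ≡⟨ e₅ q y d ⟩
  y * (y * y) * (q * d)     ∎)
  where
  e₁ : ∀ y p a → y * (y * y) * (p * a) ≡ p * (y * (y * y)) * a
  e₁ = solve-∀
  e₂ : ∀ q x a → q * (x * (x * x)) * a ≡ q * (x * (x * (x * a)))
  e₂ = solve-∀
  e₃ : ∀ q x y b → q * (x * (x * (y * b))) ≡ q * (y * (x * (x * b)))
  e₃ = solve-∀
  e₄ : ∀ q x y c → q * (y * (x * (y * c))) ≡ q * (y * (y * (x * c)))
  e₄ = solve-∀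
  e₅ : ∀ q y d → q * (y * (y * (y * d))) ≡ y * (y * y) * (q * d)
  e₅ = solve-∀

-- (65/33)³ exceeds 15/2, a ratio chosen between the factor 6 per generation of the tree and the
-- limit 8.
majorant-growth³ : ∀ n → 15 * majorant n ≤ 2 * majorant (3 + n)
majorant-growth³ n = three-steps 65 33 15 2 {majorant n} {majorant (1 + n)} {majorant (2 + n)} {majorant (3 + n)} (majorant-growth n) (majorant-growth (suc n)) (majorant-growth (2 + n))
  (≤ᵇ⇒≤ (15 * (33 * (33 * 33))) (2 * (65 * (65 * 65))) _)

-- 49 * majorant m is the bound on primitive permutations of size m established below.
cycleBound : ℕ → ℕ → ℕ
cycleBound (suc (suc (suc m))) j = cycleBound m (suc j) + 49 * majorant m * descendants j 2
cycleBound _                   j = 0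

-- Unrolling `cycleBound` sums over the generations since the primitive ancestor, and each
-- generation lowers the majorant by a factor of at least 15/2. Any k that exhausts m in steps of
-- three will do; the power of 15 clears the denominators.
cycleBound-series : ∀ k m j → m < 3 + k * 3 → 15 ^ k * cycleBound m j ≤ 49 * majorant m * (2 * series k j 2)
cycleBound-series k       zero                j _ = ≤-trans (≤-reflexive (*-zeroʳ (15 ^ k))) z≤n
cycleBound-series k       (suc zero)          j _ = ≤-trans (≤-reflexive (*-zeroʳ (15 ^ k))) z≤n
cycleBound-series k       (suc (suc zero))    j _ = ≤-trans (≤-reflexive (*-zeroʳ (15 ^ k))) z≤n
cycleBound-series zero    (suc (suc (suc m))) j (s≤s (s≤s (s≤s ())))
cycleBound-series (suc k) (suc (suc (suc m))) j (s≤s (s≤s (s≤s m<))) = begin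
  15 * P * (cycleBound m (suc j) + 49 * M * D)
    ≡⟨ e₁ 15 P 49 M D (cycleBound m (suc j)) ⟩
  15 * (P * cycleBound m (suc j)) + 49 * (15 * M) * (P * D)
    ≤⟨ +-monoˡ-≤ (49 * (15 * M) * (P * D)) (*-monoʳ-≤ 15 (cycleBound-series k m (suc j) m<)) ⟩
  15 * (49 * M * (2 * S)) + 49 * (15 * M) * (P * D)
    ≡⟨ e₂ 15 49 M (2 * S) (P * D) ⟩
  49 * (15 * M) * (P * D + 2 * S)
    ≤⟨ *-monoˡ-≤ (P * D + 2 * S) (*-monoʳ-≤ 49 (majorant-growth³ m)) ⟩
  49 * (2 * M′) * (P * D + 2 * S)
    ≡⟨ e₃ 49 2 M′ (P * D + 2 * S) ⟩
  49 * M′ * (2 * (P * D + 2 * S)) ∎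
  where
  P = 15 ^ k
  M = majorant m
  M′ = majorant (3 + m)
  D = descendants j 2
  S = series k (suc j) 2
  e₁ : ∀ f p c m d b → f * p * (b + c * m * d) ≡ f * (p * b) + c * (f * m) * (p * d)
  e₁ = solve-∀
  e₂ : ∀ f c m s x → f * (c * m * s) + c * (f * m) * x ≡ c * (f * m) * (x + s)
  e₂ = solve-∀
  e₃ : ∀ c t m x → c * (t * m) * x ≡ c * m * (t * x)
  e₃ = solve-∀

-- 14 = 49 · (2/15) · (15/7): one factor 2/15 for the first insertion, and 15/7 from `series-bound`
-- at two sites.
cycleBound≤ : ∀ n → cycleBound n 0 ≤ 14 * majorant n
cycleBound≤ n = *-cancelˡ-≤ (15 ^ n) {{m^n≢0 15 n}} (begin
  15 ^ n * cycleBound n 0     ≤⟨ cycleBound-series n n 0 (s≤s (≤-trans (m≤m*n n 3) (m≤n+m (n * 3) 2))) ⟩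
  49 * M * (2 * S)            ≡⟨ e₁ M S ⟩
  7 * M * (14 * S)            ≤⟨ *-monoʳ-≤ (7 * M) (series-bound n 0) ⟩
  7 * M * (15 ^ n * 2)        ≡⟨ e₂ M (15 ^ n) ⟩
  15 ^ n * (14 * M)           ∎)
  where
  M = majorant n
  S = series n 0 2
  e₁ : ∀ m s → 49 * m * (2 * s) ≡ 7 * m * (14 * s)
  e₁ = solve-∀
  e₂ : ∀ m p → 7 * m * (p * 2) ≡ p * (14 * m)
  e₂ = solve-∀

cover-weaken : ∀ {n P a b} → a ≤ b → Cover n P a → Cover n P b
cover-weaken a≤b C = record { members = members ; count≤ = ≤-trans count≤ a≤b ; covers = covers }
  where open Cover C

cycle-cover : ∀ n → (∀ {m} → m < n → Cover m (Primitive m) (49 * majorant m)) → CycleCover n (cycleBound n)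
cycle-cover zero                _ = smallCycleCover (s≤s z≤n)
cycle-cover (suc zero)          _ = smallCycleCover (s≤s (s≤s z≤n))
cycle-cover (suc (suc zero))    _ = smallCycleCover (s≤s (s≤s (s≤s z≤n)))
cycle-cover (suc (suc (suc m))) R = cycleCover-step
  (cycle-cover m (λ {k} k<m → R (≤-trans k<m (m≤n+m m 3))))
  (R (s≤s (m≤n+m m 2)))

-- 63 · 33/65 < 32, and 32 + 3 + 14 = 49.
primitive-bound : ∀ N → 49 * majorant N + cycleBound N 0 + (central (suc N) + (cycleBound (suc N) 0 + (central (suc N) + central (suc N))))
                  ≤ 49 * majorant (suc N)
primitive-bound N = begin
  49 * M + cycleBound N 0 + (c + (cycleBound (suc N) 0 + (c + c)))
    ≤⟨ +-mono-≤ (+-monoʳ-≤ (49 * M) (cycleBound≤ N)) (+-mono-≤ c≤ (+-mono-≤ (cycleBound≤ (suc N)) (+-mono-≤ c≤ c≤))) ⟩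
  49 * M + 14 * M + (M′ + (14 * M′ + (M′ + M′)))
    ≡⟨ e₁ M M′ ⟩
  63 * M + 17 * M′
    ≤⟨ +-monoˡ-≤ (17 * M′) 63M≤32M′ ⟩
  32 * M′ + 17 * M′
    ≡⟨ sym (*-distribʳ-+ M′ 32 17) ⟩
  49 * M′ ∎
  where
  M = majorant N
  M′ = majorant (suc N)
  c = central (suc N)
  c≤ : c ≤ M′
  c≤ = central≤majorant (suc N)
  e₁ : ∀ m m′ → 49 * m + 14 * m + (m′ + (14 * m′ + (m′ + m′))) ≡ 63 * m + 17 * m′
  e₁ = solve-∀
  scale : ∀ x y p q {a b} .{{_ : NonZero y}} → y * a ≤ x * b → p * x ≤ q * y → p * a ≤ q * b
  scale x y p q {a} {b} h₁ h₂ = *-cancelˡ-≤ y (begin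
    y * (p * a) ≡⟨ swap y p a ⟩
    p * (y * a) ≤⟨ *-monoʳ-≤ p h₁ ⟩
    p * (x * b) ≡⟨ sym (*-assoc p x b) ⟩
    p * x * b   ≤⟨ *-monoˡ-≤ b h₂ ⟩
    q * y * b   ≡⟨ trans (*-assoc q y b) (swap q y b) ⟩
    y * (q * b) ∎)
    where
    swap : ∀ x y z → x * (y * z) ≡ y * (x * z)
    swap = solve-∀
  63M≤32M′ : 63 * M ≤ 32 * M′
  63M≤32M′ = scale 33 65 63 32 {M} {M′} (majorant-growth N) (≤ᵇ⇒≤ (63 * 33) (32 * 65) _)

primitive-covers : ∀ n → Cover n (Primitive n) (49 * majorant n)
primitive-covers = <-rec _ step
  where
  step : ∀ n → (∀ {m} → m < n → Cover m (Primitive m) (49 * majorant m)) → Cover n (Primitive n) (49 * majorant n)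
  step zero _ = record
    { members = (λ x → x) ∷ []
    ; count≤  = ≤-trans (≤-trans (central>0 0) (central≤majorant 0)) (m≤n*m (majorant 0) 49)
    ; covers  = λ _ → (λ x → x) , here refl , λ ()
    }
  step (suc N) R = cover-weaken (primitive-bound N)
    (primitive-cover (strong-cover (R (n<1+n N)) (cycle-cover N (λ m<N → R (m<n⇒m<1+n m<N)))) (cycle-cover (suc N) R))

strong-covers : ∀ n → Cover n (Strong n) (63 * majorant n)
strong-covers n = cover-weaken (≤-trans (+-monoʳ-≤ (49 * majorant n) (cycleBound≤ n)) (≤-reflexive (sym (*-distribʳ-+ (majorant n) 49 14))))
  (strong-cover (primitive-covers n) (cycle-cover n (λ {m} _ → primitive-covers m)))

-- central-small with M = 64 · 2⁶⁴, where 2⁶⁴ undoes the shift in the majorant.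
abstract
  large : ℕ
  large = 64 * 2 ^ 64 * (64 * 2 ^ 64)

  majorant-small : ∀ n → large ≤ n → 63 * majorant n < 2 ^ n
  majorant-small n big = <-≤-trans (*-monoˡ-< (majorant n) {{>-nonZero majorant>0}} (n<1+n 63))
    (shrink-power 64 64 n {majorant n} (subst (λ v → 64 * 2 ^ 64 * v ≤ 2 ^ (n + 64)) (sym (majorant≡ n))
      (central-small (64 * 2 ^ 64) (n + 64) (≤-trans big (m≤m+n n 64)))))
    where
    majorant>0 : 0 < majorant n
    majorant>0 = <-≤-trans (central>0 n) (central≤majorant n)
    shrink-power : ∀ a k n {b} → a * 2 ^ k * b ≤ 2 ^ (n + k) → a * b ≤ 2 ^ n
    shrink-power a k n {b} h = *-cancelˡ-≤ (2 ^ k) {{m^n≢0 2 k}} (begin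
      2 ^ k * (a * b)   ≡⟨ trans (sym (*-assoc (2 ^ k) a b)) (cong (_* b) (*-comm (2 ^ k) a)) ⟩
      a * 2 ^ k * b     ≤⟨ h ⟩
      2 ^ (n + k)       ≡⟨ trans (^-distribˡ-+-* 2 n k) (*-comm (2 ^ n) (2 ^ k)) ⟩
      2 ^ k * 2 ^ n     ∎)

-- Counting

record Enumerates {m} (P : Fin m → Set) (c : ℕ) : Set where
  field
    at     : Fin c → Fin m
    at-inj : ∀ {i j} → at i ≡ at j → i ≡ j
    holds  : ∀ i → P (at i)
    onto   : ∀ k → P k → ∃[ i ] (at i ≡ k)

count-enumerates : ∀ {m} {A : Set} (f : Fin m → A) {P : A → Set} (P? : Decidable P) →
                   Enumerates (P ∘ f) (count P? (tabulate f))
count-enumerates {zero}  f P? = record { at = λ () ; at-inj = λ {} ; holds = λ () ; onto = λ () }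
count-enumerates {suc m} f {P} P? with P? (f Fin.zero) | count-enumerates (f ∘ Fin.suc) P?
... | yes p | E = record { at = at′ ; at-inj = inj′ _ _ ; holds = holds′ ; onto = onto′ }
  where
  open Enumerates E
  at′ : Fin (suc _) → Fin (suc m)
  at′ Fin.zero    = Fin.zero
  at′ (Fin.suc i) = Fin.suc (at i)
  inj′ : ∀ i j → at′ i ≡ at′ j → i ≡ j
  inj′ Fin.zero    Fin.zero    _  = refl
  inj′ Fin.zero    (Fin.suc j) ()
  inj′ (Fin.suc i) Fin.zero    ()
  inj′ (Fin.suc i) (Fin.suc j) eq = cong Fin.suc (at-inj (suc-inj eq))
    where
    suc-inj : ∀ {n} {i j : Fin n} → Fin.suc i ≡ Fin.suc j → i ≡ j
    suc-inj refl = refl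
  holds′ : ∀ i → P (f (at′ i))
  holds′ Fin.zero    = p
  holds′ (Fin.suc i) = holds i
  onto′ : ∀ k → P (f k) → ∃[ i ] (at′ i ≡ k)
  onto′ Fin.zero    _ = Fin.zero , refl
  onto′ (Fin.suc k) h with i , eq ← onto k h = Fin.suc i , cong Fin.suc eq
... | no ¬p | E = record { at = Fin.suc ∘ at ; at-inj = λ { eq → at-inj (suc-inj eq) } ; holds = holds ; onto = onto′ }
  where
  open Enumerates E
  suc-inj : ∀ {n} {i j : Fin n} → Fin.suc i ≡ Fin.suc j → i ≡ j
  suc-inj refl = refl
  onto′ : ∀ k → P (f k) → ∃[ i ] (Fin.suc (at i) ≡ k)
  onto′ Fin.zero    h = ⊥-elim (¬p h)
  onto′ (Fin.suc k) h with i , eq ← onto k h = i , cong Fin.suc eq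

Counted : ∀ n → Fin (n ^ n) → Set
Counted n k = IsPermutation (finToFun {n} {n} k) × StronglyAvoids132 (finToFun {n} {n} k)

counted : ∀ n → Enumerates (Counted n) (numStronglyAvoiding132 n)
counted n = count-enumerates (λ k → k) (λ k → isPermutation? (finToFun k) ×-dec stronglyAvoids132? (finToFun k))

toNatFun : ∀ {n} → (Fin n → Fin n) → ℕ → ℕ
toNatFun {n} f x with x <? n
... | yes x<n = toℕ (f (fromℕ< x<n))
... | no  _   = x

toNatFun-toℕ : ∀ {n} (f : Fin n → Fin n) i → toNatFun f (toℕ i) ≡ toℕ (f i)
toNatFun-toℕ {n} f i with toℕ i <? n
... | yes i<n = cong (toℕ ∘ f) (fromℕ<-toℕ i i<n)
... | no  i≮n = ⊥-elim (i≮n (toℕ<n i))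

data FinView {n} : ℕ → Set where
  fin : (i : Fin n) → FinView (toℕ i)

finView : ∀ {n x} → x < n → FinView {n} x
finView x<n = subst FinView (toℕ-fromℕ< x<n) (fin (fromℕ< x<n))

module _ {n} {f : Fin n → Fin n} (bijective : IsPermutation f) where

  private
    g : Fin n → Fin n
    g = proj₁ ∘ proj₂ bijective
    fg : ∀ y → f (g y) ≡ y
    fg y = proj₂ (proj₂ bijective y) refl
    gf : ∀ x → g (f x) ≡ x
    gf x = proj₁ bijective (fg (f x))

  perm-of : Perm n (toNatFun f) (toNatFun g)
  perm-of = record
    { π<   = λ x<n → bound f (finView x<n)
    ; π⁻¹< = λ x<n → bound g (finView x<n)
    ; invˡ = λ x<n → cancel g f gf (finView x<n)
    ; invʳ = λ x<n → cancel f g fg (finView x<n)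
    }
    where
    bound : ∀ h {x} → FinView {n} x → toNatFun h x < n
    bound h (fin i) = subst (_< n) (sym (toNatFun-toℕ h i)) (toℕ<n (h i))
    cancel : ∀ h k → (∀ i → h (k i) ≡ i) → ∀ {x} → FinView {n} x → toNatFun h (toNatFun k x) ≡ x
    cancel h k hk (fin i) = trans (cong (toNatFun h) (toNatFun-toℕ k i))
      (trans (toNatFun-toℕ h (k i)) (cong toℕ (hk i)))

  avoids-of : ∀ {h : Fin n → Fin n} {h′ : ℕ → ℕ} → (∀ i → h′ (toℕ i) ≡ toℕ (h i)) → Avoids132 h → Avoids n h′
  avoids-of {h} {h′} eq av {i} {j} {k} i<j j<k k<n p q =
    go (finView (<-trans i<j (<-trans j<k k<n))) (finView (<-trans j<k k<n)) (finView k<n) i<j j<k p q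
    where
    go : ∀ {i j k} → FinView {n} i → FinView {n} j → FinView {n} k → i < j → j < k → h′ i < h′ k → h′ k < h′ j → ⊥
    go (fin i) (fin j) (fin k) i<j j<k p q =
      av (i , j , k , i<j , j<k , subst₂ _<_ (eq i) (eq k) p , subst₂ _<_ (eq k) (eq j) q)

  strong-of : StronglyAvoids132 f → Strong n (toNatFun f) (toNatFun g)
  strong-of (av , av²) = record
    { perm = perm-of
    ; av   = avoids-of (toNatFun-toℕ f) av
    ; av²  = avoids-of (λ i → trans (cong (toNatFun f) (toNatFun-toℕ f i)) (toNatFun-toℕ f (f i))) av²
    }

funToFin-cong : ∀ {m n} {f g : Fin m → Fin n} → (∀ i → f i ≡ g i) → funToFin f ≡ funToFin g
funToFin-cong {zero}  eq = refl
funToFin-cong {suc m} eq = cong₂ Fin.combine (eq Fin.zero) (funToFin-cong (eq ∘ Fin.suc))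

finToFun-injective : ∀ {n k l} → (∀ i → finToFun {n} {n} k i ≡ finToFun {n} {n} l i) → k ≡ l
finToFun-injective {n} {k} {l} eq = trans (sym (funToFin-finToFin {n} {n} k)) (trans (funToFin-cong eq) (funToFin-finToFin {n} {n} l))

-- The index of a covering member determines the permutation, because the member agrees with it
-- below n.
count-upper : ∀ {n b} → Cover n (Strong n) b → numStronglyAvoiding132 n ≤ b
count-upper {n} {b} C = ≤-trans (injective⇒≤ {f = code} code-injective) C.count≤
  where
  module C = Cover C
  open Enumerates (counted n)
  F : Fin (numStronglyAvoiding132 n) → Fin n → Fin n
  F i = finToFun (at i)
  found : ∀ i → ∃[ f ] (f ∈ C.members × f ≈[ n ] toNatFun (F i))
  found i = C.covers (strong-of (proj₁ (holds i)) (proj₂ (holds i)))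
  code : Fin (numStronglyAvoiding132 n) → Fin (length C.members)
  code i = index (proj₁ (proj₂ (found i)))
  code-injective : ∀ {i j} → code i ≡ code j → i ≡ j
  code-injective {i} {j} eq = at-inj (finToFun-injective λ x → toℕ-injective (trans (sym (toNatFun-toℕ (F i) x))
      (trans (sym (proj₂ (proj₂ (found i)) (toℕ<n x))) (trans (cong (λ f → f (toℕ x)) same)
        (trans (proj₂ (proj₂ (found j)) (toℕ<n x)) (toNatFun-toℕ (F j) x))))))
    where
    same : proj₁ (found i) ≡ proj₁ (found j)
    same = index-injective (setoid (ℕ → ℕ)) (proj₁ (proj₂ (found i))) (proj₁ (proj₂ (found j))) eq

module _ {n f} (s : Strong n f f) where
  open Strong s

  restrictFin : Fin n → Fin n
  restrictFin i = fromℕ< (π< perm (toℕ<n i))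

  toℕ-restrictFin : ∀ i → toℕ (restrictFin i) ≡ f (toℕ i)
  toℕ-restrictFin i = toℕ-fromℕ< (π< perm (toℕ<n i))

  private
    g = finToFun {n} {n} (funToFin restrictFin)
    toℕ-g : ∀ i → toℕ (g i) ≡ f (toℕ i)
    toℕ-g i = trans (cong toℕ (finToFun-funToFin restrictFin i)) (toℕ-restrictFin i)
    gg : ∀ i → g (g i) ≡ i
    gg i = toℕ-injective (trans (toℕ-g (g i)) (trans (cong f (toℕ-g i)) (invˡ perm (toℕ<n i))))

  restrictFin-counted : Counted n (funToFin restrictFin)
  restrictFin-counted =
    ((λ {x} {y} eq → trans (sym (gg x)) (trans (cong g eq) (gg y))) , λ y → g y , λ { refl → gg y }) ,
    (λ { (i , j , k , i<j , j<k , p , q) → av i<j j<k (toℕ<n k)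
           (subst₂ _<_ (toℕ-g i) (toℕ-g k) p) (subst₂ _<_ (toℕ-g k) (toℕ-g j) q) }) ,
    λ { (i , j , k , i<j , j<k , p , q) → <-asym j<k
           (subst₂ _<_ (cong toℕ (gg k)) (cong toℕ (gg j)) q) }

lookup-injective : ∀ {A : Set} {xs : List A} → Unique xs → ∀ {i j} → lookup xs i ≡ lookup xs j → i ≡ j
lookup-injective (_ ∷ _)  {Fin.zero}  {Fin.zero}  _  = refl
lookup-injective (px ∷ _) {Fin.zero}  {Fin.suc j} eq = ⊥-elim (All.lookup px (∈-lookup j) eq)
lookup-injective (px ∷ _) {Fin.suc i} {Fin.zero}  eq = ⊥-elim (All.lookup px (∈-lookup i) (sym eq))
lookup-injective (_ ∷ u)  {Fin.suc i} {Fin.suc j} eq = cong Fin.suc (lookup-injective u eq)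

count-lower : ∀ n → central n ≤ numStronglyAvoiding132 n
count-lower n = subst (_≤ numStronglyAvoiding132 n) (length-codes n 0) (injective⇒≤ {f = place} place-injective)
  where
  open Enumerates (counted n)
  L = codes n 0
  valid : ∀ i → Valid (lookup L i)
  valid i = proj₁ (codes-sound n 0 (∈-lookup i))
  size≡ : ∀ i → size (lookup L i) ≡ n
  size≡ i = trans (proj₁ (proj₂ (codes-sound n 0 (∈-lookup i)))) (+-identityʳ n)
  strong : ∀ i → Strong n (fun (lookup L i)) (fun (lookup L i))
  strong i = subst (λ m → Strong m (fun (lookup L i)) (fun (lookup L i))) (size≡ i) (Good.strong (good (valid i)))
  place : Fin (length L) → Fin (numStronglyAvoiding132 n)
  place i = proj₁ (onto _ (restrictFin-counted (strong i)))
  place-injective : ∀ {i j} → place i ≡ place j → i ≡ j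
  place-injective {i} {j} eq = lookup-injective (codes-unique n 0)
      (fun-injective (valid i) (valid j) (trans (size≡ i) (sym (size≡ j))) λ {x} x<m → agree (finView (subst (x <_) (size≡ i) x<m)))
    where
    same : funToFin (restrictFin (strong i)) ≡ funToFin (restrictFin (strong j))
    same = trans (sym (proj₂ (onto _ (restrictFin-counted (strong i))))) (trans (cong at eq) (proj₂ (onto _ (restrictFin-counted (strong j)))))
    agree : ∀ {x} → FinView {n} x → fun (lookup L i) x ≡ fun (lookup L j) x
    agree (fin x) = trans (sym (toℕ-restrictFin (strong i) x)) (trans (cong toℕ (trans (sym (finToFun-funToFin (restrictFin (strong i)) x))
      (trans (cong (λ k → finToFun {n} {n} k x) same) (finToFun-funToFin (restrictFin (strong j)) x)))) (toℕ-restrictFin (strong j) x))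

-- Growth of (1 + 1/M)^n against n + 1

bernoulli : ∀ M m → M ^ m * (M + m) ≤ M * suc M ^ m
bernoulli M zero    = ≤-reflexive (trans (*-identityˡ (M + 0)) (trans (+-identityʳ M) (sym (*-identityʳ M))))
bernoulli M (suc m) = begin
  M * A * (M + suc m)     ≤⟨ m≤m+n _ (A * m) ⟩
  M * A * (M + suc m) + A * m ≡⟨ e₁ M A m ⟩
  suc M * (A * (M + m))   ≤⟨ *-monoʳ-≤ (suc M) (bernoulli M m) ⟩
  suc M * (M * B)         ≡⟨ e₂ M B ⟩
  M * (suc M * B)         ∎
  where
  open ≤-Reasoning
  A = M ^ m
  B = suc M ^ m
  e₁ : ∀ M a m → M * a * (M + suc m) + a * m ≡ suc M * (a * (M + m))
  e₁ = solve-∀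
  e₂ : ∀ M b → suc M * (M * b) ≡ M * (suc M * b)
  e₂ = solve-∀

^-distribʳ-* : ∀ a b n → (a * b) ^ n ≡ a ^ n * b ^ n
^-distribʳ-* a b zero    = refl
^-distribʳ-* a b (suc n) = trans (cong (a * b *_) (^-distribʳ-* a b n)) (e a b (a ^ n) (b ^ n))
  where
  e : ∀ a b x y → a * b * (x * y) ≡ a * x * (b * y)
  e = solve-∀

threshold : ℕ → ℕ
threshold M = 2 * (M * M) + 2 * (M * M)

-- At n = 2m with m = 2M², square Bernoulli's inequality; then induct on n.
exp-beats-linear : ∀ M k → .{{_ : NonZero M}} → let n = threshold M + k in suc n * M ^ n < suc M ^ n
exp-beats-linear M zero = subst (λ n → suc n * M ^ n < suc M ^ n) (sym (+-identityʳ (m + m)))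
    (*-cancelˡ-< (M * M) _ _ (begin-strict
      M * M * (suc (m + m) * M ^ (m + m))          ≡⟨ cong (λ v → M * M * (suc (m + m) * v)) (^-distribˡ-+-* M m m) ⟩
      M * M * (suc (m + m) * (A * A))                ≡⟨ e₁ M m A ⟩
      suc (m + m) * (M * M) * (A * A)                <⟨ *-monoˡ-< (A * A) {{m*n≢0 A A}} quadratic ⟩
      (M + m) * (M + m) * (A * A)                    ≡⟨ e₂ M m A ⟩
      A * (M + m) * (A * (M + m))                    ≤⟨ *-mono-≤ (bernoulli M m) (bernoulli M m) ⟩
      M * B * (M * B)                                ≡⟨ e₃ M B ⟩
      M * M * (B * B)                                ≡⟨ cong (M * M *_) (sym (^-distribˡ-+-* (suc M) m m)) ⟩
      M * M * suc M ^ (m + m)                      ∎))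
  where
  open ≤-Reasoning
  m = 2 * (M * M)
  A = M ^ m
  B = suc M ^ m
  instance _ = m^n≢0 M m
  e₁ : ∀ M m a → M * M * (suc (m + m) * (a * a)) ≡ suc (m + m) * (M * M) * (a * a)
  e₁ = solve-∀
  e₂ : ∀ M m a → (M + m) * (M + m) * (a * a) ≡ a * (M + m) * (a * (M + m))
  e₂ = solve-∀
  e₃ : ∀ M b → M * b * (M * b) ≡ M * M * (b * b)
  e₃ = solve-∀
  e₄ : ∀ M → suc (2 * (M * M) + 2 * (M * M)) * (M * M) + 4 * (M * (M * M)) ≡ (M + 2 * (M * M)) * (M + 2 * (M * M))
  e₄ = solve-∀
  quadratic : suc (m + m) * (M * M) < (M + m) * (M + m)
  quadratic = subst (suc (m + m) * (M * M) <_) (e₄ M)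
    (m<m+n (suc (m + m) * (M * M)) (>-nonZero⁻¹ (4 * (M * (M * M))) {{m*n≢0 4 (M * (M * M)) {{it}} {{m*n≢0 M (M * M) {{it}} {{m*n≢0 M M}}}}}}))
-- The step needs (n + 2) M ≤ (M + 1)(n + 1), that is M ≤ n + 1.
exp-beats-linear M (suc k) = subst (λ n → suc n * M ^ n < suc M ^ n) (sym (+-suc (threshold M) k)) (begin-strict
  (2 + n) * (M * A)      ≤⟨ ≤-trans (m≤m+n _ (A * (suc n ∸ M))) (≤-reflexive (trans (e₁ n M A (suc n ∸ M)) (cong (λ v → (M * suc n + v) * A) (m+[n∸m]≡n M≤1+n)))) ⟩
  (M * suc n + suc n) * A ≡⟨ e₂ n M A ⟩
  suc M * (suc n * A)    <⟨ *-monoʳ-< (suc M) (exp-beats-linear M k) ⟩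
  suc M * suc M ^ n    ∎)
  where
  open ≤-Reasoning
  n = threshold M + k
  A = M ^ n
  e₁ : ∀ n M a d → (2 + n) * (M * a) + a * d ≡ (M * suc n + (M + d)) * a
  e₁ = solve-∀
  e₂ : ∀ n M a → (M * suc n + suc n) * a ≡ suc M * (suc n * a)
  e₂ = solve-∀
  M≤1+n : M ≤ suc n
  M≤1+n = m≤n⇒m≤1+n (≤-trans (m≤m*n M M) (≤-trans (m≤n*m (M * M) 2) (≤-trans (m≤m+n (2 * (M * M)) (2 * (M * M))) (m≤m+n (threshold M) k))))

count-small : ∀ n → large ≤ n → numStronglyAvoiding132 n < 2 ^ n
count-small n big = ≤-<-trans (count-upper (strong-covers n)) (majorant-small n big)

-- This bounds the n-th root below by 2M / (M + 1): the factor n + 1 lost in `central-lower` is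
-- absorbed by ((M + 1) / M)^n.
count-large : ∀ M n → .{{_ : NonZero M}} → threshold M ≤ n →
              (2 * M) ^ n < numStronglyAvoiding132 n * suc M ^ n
count-large M n big = begin-strict
  (2 * M) ^ n                   ≡⟨ ^-distribʳ-* 2 M n ⟩
  2 ^ n * M ^ n               ≤⟨ *-monoˡ-≤ (M ^ n) (central-lower n) ⟩
  suc n * central n * M ^ n     ≡⟨ e (suc n) (central n) (M ^ n) ⟩
  central n * (suc n * M ^ n)   <⟨ *-monoʳ-< (central n) {{>-nonZero (central>0 n)}}
                                       (subst (λ n → suc n * M ^ n < suc M ^ n) (m+[n∸m]≡n big) (exp-beats-linear M (n ∸ threshold M))) ⟩
  central n * suc M ^ n         ≤⟨ *-monoˡ-≤ (suc M ^ n) (count-lower n) ⟩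
  numStronglyAvoiding132 n * suc M ^ n ∎
  where
  open ≤-Reasoning
  e : ∀ a b c → a * b * c ≡ b * (a * c)
  e = solve-∀

root-lower-bound : ∀ {q M a n} → 0ℚ ℚ.≤ q → q ℚ.* fromℕ (suc M) ℚ.≤ fromℕ (2 * M) →
                   (2 * M) ^ n < a * suc M ^ n → q ^ℚ n ℚ.< fromℕ a
root-lower-bound {q} {M} {a} {n} 0≤q q≤ h = ℚ.*-cancelʳ-<-nonNeg (fromℕ (suc M ^ n)) {{nonNegative (fromℕ-nonNeg (suc M ^ n))}}
  (ℚ.≤-<-trans (^-scale (suc M) (2 * M) n 0≤q q≤)
    (subst (fromℕ ((2 * M) ^ n) ℚ.<_) (fromℕ-* a (suc M ^ n)) (fromℕ-mono-< h)))

corollary4p4 : HasGrowthRate numStronglyAvoiding132 (fromℕ 2)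
    × (∃[ N ] (∀ n → N ≤ n → numStronglyAvoiding132 n < 2 ℕ.^ n))
corollary4p4 = growth , (large , count-small)
  where
  growth : HasGrowthRate numStronglyAvoiding132 (fromℕ 2)
  growth ε 0<ε = from (archimedean ε 0<ε)
    where
    q = fromℕ 2 ℚ.- ε
    2<2+ε : fromℕ 2 ℚ.< fromℕ 2 ℚ.+ ε
    2<2+ε = subst (ℚ._< fromℕ 2 ℚ.+ ε) (ℚ.+-identityʳ (fromℕ 2)) (ℚ.+-monoʳ-< (fromℕ 2) 0<ε)
    0<2+ε : 0ℚ ℚ.< fromℕ 2 ℚ.+ ε
    0<2+ε = ℚ.≤-<-trans (fromℕ-nonNeg 2) 2<2+ε
    lower : ∀ d n → threshold (suc (d + d)) ≤ n → 1ℚ ℚ.≤ ε ℚ.* fromℕ (suc d) → Dec (q ℚ.< 0ℚ) →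
            q ℚ.< 0ℚ ⊎ q ^ℚ n ℚ.< fromℕ (numStronglyAvoiding132 n)
    lower d n big 1≤εd (yes q<0) = inj₁ q<0
    lower d n big 1≤εd (no q≮0)  = inj₂ (root-lower-bound {q} {suc (d + d)} {numStronglyAvoiding132 n} {n}
      (ℚ.≮⇒≥ q≮0) (2-ε-bound ε d 1≤εd) (count-large (suc (d + d)) n big))
    upper : ∀ n → large ≤ n → fromℕ (numStronglyAvoiding132 n) ℚ.< (fromℕ 2 ℚ.+ ε) ^ℚ n
    upper n big = ℚ.<-≤-trans (fromℕ-mono-< {numStronglyAvoiding132 n} {2 ^ n} (count-small n big))
      (fromℕ-^-≤ 2 n (ℚ.<⇒≤ 2<2+ε))
    from : ∃[ d ] (1ℚ ℚ.≤ ε ℚ.* fromℕ (suc d)) → ∃[ N ] (∀ n → .{{_ : NonZero n}} → N ≤ n →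
             (q ℚ.< 0ℚ ⊎ q ^ℚ n ℚ.< fromℕ (numStronglyAvoiding132 n)) ×
             (0ℚ ℚ.< fromℕ 2 ℚ.+ ε × fromℕ (numStronglyAvoiding132 n) ℚ.< (fromℕ 2 ℚ.+ ε) ^ℚ n))
    from (d , 1≤εd) = threshold (suc (d + d)) + large , λ n N≤n →
      lower d n (≤-trans (m≤m+n (threshold (suc (d + d))) large) N≤n) 1≤εd (q ℚ.<? 0ℚ) ,
      (0<2+ε , upper n (≤-trans (m≤n+m large (threshold (suc (d + d)))) N≤n))
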